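{- The values $b_{200}(25(5n+2)-26)$ and $p_{17}(5n+2)$ have the same parity for almost all $n\ge0$, and likewise $b_{200}(25(5n+4)-26)$ and $p_{17}(5n+4)$ have the same parity for almost all $n\ge 0$; here "almost all" means that the set of $n$ for which the parities differ has natural density zero.
   Context: $b_{200}(n)$ denotes the number of partitions of $n$ none of whose parts is divisible by $200$; equivalently $\sum_{n\ge0} b_{200}(n)q^n = \prod_{i\ge1}(1-q^{200i})/(1-q^i)$. $p_{17}(n)$ denotes the number of $17$-multipartitions of $n$, with $\sum_{n\ge0}p_{17}(n)q^n=\prod_{i\ge1}(1-q^i)^{ -17}$. -}

module Defs where

open import Data.Nat as ℕ using (ℕ; zero; suc; _∸_; _%_; _≤_)
open import Data.Integer as ℤ using (ℤ; +_; -_; ∣_∣)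
open import Data.Bool using (Bool; true; false; if_then_else_)
open import Data.Product using (∃-syntax)
open import Relation.Nullary.Decidable using (⌊_⌋)

-- Formal power series in q with integer coefficients: n ↦ coefficient of q^n.
Series : Set
Series = ℕ → ℤ

sumTo : ℕ → (ℕ → ℤ) → ℤ
sumTo zero    f = f 0
sumTo (suc n) f = sumTo n f ℤ.+ f (suc n)

_⊛_ : Series → Series → Series
(f ⊛ g) n = sumTo n (λ k → f k ℤ.* g (n ∸ k))

oneS : Series
oneS zero    = + 1
oneS (suc _) = + 0

_^S_ : Series → ℕ → Series
f ^S zero  = oneS
f ^S suc k = f ⊛ (f ^S k)

-- 1 / (1 - q^(j+1)) = Σ_m q^{(j+1) m}
geomS : ℕ → Series
geomS j m = if ⌊ m % suc j ℕ.≟ 0 ⌋ then + 1 else + 0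

-- 1 - q^d  (intended for d ≥ 1)
oneMinusS : ℕ → Series
oneMinusS d m =
  if ⌊ m ℕ.≟ 0 ⌋ then + 1 else (if ⌊ m ℕ.≟ d ⌋ then - (+ 1) else + 0)

prodS : ℕ → (ℕ → Series) → Series
prodS zero    F = oneS
prodS (suc N) F = prodS N F ⊛ F (suc N)

-- coefficient of q^n in an infinite product ∏_{i≥1} F i, where every factor
-- F i ≡ 1 mod q^i: it equals the coefficient of the finite product up to i = n.
coeffInfProd : (ℕ → Series) → ℕ → ℤ
coeffInfProd F n = prodS n F n

b200 : ℕ → ℤ
b200 = coeffInfProd (λ i → oneMinusS (200 ℕ.* i) ⊛ geomS (i ∸ 1))

p17 : ℕ → ℤ
p17 = coeffInfProd (λ i → geomS (i ∸ 1) ^S 17)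

parity : ℤ → ℕ
parity z = ∣ z ∣ % 2

count : (ℕ → Bool) → ℕ → ℕ
count f zero    = 0
count f (suc x) = (if f x then 1 else 0) ℕ.+ count f x

-- the set {n | f n = true} has natural density zero:
-- for every ε = 1/(k+1) there is N with count f x ≤ ε x for all x ≥ N.
DensityZero : (ℕ → Bool) → Set
DensityZero f = ∀ (k : ℕ) → ∃[ N ] (∀ (x : ℕ) → N ≤ x → suc k ℕ.* count f x ≤ x)

parityDiffers : (ℕ → ℤ) → (ℕ → ℤ) → ℕ → Bool
parityDiffers a b n = if ⌊ parity (a n) ℕ.≟ parity (b n) ⌋ then false else true

{-# OPTIONS --safe #-}

-- Work modulo 2 with E = ∏ (1 - qⁱ). Then E = Σ qᵐ over 24 m + 1 = r² (Euler), and comparing the solutions of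
-- r² + c s² = (1 + c) M with those of x² + c y² = M for c = 2 and c = 5 yields E³ = Σ qᵐ over 8 m + 1 = r² and the
-- identity E⁶ + q E(q⁵)⁶ = E E(q⁵). Dissecting this identity along E = A(q⁵) + q E(q²⁵) + q² C(q⁵) gives
-- A C = E(q⁵)² and E = A⁵ + q² C⁵, which allow the sections modulo 25 of E(q²⁵)⁸ / E, the generating function of
-- b₂₀₀, to be computed: b₂₀₀(25 m - 26) + p₁₇(m) is the coefficient of qᵐ in E¹³ / E(q⁵)⁶. Its sections at
-- m = 5 n + 2 and m = 5 n + 4 are A E⁶ and C E⁶, so the parities differ exactly when N = 120 n + 31, respectively
-- N = 120 n + 79, has an odd number of representations as 30 x² + y².
--
-- There is one class of forms per genus in discriminant -120 and N lies in the principal genus. A primitive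
-- representation of N / g² is therefore moved to another one by multiplying y / x by a square root of 1 modulo
-- N / g² other than ±1, and such a root exists unless N / g² is a prime power. Hence the number of representations is
-- even unless N = p s² with p prime, and by Chebyshev's bound for the number of primes these N have density zero.

module Submission where

open import Algebra.Bundles using (CommutativeRing; RawRing)
import Algebra.Solver.Ring as RingSolver
open import Algebra.Solver.Ring.AlmostCommutativeRing using (fromCommutativeRing; _-Raw-AlmostCommutative⟶_)
open import Data.Bool.Base using (Bool; true; false; _∧_; _xor_; not; if_then_else_; _∨_)
import Data.Bool.Properties as Boolₚ
open import Data.Bool.Solver using (module xor-∧-Solver)
open import Data.Empty using (⊥; ⊥-elim)
open import Data.Integer as ℤ using (ℤ; +_; -[1+_]; ∣_∣; _⊖_)
import Data.Integer.Divisibility.Signed as ℤ∣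
import Data.Integer.Properties as ℤₚ
import Data.Integer.Tactic.RingSolver as ℤSolver
open import Data.List.Base using (List; []; _∷_; _++_; map; upTo; applyUpTo; cartesianProduct)
open import Data.List.Membership.Propositional using (_∈_)
open import Data.List.Membership.Propositional.Properties using (∈-map⁺; ∈-++⁺ˡ; ∈-++⁺ʳ; ∈-cartesianProduct⁺; ∈-upTo⁺; ∈-map⁻; ∈-++⁻; ∈-upTo⁻)
open import Data.List.Relation.Unary.All as All using (All; []; _∷_)
open import Data.List.Relation.Unary.AllPairs using ([]; _∷_)
open import Data.List.Relation.Unary.Any using (here; there)
open import Data.List.Relation.Unary.Unique.Propositional using (Unique)
import Data.List.Relation.Unary.Unique.Propositional.Properties as Unique
open import Data.Maybe.Base using (Maybe; just; nothing)
open import Data.Nat as ℕ using (ℕ; zero; suc; _+_; _*_; _∸_; _^_; _≤_; _<_; z≤n; s≤s; _≟_; _%_; _≤′_; ≤′-refl; ≤′-step; NonZero; _<′_; _≤?_; _/_; _!)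
open import Data.Nat.Combinatorics using (nCk≡n!/k![n-k]!; k![n∸k]!∣n!; nCk+nC[k+1]≡[n+1]C[k+1]; nCk≡nC[n∸k]; nCn≡1; k>n⇒nCk≡0) renaming (_C_ to _choose_)
open import Data.Nat.Coprimality as Coprimality using (Coprime; coprime-divisor; coprime-Bézout; coprime-factors)
open import Data.Nat.DivMod using ([m+n]%n≡m%n; m<n⇒m%n≡m; [m+kn]%n≡m%n; m≡m%n+[m/n]*n; m%n<n; %-distribˡ-*; m*n%n≡0; m%n%n≡m%n; /-congʳ; m/n*n≡m; m*n/n≡m; m/n*n≤m; /-monoˡ-≤)
open import Data.Nat.Divisibility as ℕ∣ using (divides; _∣?_; ∣-trans; ∣-antisym; ∣1⇒≡1; ∣m+n∣m⇒∣n; ∣n⇒∣m*n; m≤n⇒m!∣n!) renaming (_∣_ to _∣ⁿ_)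
open import Data.Nat.GCD using (gcd; gcd[m,n]∣m; gcd[m,n]∣n; gcd-greatest; module Bézout)
open import Data.Nat.Induction using (<-rec)
open import Data.Nat.ListAction using (product)
open import Data.Nat.Primality using (Prime; prime?; prime⇒nonZero; prime⇒irreducible; euclidsLemma; prime[2]; prime⇒nonTrivial)
open import Data.Nat.Primality.Factorisation using (factorise; module PrimeFactorisation)
import Data.Nat.Properties as ℕₚ
open import Data.Nat.Tactic.RingSolver using (solve-∀)
open import Data.Product using (_,_; _×_; ∃-syntax; proj₁; proj₂)
import Data.Product.Properties as Productₚ
open import Data.Sum using (_⊎_; inj₁; inj₂)
import Data.Sum.Properties as Sumₚ
open import Defs
open import Function.Bundles using (mk⇔)
open import Level using (0ℓ)
open import Relation.Binary.Definitions using (DecidableEquality; tri<; tri≈; tri>)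
open import Relation.Binary.PropositionalEquality using (_≡_; refl; sym; trans; cong; cong₂; subst; module ≡-Reasoning; _≢_; subst₂)
import Relation.Binary.Reasoning.Setoid as SetoidReasoning
open import Relation.Nullary using (¬_; Dec; yes; no; does; contradiction)
open import Relation.Nullary.Decidable using (dec-true; dec-false; ⌊_⌋; does-⇔)
open ℤ∣ using () renaming (_∣_ to _∣ᶻ_; divides to dividesᶻ)

-- Power series over the field with two elements

-- The two values of c rest on (x - c y)² + c (x + y)² = (1 + c)(x² + c y²). The roots of 1 + 24 i
-- are ±1 modulo 6, so the sign of s can be chosen with r = s modulo 6, and if 1 + c divides 6 then
-- x and y can be recovered from r and s; if moreover 3 divides 1 + c, that sign is unique unless 3
-- divides r. This leaves c = 2 and c = 5. Division by E is replaced by multiplication with its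
-- conjugates over F₂[[q⁵]]: E times the remaining conjugates is its norm, a series in q⁵, and
-- multiplication by such a series commutes with taking sections. The relation A C = B² makes the
-- norm short enough for all later identities to be polynomial ones. Parities are computed from
-- matchings, given as relations and not as involutions defined by functions: a partner is only
-- known to exist (as a square root, or through the reduction of a form), while the equation or
-- congruence that characterises it is easily seen to be symmetric and to determine it.

F₂[[q]] : Set
F₂[[q]] = ℕ → Bool

infix 4 _≈_
record _≈_ (f g : F₂[[q]]) : Set where
  constructor pointwise
  field at : ∀ n → f n ≡ g n
open _≈_ public

≈-refl : ∀ {f} → f ≈ f
≈-refl = pointwise λ _ → refl

≈-sym : ∀ {f g} → f ≈ g → g ≈ f
≈-sym p = pointwise λ n → sym (at p n)

≈-trans : ∀ {f g h} → f ≈ g → g ≈ h → f ≈ h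
≈-trans p r = pointwise λ n → trans (at p n) (at r n)

tl : F₂[[q]] → F₂[[q]]
tl f n = f (suc n)

𝟘 𝟙 q : F₂[[q]]
𝟘 _ = false
𝟙 zero    = true
𝟙 (suc _) = false
q zero    = false
q (suc n) = 𝟙 n

xor-rotate : ∀ x y {z} a b c d → x xor y ≡ z → x xor (a xor (b xor (c xor (d xor y)))) ≡ z xor (a xor (b xor (c xor d)))
xor-rotate x y a b c d refl =
  solve 6 (λ x y a b c d → x :+ (a :+ (b :+ (c :+ (d :+ y)))) := (x :+ y) :+ (a :+ (b :+ (c :+ d)))) refl x y a b c d
  where open xor-∧-Solver

xor-middle : ∀ a b c d → (a xor b) xor (c xor d) ≡ (a xor c) xor (b xor d)
xor-middle a b c d = begin
  (a xor b) xor (c xor d)  ≡⟨ Boolₚ.xor-assoc a b (c xor d) ⟩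
  a xor (b xor (c xor d))  ≡⟨ cong (a xor_) (sym (Boolₚ.xor-assoc b c d)) ⟩
  a xor ((b xor c) xor d)  ≡⟨ cong (λ t → a xor (t xor d)) (Boolₚ.xor-comm b c) ⟩
  a xor ((c xor b) xor d)  ≡⟨ cong (a xor_) (Boolₚ.xor-assoc c b d) ⟩
  a xor (c xor (b xor d))  ≡⟨ sym (Boolₚ.xor-assoc a c (b xor d)) ⟩
  (a xor c) xor (b xor d)  ∎
  where open ≡-Reasoning

xor-swap : ∀ a b c → a xor (b xor c) ≡ b xor (a xor c)
xor-swap a b c = trans (sym (Boolₚ.xor-assoc a b c)) (trans (cong (_xor c) (Boolₚ.xor-comm a b)) (Boolₚ.xor-assoc b a c))

infixl 6 _⊕_
infixl 7 _⊗_

-- Opaque, so that unification treats the operations as injective.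
opaque
  _⊕_ : F₂[[q]] → F₂[[q]] → F₂[[q]]
  (f ⊕ g) n = f n xor g n

  -- The Cauchy product by recursion on the left factor, so that inductions on the exponent never
  -- meet the truncated subtraction of `_⊛_`.
  _⊗_ : F₂[[q]] → F₂[[q]] → F₂[[q]]
  (f ⊗ g) zero    = f 0 ∧ g 0
  (f ⊗ g) (suc n) = (f 0 ∧ g (suc n)) xor (tl f ⊗ g) n

  ⊕-at : ∀ f g n → (f ⊕ g) n ≡ f n xor g n
  ⊕-at f g n = refl

  ⊗-at-zero : ∀ f g → (f ⊗ g) 0 ≡ f 0 ∧ g 0
  ⊗-at-zero f g = refl

  ⊗-cong′ : ∀ {f f′ g g′} → (∀ n → f n ≡ f′ n) → (∀ n → g n ≡ g′ n) → ∀ n → (f ⊗ g) n ≡ (f′ ⊗ g′) n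
  ⊗-cong′ p r zero    = cong₂ _∧_ (p 0) (r 0)
  ⊗-cong′ p r (suc n) = cong₂ _xor_ (cong₂ _∧_ (p 0) (r (suc n))) (⊗-cong′ (λ i → p (suc i)) r n)

  ⊗-zeroˡ′ : ∀ f n → (𝟘 ⊗ f) n ≡ false
  ⊗-zeroˡ′ f zero    = refl
  ⊗-zeroˡ′ f (suc n) = ⊗-zeroˡ′ f n

  ⊗-identityˡ′ : ∀ f n → (𝟙 ⊗ f) n ≡ f n
  ⊗-identityˡ′ f zero    = refl
  ⊗-identityˡ′ f (suc n) = trans (cong (f (suc n) xor_) (⊗-zeroˡ′ f n)) (Boolₚ.xor-identityʳ _)

  ⊗-tlʳ : ∀ f g n → (f ⊗ g) (suc n) ≡ (f (suc n) ∧ g 0) xor (f ⊗ tl g) n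
  ⊗-tlʳ f g zero    = Boolₚ.xor-comm (f 0 ∧ g 1) (f 1 ∧ g 0)
  ⊗-tlʳ f g (suc n) = trans (cong ((f 0 ∧ g (suc (suc n))) xor_) (⊗-tlʳ (tl f) g n)) (xor-swap (f 0 ∧ g (suc (suc n))) (f (suc (suc n)) ∧ g 0) ((tl f ⊗ tl g) n))

  ⊗-comm′ : ∀ f g n → (f ⊗ g) n ≡ (g ⊗ f) n
  ⊗-comm′ f g zero    = Boolₚ.∧-comm (f 0) (g 0)
  ⊗-comm′ f g (suc n) = begin
    (f 0 ∧ g (suc n)) xor (tl f ⊗ g) n  ≡⟨ cong₂ _xor_ (Boolₚ.∧-comm (f 0) _) (⊗-comm′ (tl f) g n) ⟩
    (g (suc n) ∧ f 0) xor (g ⊗ tl f) n  ≡⟨ sym (⊗-tlʳ g f n) ⟩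
    (g ⊗ f) (suc n)                     ∎
    where open ≡-Reasoning

  ⊗-distribʳ-⊕ : ∀ h f g n → ((f ⊕ g) ⊗ h) n ≡ (f ⊗ h) n xor (g ⊗ h) n
  ⊗-distribʳ-⊕ h f g zero    = Boolₚ.∧-distribʳ-xor (h 0) (f 0) (g 0)
  ⊗-distribʳ-⊕ h f g (suc n) = trans
    (cong₂ _xor_ (Boolₚ.∧-distribʳ-xor (h (suc n)) (f 0) (g 0)) (⊗-distribʳ-⊕ h (tl f) (tl g) n))
    (xor-middle (f 0 ∧ h (suc n)) (g 0 ∧ h (suc n)) ((tl f ⊗ h) n) ((tl g ⊗ h) n))

  ⊗-scale : ∀ b f g n → ((λ i → b ∧ f i) ⊗ g) n ≡ b ∧ (f ⊗ g) n
  ⊗-scale b f g zero    = Boolₚ.∧-assoc b (f 0) (g 0)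
  ⊗-scale b f g (suc n) = begin
    ((b ∧ f 0) ∧ g (suc n)) xor ((λ i → b ∧ f (suc i)) ⊗ g) n
      ≡⟨ cong₂ _xor_ (Boolₚ.∧-assoc b (f 0) _) (⊗-scale b (tl f) g n) ⟩
    (b ∧ (f 0 ∧ g (suc n))) xor (b ∧ (tl f ⊗ g) n)
      ≡⟨ sym (Boolₚ.∧-distribˡ-xor b _ _) ⟩
    b ∧ ((f ⊗ g) (suc n)) ∎
    where open ≡-Reasoning

  ⊗-assoc′ : ∀ f g h n → ((f ⊗ g) ⊗ h) n ≡ (f ⊗ (g ⊗ h)) n
  ⊗-assoc′ f g h zero    = Boolₚ.∧-assoc (f 0) (g 0) (h 0)
  ⊗-assoc′ f g h (suc n) = begin
    ((f 0 ∧ g 0) ∧ h (suc n)) xor (((λ i → f 0 ∧ g (suc i)) ⊕ (tl f ⊗ g)) ⊗ h) n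
      ≡⟨ cong₂ _xor_ (Boolₚ.∧-assoc (f 0) (g 0) _) (⊗-distribʳ-⊕ h (λ i → f 0 ∧ g (suc i)) (tl f ⊗ g) n) ⟩
    (f 0 ∧ (g 0 ∧ h (suc n))) xor (((λ i → f 0 ∧ g (suc i)) ⊗ h) n xor ((tl f ⊗ g) ⊗ h) n)
      ≡⟨ cong₂ (λ s t → (f 0 ∧ (g 0 ∧ h (suc n))) xor (s xor t)) (⊗-scale (f 0) (tl g) h n) (⊗-assoc′ (tl f) g h n) ⟩
    (f 0 ∧ (g 0 ∧ h (suc n))) xor ((f 0 ∧ (tl g ⊗ h) n) xor (tl f ⊗ (g ⊗ h)) n)
      ≡⟨ sym (Boolₚ.xor-assoc (f 0 ∧ (g 0 ∧ h (suc n))) (f 0 ∧ (tl g ⊗ h) n) _) ⟩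
    ((f 0 ∧ (g 0 ∧ h (suc n))) xor (f 0 ∧ (tl g ⊗ h) n)) xor (tl f ⊗ (g ⊗ h)) n
      ≡⟨ cong (_xor (tl f ⊗ (g ⊗ h)) n) (sym (Boolₚ.∧-distribˡ-xor (f 0) (g 0 ∧ h (suc n)) ((tl g ⊗ h) n))) ⟩
    (f ⊗ (g ⊗ h)) (suc n) ∎
    where open ≡-Reasoning

  ⊕-cong′ : ∀ {f f′ g g′} → f ≈ f′ → g ≈ g′ → f ⊕ g ≈ f′ ⊕ g′
  ⊕-cong′ p r = pointwise λ n → cong₂ _xor_ (at p n) (at r n)

  ⊕-assoc′ : ∀ f g h → (f ⊕ g) ⊕ h ≈ f ⊕ (g ⊕ h)
  ⊕-assoc′ f g h = pointwise λ n → Boolₚ.xor-assoc (f n) (g n) (h n)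

  ⊕-comm′ : ∀ f g → f ⊕ g ≈ g ⊕ f
  ⊕-comm′ f g = pointwise λ n → Boolₚ.xor-comm (f n) (g n)

  ⊕-identityˡ′ : ∀ f → 𝟘 ⊕ f ≈ f
  ⊕-identityˡ′ f = pointwise λ n → refl

  ⊕-self : ∀ f → f ⊕ f ≈ 𝟘
  ⊕-self f = pointwise λ n → Boolₚ.xor-same (f n)

  ⊗-distribʳ′ : ∀ h f g → (f ⊕ g) ⊗ h ≈ f ⊗ h ⊕ g ⊗ h
  ⊗-distribʳ′ h f g = pointwise (⊗-distribʳ-⊕ h f g)

  ⊗-distribˡ′ : ∀ h f g → h ⊗ (f ⊕ g) ≈ h ⊗ f ⊕ h ⊗ g
  ⊗-distribˡ′ h f g = pointwise λ n → trans (⊗-comm′ h (f ⊕ g) n)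
    (trans (⊗-distribʳ-⊕ h f g n) (cong₂ _xor_ (⊗-comm′ f h n) (⊗-comm′ g h n)))

F₂[[q]]-ring : CommutativeRing 0ℓ 0ℓ
F₂[[q]]-ring = record
  { Carrier = F₂[[q]]
  ; _≈_ = _≈_
  ; _+_ = _⊕_
  ; _*_ = _⊗_
  ; -_ = λ f → f
  ; 0# = 𝟘
  ; 1# = 𝟙
  ; isCommutativeRing = record
    { isRing = record
      { +-isAbelianGroup = record
        { isGroup = record
          { isMonoid = record
            { isSemigroup = record
              { isMagma = record
                { isEquivalence = record { refl = ≈-refl ; sym = ≈-sym ; trans = ≈-trans }
                ; ∙-cong = ⊕-cong′ }
              ; assoc = ⊕-assoc′ }
            ; identity = ⊕-identityˡ′ , λ f → ≈-trans (⊕-comm′ f 𝟘) (⊕-identityˡ′ f) }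
          ; inverse = ⊕-self , ⊕-self
          ; ⁻¹-cong = λ p → p }
        ; comm = ⊕-comm′ }
      ; *-cong = λ p r → pointwise (⊗-cong′ (at p) (at r))
      ; *-assoc = λ f g h → pointwise (⊗-assoc′ f g h)
      ; *-identity = (λ f → pointwise (⊗-identityˡ′ f)) , (λ f → pointwise λ n → trans (⊗-comm′ f 𝟙 n) (⊗-identityˡ′ f n))
      ; distrib = ⊗-distribˡ′ , ⊗-distribʳ′ }
    ; *-comm = λ f g → pointwise (⊗-comm′ f g) } }

-- Coordinates over F₂[[q⁵]] of a series with respect to 1, q, q², q³, q⁴, each coordinate read as a
-- series in q; t is the series q⁵ read this way, that is q itself.
record Five {ℓ} (X : Set ℓ) : Set ℓ where
  constructor ⟨_,_,_,_,_⟩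
  field c₀ c₁ c₂ c₃ c₄ : X
open Five public

-- Abstract in the operations, so that the same formulas serve for series and, inside the solver,
-- for polynomials.
module FiveOps {ℓ} {X : Set ℓ} (_+_ _*_ : X → X → X) (_² : X → X) (t : X) where
  infixl 7 _⋆_

  _⋆_ : Five X → Five X → Five X
  ⟨ a₀ , a₁ , a₂ , a₃ , a₄ ⟩ ⋆ ⟨ b₀ , b₁ , b₂ , b₃ , b₄ ⟩ =
    ⟨ (a₀ * b₀) + (t * ((((a₁ * b₄) + (a₂ * b₃)) + (a₃ * b₂)) + (a₄ * b₁)))
    , ((a₀ * b₁) + (a₁ * b₀)) + (t * (((a₂ * b₄) + (a₃ * b₃)) + (a₄ * b₂)))
    , (((a₀ * b₂) + (a₁ * b₁)) + (a₂ * b₀)) + (t * ((a₃ * b₄) + (a₄ * b₃)))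
    , ((((a₀ * b₃) + (a₁ * b₂)) + (a₂ * b₁)) + (a₃ * b₀)) + (t * (a₄ * b₄))
    , ((((a₀ * b₄) + (a₁ * b₃)) + (a₂ * b₂)) + (a₃ * b₁)) + (a₄ * b₀) ⟩

  -- Squaring in characteristic 2 doubles exponents: the coordinate of q³ moves to q⁶ = t q and that
  -- of q⁴ to q⁸ = t q³.
  frobenius : Five X → Five X
  frobenius ⟨ a₀ , a₁ , a₂ , a₃ , a₄ ⟩ = ⟨ a₀ ² , t * (a₃ ²) , a₁ ² , t * (a₄ ²) , a₂ ² ⟩

  -- (a⁵ + t b⁵ + t² c⁵) / (a + q b + q² c) for t = q⁵ and ac = b².
  cofactor : X → X → X → Five X
  cofactor a b c = ⟨ ((a ²) ²) + (t * ((b ²) * (b * c))) , (a ²) * (a * b) , t * (b * ((c ²) * c))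
                   , (a * ((b ²) * b)) + (t * ((c ²) ²)) , (b ²) ² ⟩

-- A ring of characteristic 2, abstract so that the solver never unfolds the series operations.
module Char2 {c ℓ} (R : CommutativeRing c ℓ)
             (1+1≈0 : CommutativeRing._≈_ R (CommutativeRing._+_ R (CommutativeRing.1# R) (CommutativeRing.1# R)) (CommutativeRing.0# R)) where
  open CommutativeRing R renaming (Carrier to C; _+_ to _⊞_; _*_ to _⊠_; _≈_ to _≋_; refl to ≋-refl; sym to ≋-sym; trans to ≋-trans; zero to *-zero)
  private
    coeff : RawRing 0ℓ 0ℓ
    coeff = record { Carrier = Bool ; _≈_ = _≡_ ; _+_ = _xor_ ; _*_ = _∧_ ; -_ = λ b → b ; 0# = false ; 1# = true }

    ⟦_⟧c : Bool → C
    ⟦ true  ⟧c = 1#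
    ⟦ false ⟧c = 0#

    -1≈1 : 1# ≋ - 1#
    -1≈1 = ≋-trans (≋-sym (+-identityˡ _)) (≋-trans (+-congʳ (≋-sym (-‿inverseˡ 1#)))
             (≋-trans (+-assoc _ _ _) (≋-trans (+-congˡ 1+1≈0) (+-identityʳ _))))
    open import Algebra.Properties.Ring ring using (-0#≈0#)

    morphism : coeff -Raw-AlmostCommutative⟶ fromCommutativeRing R
    morphism = record
      { ⟦_⟧ = ⟦_⟧c
      ; +-homo = λ { true true → ≋-sym 1+1≈0 ; true false → ≋-sym (+-identityʳ _) ; false y → ≋-sym (+-identityˡ _) }
      ; *-homo = λ { true y → ≋-sym (*-identityˡ _) ; false y → ≋-sym (zeroˡ _) }
      ; -‿homo = λ { true → -1≈1 ; false → ≋-sym -0#≈0# }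
      ; 0-homo = ≋-refl
      ; 1-homo = ≋-refl }

    _coeff≟_ : ∀ a b → Maybe (⟦ a ⟧c ≋ ⟦ b ⟧c)
    true  coeff≟ true  = just ≋-refl
    false coeff≟ false = just ≋-refl
    _     coeff≟ _     = nothing

  open RingSolver coeff (fromCommutativeRing R) morphism _coeff≟_ public
  open import Algebra.Properties.Semiring.Exp semiring public using () renaming (_^_ to _↑_; ^-homo-* to ↑-homo-+)


  -- The solver knows no hypotheses. An identity that holds only modulo d = 0 is therefore given to
  -- it as the exact identity x = y + d z with an explicit quotient z.
  vanishing : ∀ {x y d} z → d ≋ 0# → x ≋ y ⊞ d ⊠ z → x ≋ y
  vanishing {x} {y} {d} z d≈0 eq = ≋-trans eq (≋-trans (+-congˡ (≋-trans (*-congʳ d≈0) (zeroˡ z))) (+-identityʳ y))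


  gather-1 : ∀ a b c d e t → a ⊞ (t ⊠ b ⊞ (t ⊠ c ⊞ (t ⊠ d ⊞ (t ⊠ e)))) ≋ a ⊞ t ⊠ (b ⊞ c ⊞ d ⊞ e)
  gather-1 = solve 6 (λ a b c d e t → a :+ (t :* b :+ (t :* c :+ (t :* d :+ (t :* e)))) := a :+ t :* (b :+ c :+ d :+ e)) ≋-refl

  gather-2 : ∀ a b c d e t → a ⊞ (b ⊞ (t ⊠ c ⊞ (t ⊠ d ⊞ (t ⊠ e)))) ≋ a ⊞ b ⊞ t ⊠ (c ⊞ d ⊞ e)
  gather-2 = solve 6 (λ a b c d e t → a :+ (b :+ (t :* c :+ (t :* d :+ (t :* e)))) := a :+ b :+ t :* (c :+ d :+ e)) ≋-refl

  gather-3 : ∀ a b c d e t → a ⊞ (b ⊞ (c ⊞ (t ⊠ d ⊞ (t ⊠ e)))) ≋ a ⊞ b ⊞ c ⊞ t ⊠ (d ⊞ e)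
  gather-3 = solve 6 (λ a b c d e t → a :+ (b :+ (c :+ (t :* d :+ (t :* e)))) := a :+ b :+ c :+ t :* (d :+ e)) ≋-refl

  gather-4 : ∀ a b c d e t → a ⊞ (b ⊞ (c ⊞ (d ⊞ (t ⊠ e)))) ≋ a ⊞ b ⊞ c ⊞ d ⊞ t ⊠ (e)
  gather-4 = solve 6 (λ a b c d e t → a :+ (b :+ (c :+ (d :+ (t :* e)))) := a :+ b :+ c :+ d :+ t :* (e)) ≋-refl

  gather-5 : ∀ a b c d e → a ⊞ (b ⊞ (c ⊞ (d ⊞ (e)))) ≋ a ⊞ b ⊞ c ⊞ d ⊞ e
  gather-5 = solve 5 (λ a b c d e → a :+ (b :+ (c :+ (d :+ (e)))) := a :+ b :+ c :+ d :+ e) ≋-refl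

  -- Identities for a + q b + q² c under the relation a c = b²

  module _ (a b c t : C) (ac≈b² : a ⊠ c ≋ b ↑ 2) where

    open FiveOps _⊞_ _⊠_ (_↑ 2) t
    private
      module P = FiveOps {X = Polynomial 4} _:+_ _:*_ (_:^ 2)

      E : Five C
      E = ⟨ a , b , c , 0# , 0# ⟩

      EP : (a b c : Polynomial 4) → Five (Polynomial 4)
      EP a b c = ⟨ a , b , c , con false , con false ⟩

      -- `N` is the norm of a + q b + q² c to the series in t = q⁵; its remaining terms, t a b c (b²
      -- + a c), vanish here. `ε` is the part that later turns out to be E itself.
      N ε β : C
      N = a ↑ 5 ⊞ t ⊠ b ↑ 5 ⊞ t ↑ 2 ⊠ c ↑ 5
      ε = a ↑ 5 ⊞ t ↑ 2 ⊠ c ↑ 5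
      β = t ⊠ b ↑ 5

      NP εP βP : (a b c t : Polynomial 4) → Polynomial 4
      NP a b c t = a :^ 5 :+ t :* b :^ 5 :+ t :^ 2 :* c :^ 5
      εP a b c t = a :^ 5 :+ t :^ 2 :* c :^ 5
      βP a b c t = t :* b :^ 5

      δ : C
      δ = b ↑ 2 ⊞ a ⊠ c

      δ≈0 : δ ≋ 0#
      δ≈0 = ≋-trans (+-congˡ ac≈b²) (solve 1 (λ x → x :+ x := con false) ≋-refl (b ↑ 2))

      δP : (a b c : Polynomial 4) → Polynomial 4
      δP a b c = b :^ 2 :+ a :* c

    cofactor-E-c₀ : c₀ (cofactor a b c ⋆ E) ≋ N
    cofactor-E-c₀ = vanishing (0#) δ≈0
      (solve 4 (λ a b c t → c₀ (P._⋆_ t (P.cofactor t a b c) (EP a b c)) :=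
        NP a b c t :+ δP a b c :* (con false)) ≋-refl a b c t)

    cofactor-E-c₁ : c₁ (cofactor a b c ⋆ E) ≋ 0#
    cofactor-E-c₁ = vanishing (0#) δ≈0
      (solve 4 (λ a b c t → c₁ (P._⋆_ t (P.cofactor t a b c) (EP a b c)) :=
        con false :+ δP a b c :* (con false)) ≋-refl a b c t)

    cofactor-E-c₂ : c₂ (cofactor a b c ⋆ E) ≋ 0#
    cofactor-E-c₂ = vanishing (a ↑ 3 ⊞ t ⊠ b ⊠ c ↑ 2) δ≈0
      (solve 4 (λ a b c t → c₂ (P._⋆_ t (P.cofactor t a b c) (EP a b c)) :=
        con false :+ δP a b c :* (a :^ 3 :+ t :* b :* c :^ 2)) ≋-refl a b c t)

    cofactor-E-c₃ : c₃ (cofactor a b c ⋆ E) ≋ 0#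
    cofactor-E-c₃ = vanishing (a ↑ 2 ⊠ b ⊞ t ⊠ c ↑ 3) δ≈0
      (solve 4 (λ a b c t → c₃ (P._⋆_ t (P.cofactor t a b c) (EP a b c)) :=
        con false :+ δP a b c :* (a :^ 2 :* b :+ t :* c :^ 3)) ≋-refl a b c t)

    cofactor-E-c₄ : c₄ (cofactor a b c ⋆ E) ≋ 0#
    cofactor-E-c₄ = vanishing (0#) δ≈0
      (solve 4 (λ a b c t → c₄ (P._⋆_ t (P.cofactor t a b c) (EP a b c)) :=
        con false :+ δP a b c :* (con false)) ≋-refl a b c t)

    -- The second section of G involves P⁸ E² = (P⁴ E)² for the cofactor P, and coordinate 4 of a
    -- square is the square of coordinate 2.
    cofactor⁴-E-c₂ : c₂ (frobenius (frobenius (cofactor a b c)) ⋆ E) ≋ b ↑ 2 ⊠ (ε ↑ 3 ⊞ β ↑ 3)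
    cofactor⁴-E-c₂ = vanishing (c ↑ 15 ⊠ t ↑ 6 ⊞ b ↑ 10 ⊠ c ↑ 5 ⊠ t ↑ 4 ⊞ a ⊠ b ↑ 8 ⊠ c ↑ 6 ⊠ t ↑ 4 ⊞ a ↑ 2 ⊠ b ↑ 6 ⊠ c ↑ 7 ⊠ t ↑ 4 ⊞ a ↑ 3 ⊠ b ↑ 4 ⊠ c ↑ 8 ⊠ t ↑ 4 ⊞ a ↑ 4 ⊠ b ↑ 2 ⊠ c ↑ 9 ⊠ t ↑ 4 ⊞ a ↑ 5 ⊠ b ↑ 10 ⊠ t ↑ 2 ⊞ a ↑ 6 ⊠ b ↑ 8 ⊠ c ⊠ t ↑ 2 ⊞ a ↑ 7 ⊠ b ↑ 6 ⊠ c ↑ 2 ⊠ t ↑ 2 ⊞ a ↑ 8 ⊠ b ↑ 4 ⊠ c ↑ 3 ⊠ t ↑ 2 ⊞ a ↑ 9 ⊠ b ↑ 2 ⊠ c ↑ 4 ⊠ t ↑ 2 ⊞ a ↑ 15) δ≈0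
      (solve 4 (λ a b c t → c₂ (P._⋆_ t (P.frobenius t (P.frobenius t (P.cofactor t a b c))) (EP a b c)) :=
        b :^ 2 :* (εP a b c t :^ 3 :+ βP a b c t :^ 3) :+ δP a b c :* (c :^ 15 :* t :^ 6 :+ b :^ 10 :* c :^ 5 :* t :^ 4 :+ a :* b :^ 8 :* c :^ 6 :* t :^ 4 :+ a :^ 2 :* b :^ 6 :* c :^ 7 :* t :^ 4 :+ a :^ 3 :* b :^ 4 :* c :^ 8 :* t :^ 4 :+ a :^ 4 :* b :^ 2 :* c :^ 9 :* t :^ 4 :+ a :^ 5 :* b :^ 10 :* t :^ 2 :+ a :^ 6 :* b :^ 8 :* c :* t :^ 2 :+ a :^ 7 :* b :^ 6 :* c :^ 2 :* t :^ 2 :+ a :^ 8 :* b :^ 4 :* c :^ 3 :* t :^ 2 :+ a :^ 9 :* b :^ 2 :* c :^ 4 :* t :^ 2 :+ a :^ 15)) ≋-refl a b c t)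

    -- Since 13 = 8 + 4 + 1, two of the three factors are iterated Frobenius images. The square of b
    -- N that appears here and in `E¹³-c₄` will become E¹², which leaves only the coordinate a or c
    -- and a power of E.
    E¹³-c₂ : c₂ (frobenius (frobenius (frobenius E)) ⋆ (frobenius (frobenius E) ⋆ E)) ≋ a ⊠ (b ⊠ N) ↑ 2
    E¹³-c₂ = vanishing (b ↑ 2 ⊠ c ↑ 9 ⊠ t ↑ 4 ⊞ b ↑ 7 ⊠ c ↑ 4 ⊠ t ↑ 3 ⊞ a ⊠ b ↑ 5 ⊠ c ↑ 5 ⊠ t ↑ 3 ⊞ a ↑ 2 ⊠ b ↑ 3 ⊠ c ↑ 6 ⊠ t ↑ 3 ⊞ a ↑ 3 ⊠ b ⊠ c ↑ 7 ⊠ t ↑ 3 ⊞ a ↑ 11) δ≈0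
      (solve 4 (λ a b c t → c₂ (P._⋆_ t (P.frobenius t (P.frobenius t (P.frobenius t (EP a b c)))) (P._⋆_ t (P.frobenius t (P.frobenius t (EP a b c))) (EP a b c))) :=
        a :* (b :* NP a b c t) :^ 2 :+ δP a b c :* (b :^ 2 :* c :^ 9 :* t :^ 4 :+ b :^ 7 :* c :^ 4 :* t :^ 3 :+ a :* b :^ 5 :* c :^ 5 :* t :^ 3 :+ a :^ 2 :* b :^ 3 :* c :^ 6 :* t :^ 3 :+ a :^ 3 :* b :* c :^ 7 :* t :^ 3 :+ a :^ 11)) ≋-refl a b c t)

    E¹³-c₄ : c₄ (frobenius (frobenius (frobenius E)) ⋆ (frobenius (frobenius E) ⋆ E)) ≋ c ⊠ (b ⊠ N) ↑ 2
    E¹³-c₄ = vanishing (c ↑ 11 ⊠ t ↑ 4 ⊞ a ↑ 4 ⊠ b ↑ 7 ⊠ t ⊞ a ↑ 5 ⊠ b ↑ 5 ⊠ c ⊠ t ⊞ a ↑ 6 ⊠ b ↑ 3 ⊠ c ↑ 2 ⊠ t ⊞ a ↑ 7 ⊠ b ⊠ c ↑ 3 ⊠ t ⊞ a ↑ 9 ⊠ b ↑ 2) δ≈0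
      (solve 4 (λ a b c t → c₄ (P._⋆_ t (P.frobenius t (P.frobenius t (P.frobenius t (EP a b c)))) (P._⋆_ t (P.frobenius t (P.frobenius t (EP a b c))) (EP a b c))) :=
        c :* (b :* NP a b c t) :^ 2 :+ δP a b c :* (c :^ 11 :* t :^ 4 :+ a :^ 4 :* b :^ 7 :* t :+ a :^ 5 :* b :^ 5 :* c :* t :+ a :^ 6 :* b :^ 3 :* c :^ 2 :* t :+ a :^ 7 :* b :* c :^ 3 :* t :+ a :^ 9 :* b :^ 2)) ≋-refl a b c t)

open CommutativeRing F₂[[q]]-ring using ()
  renaming ( setoid to ≈-setoid; +-cong to ⊕-cong; +-congˡ to ⊕-congˡ; +-congʳ to ⊕-congʳ; +-identityʳ to ⊕-identityʳ
           ; *-cong to ⊗-cong; *-congˡ to ⊗-congˡ; *-congʳ to ⊗-congʳ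
           ; *-assoc to ⊗-assoc; *-comm to ⊗-comm; *-identityˡ to ⊗-identityˡ; *-identityʳ to ⊗-identityʳ
           ; zeroˡ to ⊗-zeroˡ; zeroʳ to ⊗-zeroʳ)
open Char2 F₂[[q]]-ring (⊕-self 𝟙)
open FiveOps _⊕_ _⊗_ (_↑ 2) q

module ≈-Reasoning = SetoidReasoning ≈-setoid

-- Sections of series modulo five

shift : F₂[[q]] → F₂[[q]]
shift f zero    = false
shift f (suc n) = f n

q⊗ : ∀ f → q ⊗ f ≈ shift f
q⊗ f = pointwise (q⊗′ f)
  where
  opaque
    unfolding _⊗_
    q⊗′ : ∀ f n → (q ⊗ f) n ≡ shift f n
    q⊗′ f zero    = refl
    q⊗′ f (suc n) = at (⊗-identityˡ f) n

section : ℕ → F₂[[q]] → F₂[[q]]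
section r f n = f (r + n * 5)

infix 4 _splits-as_
record _splits-as_ (f : F₂[[q]]) (v : Five F₂[[q]]) : Set where
  constructor split
  field
    s₀ : section 0 f ≈ c₀ v
    s₁ : section 1 f ≈ c₁ v
    s₂ : section 2 f ≈ c₂ v
    s₃ : section 3 f ≈ c₃ v
    s₄ : section 4 f ≈ c₄ v
open _splits-as_ public

private
  sections : F₂[[q]] → Five F₂[[q]]
  sections f = ⟨ section 0 f , section 1 f , section 2 f , section 3 f , section 4 f ⟩

  -- The formula of `_⋆_` before regrouping: multiplication by q is still a shift, and the terms
  -- stand in the order in which the induction below produces them.
  ⋆-flat : F₂[[q]] → F₂[[q]] → Five F₂[[q]]
  ⋆-flat f g =
    ⟨ (x₀ ⊗ y₀) ⊕ (shift (x₁ ⊗ y₄) ⊕ (shift (x₂ ⊗ y₃) ⊕ (shift (x₃ ⊗ y₂) ⊕ (shift (x₄ ⊗ y₁)))))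
    , (x₀ ⊗ y₁) ⊕ ((x₁ ⊗ y₀) ⊕ (shift (x₂ ⊗ y₄) ⊕ (shift (x₃ ⊗ y₃) ⊕ (shift (x₄ ⊗ y₂)))))
    , (x₀ ⊗ y₂) ⊕ ((x₁ ⊗ y₁) ⊕ ((x₂ ⊗ y₀) ⊕ (shift (x₃ ⊗ y₄) ⊕ (shift (x₄ ⊗ y₃)))))
    , (x₀ ⊗ y₃) ⊕ ((x₁ ⊗ y₂) ⊕ ((x₂ ⊗ y₁) ⊕ ((x₃ ⊗ y₀) ⊕ (shift (x₄ ⊗ y₄)))))
    , (x₀ ⊗ y₄) ⊕ ((x₁ ⊗ y₃) ⊕ ((x₂ ⊗ y₂) ⊕ ((x₃ ⊗ y₁) ⊕ ((x₄ ⊗ y₀))))) ⟩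
    where
    open Five (sections f) renaming (c₀ to x₀; c₁ to x₁; c₂ to x₂; c₃ to x₃; c₄ to x₄)
    open Five (sections g) renaming (c₀ to y₀; c₁ to y₁; c₂ to y₂; c₃ to y₃; c₄ to y₄)

  opaque
    unfolding _⊕_ _⊗_

    ⊗-head : ∀ f g n → (f 0 ∧ g n) xor shift (tl f ⊗ g) n ≡ (f ⊗ g) n
    ⊗-head f g zero    = Boolₚ.xor-identityʳ _
    ⊗-head f g (suc n) = refl

    -- One mutual induction for all residues: splitting off the coefficient f 0 lowers the residue
    -- by one and replaces f by `tl f`, whose sections are those of f rotated by one place. The
    -- split coefficient then rejoins the last product of the rotated sum. Only the step from
    -- residue 0 to residue 4 lowers n.
    section₀ : ∀ f g n → section 0 (f ⊗ g) n ≡ c₀ (⋆-flat f g) n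
    section₁ : ∀ f g n → section 1 (f ⊗ g) n ≡ c₁ (⋆-flat f g) n
    section₂ : ∀ f g n → section 2 (f ⊗ g) n ≡ c₂ (⋆-flat f g) n
    section₃ : ∀ f g n → section 3 (f ⊗ g) n ≡ c₃ (⋆-flat f g) n
    section₄ : ∀ f g n → section 4 (f ⊗ g) n ≡ c₄ (⋆-flat f g) n
    section₀ f g zero    = sym (Boolₚ.xor-identityʳ _)
    section₀ f g (suc n) = trans (cong (x xor_) (section₄ (tl f) g n))
      (xor-rotate x ((tl (section 0 f) ⊗ section 0 g) n) ((section 1 f ⊗ section 4 g) n) ((section 2 f ⊗ section 3 g) n) ((section 3 f ⊗ section 2 g) n) ((section 4 f ⊗ section 1 g) n) refl)
      where
      x : Bool
      x = f 0 ∧ section 0 g (suc n)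
    section₁ f g n = trans (cong (x xor_) (section₀ (tl f) g n))
      (xor-rotate x (shift (tl (section 0 f) ⊗ section 1 g) n) ((section 1 f ⊗ section 0 g) n) (shift (section 2 f ⊗ section 4 g) n) (shift (section 3 f ⊗ section 3 g) n) (shift (section 4 f ⊗ section 2 g) n) (⊗-head (section 0 f) (section 1 g) n))
      where
      x : Bool
      x = f 0 ∧ section 1 g n
    section₂ f g n = trans (cong (x xor_) (section₁ (tl f) g n))
      (xor-rotate x (shift (tl (section 0 f) ⊗ section 2 g) n) ((section 1 f ⊗ section 1 g) n) ((section 2 f ⊗ section 0 g) n) (shift (section 3 f ⊗ section 4 g) n) (shift (section 4 f ⊗ section 3 g) n) (⊗-head (section 0 f) (section 2 g) n))
      where
      x : Bool
      x = f 0 ∧ section 2 g n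
    section₃ f g n = trans (cong (x xor_) (section₂ (tl f) g n))
      (xor-rotate x (shift (tl (section 0 f) ⊗ section 3 g) n) ((section 1 f ⊗ section 2 g) n) ((section 2 f ⊗ section 1 g) n) ((section 3 f ⊗ section 0 g) n) (shift (section 4 f ⊗ section 4 g) n) (⊗-head (section 0 f) (section 3 g) n))
      where
      x : Bool
      x = f 0 ∧ section 3 g n
    section₄ f g n = trans (cong (x xor_) (section₃ (tl f) g n))
      (xor-rotate x (shift (tl (section 0 f) ⊗ section 4 g) n) ((section 1 f ⊗ section 3 g) n) ((section 2 f ⊗ section 2 g) n) ((section 3 f ⊗ section 1 g) n) ((section 4 f ⊗ section 0 g) n) (⊗-head (section 0 f) (section 4 g) n))
      where
      x : Bool
      x = f 0 ∧ section 4 g n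

  ⋆-sections : ∀ f g → f ⊗ g splits-as sections f ⋆ sections g
  ⋆-sections f g = split
    (≈-trans (pointwise {section 0 (f ⊗ g)} {c₀ (⋆-flat f g)} (section₀ f g)) (≈-trans (⊕-congˡ (⊕-cong (≈-sym (q⊗ (x₁ ⊗ y₄))) (⊕-cong (≈-sym (q⊗ (x₂ ⊗ y₃))) (⊕-cong (≈-sym (q⊗ (x₃ ⊗ y₂))) (≈-sym (q⊗ (x₄ ⊗ y₁))))))) (gather-1 (x₀ ⊗ y₀) (x₁ ⊗ y₄) (x₂ ⊗ y₃) (x₃ ⊗ y₂) (x₄ ⊗ y₁) q)))
    (≈-trans (pointwise {section 1 (f ⊗ g)} {c₁ (⋆-flat f g)} (section₁ f g)) (≈-trans (⊕-congˡ (⊕-congˡ (⊕-cong (≈-sym (q⊗ (x₂ ⊗ y₄))) (⊕-cong (≈-sym (q⊗ (x₃ ⊗ y₃))) (≈-sym (q⊗ (x₄ ⊗ y₂))))))) (gather-2 (x₀ ⊗ y₁) (x₁ ⊗ y₀) (x₂ ⊗ y₄) (x₃ ⊗ y₃) (x₄ ⊗ y₂) q)))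
    (≈-trans (pointwise {section 2 (f ⊗ g)} {c₂ (⋆-flat f g)} (section₂ f g)) (≈-trans (⊕-congˡ (⊕-congˡ (⊕-congˡ (⊕-cong (≈-sym (q⊗ (x₃ ⊗ y₄))) (≈-sym (q⊗ (x₄ ⊗ y₃))))))) (gather-3 (x₀ ⊗ y₂) (x₁ ⊗ y₁) (x₂ ⊗ y₀) (x₃ ⊗ y₄) (x₄ ⊗ y₃) q)))
    (≈-trans (pointwise {section 3 (f ⊗ g)} {c₃ (⋆-flat f g)} (section₃ f g)) (≈-trans (⊕-congˡ (⊕-congˡ (⊕-congˡ (⊕-congˡ (≈-sym (q⊗ (x₄ ⊗ y₄))))))) (gather-4 (x₀ ⊗ y₃) (x₁ ⊗ y₂) (x₂ ⊗ y₁) (x₃ ⊗ y₀) (x₄ ⊗ y₄) q)))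
    (≈-trans (pointwise {section 4 (f ⊗ g)} {c₄ (⋆-flat f g)} (section₄ f g)) (gather-5 (x₀ ⊗ y₄) (x₁ ⊗ y₃) (x₂ ⊗ y₂) (x₃ ⊗ y₁) (x₄ ⊗ y₀)))
    where
    open Five (sections f) renaming (c₀ to x₀; c₁ to x₁; c₂ to x₂; c₃ to x₃; c₄ to x₄)
    open Five (sections g) renaming (c₀ to y₀; c₁ to y₁; c₂ to y₂; c₃ to y₃; c₄ to y₄)

splits-resp : ∀ {f v w} → f splits-as v → c₀ v ≈ c₀ w → c₁ v ≈ c₁ w → c₂ v ≈ c₂ w → c₃ v ≈ c₃ w → c₄ v ≈ c₄ w → f splits-as w
splits-resp (split a b c d e) a′ b′ c′ d′ e′ =
  split (≈-trans a a′) (≈-trans b b′) (≈-trans c c′) (≈-trans d d′) (≈-trans e e′)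

splits-respˡ : ∀ {f g v} → f ≈ g → g splits-as v → f splits-as v
splits-respˡ p (split a b c d e) = split
  (≈-trans (pointwise λ n → at p (n * 5)) a) (≈-trans (pointwise λ n → at p (1 + n * 5)) b)
  (≈-trans (pointwise λ n → at p (2 + n * 5)) c) (≈-trans (pointwise λ n → at p (3 + n * 5)) d)
  (≈-trans (pointwise λ n → at p (4 + n * 5)) e)

splits-⊗ : ∀ {f g v w} → f splits-as v → g splits-as w → f ⊗ g splits-as v ⋆ w
splits-⊗ {f} {g} (split a b c d e) (split a′ b′ c′ d′ e′) = splits-resp (⋆-sections f g)
  (⊕-cong (⊗-cong a a′) (⊗-congˡ (⊕-cong (⊕-cong (⊕-cong (⊗-cong b e′) (⊗-cong c d′)) (⊗-cong d c′)) (⊗-cong e b′))))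
  (⊕-cong (⊕-cong (⊗-cong a b′) (⊗-cong b a′)) (⊗-congˡ (⊕-cong (⊕-cong (⊗-cong c e′) (⊗-cong d d′)) (⊗-cong e c′))))
  (⊕-cong (⊕-cong (⊕-cong (⊗-cong a c′) (⊗-cong b b′)) (⊗-cong c a′)) (⊗-congˡ (⊕-cong (⊗-cong d e′) (⊗-cong e d′))))
  (⊕-cong (⊕-cong (⊕-cong (⊕-cong (⊗-cong a d′) (⊗-cong b c′)) (⊗-cong c b′)) (⊗-cong d a′)) (⊗-congˡ (⊗-cong e e′)))
  (⊕-cong (⊕-cong (⊕-cong (⊕-cong (⊗-cong a e′) (⊗-cong b d′)) (⊗-cong c c′)) (⊗-cong d b′)) (⊗-cong e a′))

splits-² : ∀ {f v} → f splits-as v → f ↑ 2 splits-as frobenius v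
splits-² {f} {⟨ a , b , c , d , e ⟩} s =
  splits-respˡ {f ↑ 2} {f ⊗ f} (⊗-congˡ (⊗-identityʳ f)) (splits-resp (splits-⊗ s s)
    (solve 6 (λ a b c d e q → c₀ (P._⋆_ q ⟨ a , b , c , d , e ⟩ ⟨ a , b , c , d , e ⟩) := a :^ 2) ≈-refl a b c d e q)
    (solve 6 (λ a b c d e q → c₁ (P._⋆_ q ⟨ a , b , c , d , e ⟩ ⟨ a , b , c , d , e ⟩) := q :* d :^ 2) ≈-refl a b c d e q)
    (solve 6 (λ a b c d e q → c₂ (P._⋆_ q ⟨ a , b , c , d , e ⟩ ⟨ a , b , c , d , e ⟩) := b :^ 2) ≈-refl a b c d e q)
    (solve 6 (λ a b c d e q → c₃ (P._⋆_ q ⟨ a , b , c , d , e ⟩ ⟨ a , b , c , d , e ⟩) := q :* e :^ 2) ≈-refl a b c d e q)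
    (solve 6 (λ a b c d e q → c₄ (P._⋆_ q ⟨ a , b , c , d , e ⟩ ⟨ a , b , c , d , e ⟩) := c :^ 2) ≈-refl a b c d e q))
  where module P = FiveOps {X = Polynomial 6} _:+_ _:*_ (_:^ 2)

-- The coordinates of f(q⁵).
dilated : F₂[[q]] → Five F₂[[q]]
dilated f = ⟨ f , 𝟘 , 𝟘 , 𝟘 , 𝟘 ⟩

splits-dilated-⊗ : ∀ {f g f₀ v} → f splits-as dilated f₀ → g splits-as v →
                   f ⊗ g splits-as ⟨ f₀ ⊗ c₀ v , f₀ ⊗ c₁ v , f₀ ⊗ c₂ v , f₀ ⊗ c₃ v , f₀ ⊗ c₄ v ⟩
splits-dilated-⊗ {f₀ = f₀} {v = ⟨ a , b , c , d , e ⟩} s r = splits-resp (splits-⊗ s r)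
  (solve 7 (λ x a b c d e q → c₀ (P._⋆_ q ⟨ x , con false , con false , con false , con false ⟩ ⟨ a , b , c , d , e ⟩) := x :* a) ≈-refl f₀ a b c d e q)
  (solve 7 (λ x a b c d e q → c₁ (P._⋆_ q ⟨ x , con false , con false , con false , con false ⟩ ⟨ a , b , c , d , e ⟩) := x :* b) ≈-refl f₀ a b c d e q)
  (solve 7 (λ x a b c d e q → c₂ (P._⋆_ q ⟨ x , con false , con false , con false , con false ⟩ ⟨ a , b , c , d , e ⟩) := x :* c) ≈-refl f₀ a b c d e q)
  (solve 7 (λ x a b c d e q → c₃ (P._⋆_ q ⟨ x , con false , con false , con false , con false ⟩ ⟨ a , b , c , d , e ⟩) := x :* d) ≈-refl f₀ a b c d e q)
  (solve 7 (λ x a b c d e q → c₄ (P._⋆_ q ⟨ x , con false , con false , con false , con false ⟩ ⟨ a , b , c , d , e ⟩) := x :* e) ≈-refl f₀ a b c d e q)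
  where module P = FiveOps {X = Polynomial 7} _:+_ _:*_ (_:^ 2)

splits-dilated-↑ : ∀ {f f₀} → f splits-as dilated f₀ → ∀ k → f ↑ k splits-as dilated (f₀ ↑ k)
splits-dilated-↑ s zero    = split
  (pointwise λ { zero → refl ; (suc n) → refl }) (pointwise λ _ → refl) (pointwise λ _ → refl) (pointwise λ _ → refl) (pointwise λ _ → refl)
splits-dilated-↑ s (suc k) = splits-resp (splits-dilated-⊗ s (splits-dilated-↑ s k))
  ≈-refl (⊗-zeroʳ _) (⊗-zeroʳ _) (⊗-zeroʳ _) (⊗-zeroʳ _)

-- Inverse to taking sections; it turns the cofactor, known by its coordinates only, into a series.
interleave : Five F₂[[q]] → F₂[[q]]
interleave v 0 = c₀ v 0
interleave v 1 = c₁ v 0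
interleave v 2 = c₂ v 0
interleave v 3 = c₃ v 0
interleave v 4 = c₄ v 0
interleave ⟨ a , b , c , d , e ⟩ (suc (suc (suc (suc (suc n))))) = interleave ⟨ tl a , tl b , tl c , tl d , tl e ⟩ n

interleave-splits : ∀ v → interleave v splits-as v
interleave-splits v = split (pointwise (i₀ v)) (pointwise (i₁ v)) (pointwise (i₂ v)) (pointwise (i₃ v)) (pointwise (i₄ v))
  where
  i₀ : ∀ v n → section 0 (interleave v) n ≡ c₀ v n
  i₀ v zero    = refl
  i₀ v (suc n) = i₀ _ n
  i₁ : ∀ v n → section 1 (interleave v) n ≡ c₁ v n
  i₁ v zero    = refl
  i₁ v (suc n) = i₁ _ n
  i₂ : ∀ v n → section 2 (interleave v) n ≡ c₂ v n
  i₂ v zero    = refl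
  i₂ v (suc n) = i₂ _ n
  i₃ : ∀ v n → section 3 (interleave v) n ≡ c₃ v n
  i₃ v zero    = refl
  i₃ v (suc n) = i₃ _ n
  i₄ : ∀ v n → section 4 (interleave v) n ≡ c₄ v n
  i₄ v zero    = refl
  i₄ v (suc n) = i₄ _ n

-- Cancellation and square roots of series

⊕-zero⇒≈ : ∀ {f g} → f ⊕ g ≈ 𝟘 → f ≈ g
⊕-zero⇒≈ {f} {g} p = begin
  f          ≈⟨ solve 2 (λ f g → f := f :+ g :+ g) ≈-refl f g ⟩
  f ⊕ g ⊕ g  ≈⟨ ⊕-congʳ p ⟩
  𝟘 ⊕ g      ≈⟨ ⊕-identityˡ′ g ⟩
  g          ∎
  where open ≈-Reasoning

opaque
  unfolding _⊗_

  -- The lowest coefficient of the product is g 0, so it vanishes, and then the product is q (f ⊗ tl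
  -- g).
  ⊗-unit-zero : ∀ f → f 0 ≡ true → ∀ g → (∀ n → (f ⊗ g) n ≡ false) → ∀ n → g n ≡ false
  ⊗-unit-zero f f₀ g p zero    = trans (sym (cong (_∧ g 0) f₀)) (p 0)
  ⊗-unit-zero f f₀ g p (suc n) = ⊗-unit-zero f f₀ (tl g) p′ n
    where
    p′ : ∀ m → (f ⊗ tl g) m ≡ false
    p′ m = begin
      (f ⊗ tl g) m                           ≡⟨ cong (_xor (f ⊗ tl g) m) (sym (Boolₚ.∧-zeroʳ (f (suc m)))) ⟩
      (f (suc m) ∧ false) xor (f ⊗ tl g) m   ≡⟨ cong (λ b → (f (suc m) ∧ b) xor (f ⊗ tl g) m) (sym (⊗-unit-zero f f₀ g p 0)) ⟩
      (f (suc m) ∧ g 0) xor (f ⊗ tl g) m     ≡⟨ sym (⊗-tlʳ f g m) ⟩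
      (f ⊗ g) (suc m)                        ≡⟨ p (suc m) ⟩
      false                                  ∎
      where open ≡-Reasoning

  -- From f 0 = 0 it follows that the square is q² (tl f)², and the argument repeats.
  square-zero : ∀ f → (∀ n → (f ⊗ f) n ≡ false) → ∀ n → f n ≡ false
  square-zero f p zero    = trans (sym (Boolₚ.∧-idem (f 0))) (p 0)
  square-zero f p (suc n) = square-zero (tl f) p′ n
    where
    f₀ : f 0 ≡ false
    f₀ = trans (sym (Boolₚ.∧-idem (f 0))) (p 0)
    p′ : ∀ m → (tl f ⊗ tl f) m ≡ false
    p′ m = begin
      (tl f ⊗ tl f) m                                     ≡⟨ cong (_xor (tl f ⊗ tl f) m) (sym (Boolₚ.∧-zeroʳ (f (suc (suc m))))) ⟩
      (f (suc (suc m)) ∧ false) xor (tl f ⊗ tl f) m       ≡⟨ cong (λ b → (f (suc (suc m)) ∧ b) xor (tl f ⊗ tl f) m) (sym f₀) ⟩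
      (f (suc (suc m)) ∧ f 0) xor (tl f ⊗ tl f) m         ≡⟨ sym (⊗-tlʳ (tl f) f m) ⟩
      (tl f ⊗ f) (suc m)                                  ≡⟨ cong (λ b → (b ∧ f (suc (suc m))) xor (tl f ⊗ f) (suc m)) (sym f₀) ⟩
      (f ⊗ f) (suc (suc m))                               ≡⟨ p (suc (suc m)) ⟩
      false                                               ∎
      where open ≡-Reasoning

⊗-cancelˡ : ∀ {f g h} → f 0 ≡ true → f ⊗ g ≈ f ⊗ h → g ≈ h
⊗-cancelˡ {f} {g} {h} f₀ p = ⊕-zero⇒≈ (pointwise (⊗-unit-zero f f₀ (g ⊕ h) (at p′)))
  where
  p′ : f ⊗ (g ⊕ h) ≈ 𝟘
  p′ = ≈-trans (⊗-distribˡ′ f g h) (≈-trans (⊕-congʳ p) (⊕-self (f ⊗ h)))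

square-root : ∀ {f} → f ↑ 2 ≈ 𝟘 → f ≈ 𝟘
square-root {f} p = pointwise (square-zero f (at (≈-trans (⊗-congˡ (≈-sym (⊗-identityʳ f))) p)))

↑-cong : ∀ k {f g} → f ≈ g → f ↑ k ≈ g ↑ k
↑-cong zero    p = ≈-refl
↑-cong (suc k) p = ⊗-cong p (↑-cong k p)

unit-⊗ : ∀ {f g} → f 0 ≡ true → g 0 ≡ true → (f ⊗ g) 0 ≡ true
unit-⊗ {f} {g} f₀ g₀ = trans (⊗-at-zero f g) (cong₂ _∧_ f₀ g₀)

unit-↑ : ∀ {f} → f 0 ≡ true → ∀ n → (f ↑ n) 0 ≡ true
unit-↑ f₀ zero    = refl
unit-↑ {f} f₀ (suc n) = unit-⊗ {f} {f ↑ n} f₀ (unit-↑ f₀ n)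

opaque
  unfolding _⊕_

  splits-⊕ : ∀ {f g v w} → f splits-as v → g splits-as w →
             f ⊕ g splits-as ⟨ c₀ v ⊕ c₀ w , c₁ v ⊕ c₁ w , c₂ v ⊕ c₂ w , c₃ v ⊕ c₃ w , c₄ v ⊕ c₄ w ⟩
  splits-⊕ (split a b c d e) (split a′ b′ c′ d′ e′) = split
    (pointwise λ n → cong₂ _xor_ (at a n) (at a′ n)) (pointwise λ n → cong₂ _xor_ (at b n) (at b′ n))
    (pointwise λ n → cong₂ _xor_ (at c n) (at c′ n)) (pointwise λ n → cong₂ _xor_ (at d n) (at d′ n))
    (pointwise λ n → cong₂ _xor_ (at e n) (at e′ n))

splits-q : ∀ {f v} → f splits-as v → q ⊗ f splits-as ⟨ q ⊗ c₄ v , c₀ v , c₁ v , c₂ v , c₃ v ⟩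
splits-q {f} {v} (split a b c d e) = splits-respˡ (q⊗ f) (split
  (≈-trans (pointwise λ { zero → refl ; (suc n) → at e n }) (≈-sym (q⊗ (c₄ v)))) a b c d)

-- The hypotheses are those of E = ∏ (1 - qⁱ), of B = E(q⁵), of X = E(q²⁵), and of the generating
-- functions G of b₂₀₀ and H of p₁₇.
module Dissection
  {E A B C X G H : F₂[[q]]}
  (E-splits : E splits-as ⟨ A , B , C , 𝟘 , 𝟘 ⟩) (B-splits : B splits-as dilated E) (X-splits : X splits-as dilated B)
  (A₀ : A 0 ≡ true) (B₀ : B 0 ≡ true) (E₀ : E 0 ≡ true)
  (E⁶+qB⁶≈EB : E ↑ 6 ⊕ q ⊗ B ↑ 6 ≈ E ⊗ B)
  (GE≈X⁸ : G ⊗ E ≈ X ↑ 8) (HE¹⁷≈1 : H ⊗ E ↑ 17 ≈ 𝟙)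
  where

  private
    e : Five F₂[[q]]
    e = ⟨ A , B , C , 𝟘 , 𝟘 ⟩

    -- E⁶ is written as E⁴ E², whose factors are Frobenius images. `EB-splits` dissects the same
    -- series from the other side of E⁶ + q B⁶ = E B; coordinates 4 and 0 of the comparison are the
    -- two relations that follow.
    E⁶-splits : (E ↑ 2) ↑ 2 ⊗ E ↑ 2 ⊕ q ⊗ B ↑ 6 splits-as _
    E⁶-splits = splits-⊕ (splits-⊗ (splits-² (splits-² E-splits)) (splits-² E-splits))
                         (splits-q (splits-dilated-↑ B-splits 6))

    EB-splits : (E ↑ 2) ↑ 2 ⊗ E ↑ 2 ⊕ q ⊗ B ↑ 6 splits-as ⟨ E ⊗ A , E ⊗ B , E ⊗ C , E ⊗ 𝟘 , E ⊗ 𝟘 ⟩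
    EB-splits = splits-respˡ
      (≈-trans (⊕-congʳ (solve 1 (λ e → (e :^ 2) :^ 2 :* e :^ 2 := e :^ 6) ≈-refl E)) (≈-trans E⁶+qB⁶≈EB (⊗-comm E B)))
      (splits-dilated-⊗ B-splits E-splits)

    module P4 = FiveOps {X = Polynomial 4} _:+_ _:*_ (_:^ 2)

    eP : (a b c : Polynomial 4) → Five (Polynomial 4)
    eP a b c = ⟨ a , b , c , con false , con false ⟩

  -- E B has no coordinate 4, while that of E⁶ + q B⁶ is the square of A (A C + B²).
  AC≈B² : A ⊗ C ≈ B ↑ 2
  AC≈B² = ⊕-zero⇒≈ (square-root (⊗-cancelˡ (unit-↑ A₀ 2) (begin
    A ↑ 2 ⊗ (A ⊗ C ⊕ B ↑ 2) ↑ 2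
      ≈⟨ solve 4 (λ a b c t → a :^ 2 :* (a :* c :+ b :^ 2) :^ 2 :=
           c₄ (P4._⋆_ t (P4.frobenius t (P4.frobenius t (eP a b c))) (P4.frobenius t (eP a b c))) :+ con false) ≈-refl A B C q ⟩
    c₄ (frobenius (frobenius e) ⋆ frobenius e) ⊕ 𝟘
      ≈⟨ ≈-sym (s₄ E⁶-splits) ⟩
    section 4 ((E ↑ 2) ↑ 2 ⊗ E ↑ 2 ⊕ q ⊗ B ↑ 6)
      ≈⟨ s₄ EB-splits ⟩
    E ⊗ 𝟘
      ≈⟨ solve 2 (λ e a → e :* con false := a :* con false) ≈-refl E (A ↑ 2) ⟩
    A ↑ 2 ⊗ 𝟘 ∎)))
    where open ≈-Reasoning

  -- Coordinate 0 reads E A = A⁶ + q² B² C⁴; replacing B² by A C exposes the common factor A.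
  E≈A⁵+q²C⁵ : E ≈ A ↑ 5 ⊕ q ↑ 2 ⊗ C ↑ 5
  E≈A⁵+q²C⁵ = ⊗-cancelˡ A₀ (begin
    A ⊗ E
      ≈⟨ ⊗-comm A E ⟩
    E ⊗ A
      ≈⟨ ≈-sym (s₀ EB-splits) ⟩
    section 0 ((E ↑ 2) ↑ 2 ⊗ E ↑ 2 ⊕ q ⊗ B ↑ 6)
      ≈⟨ s₀ E⁶-splits ⟩
    c₀ (frobenius (frobenius e) ⋆ frobenius e) ⊕ q ⊗ 𝟘
      ≈⟨ solve 4 (λ a b c t →
           c₀ (P4._⋆_ t (P4.frobenius t (P4.frobenius t (eP a b c))) (P4.frobenius t (eP a b c))) :+ t :* con false :=
           a :^ 6 :+ t :^ 2 :* b :^ 2 :* c :^ 4) ≈-refl A B C q ⟩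
    A ↑ 6 ⊕ q ↑ 2 ⊗ B ↑ 2 ⊗ C ↑ 4
      ≈⟨ ⊕-congˡ (⊗-congʳ (⊗-congˡ (≈-sym AC≈B²))) ⟩
    A ↑ 6 ⊕ q ↑ 2 ⊗ (A ⊗ C) ⊗ C ↑ 4
      ≈⟨ solve 3 (λ a c t → a :^ 6 :+ t :^ 2 :* (a :* c) :* c :^ 4 := a :* (a :^ 5 :+ t :^ 2 :* c :^ 5)) ≈-refl A C q ⟩
    A ⊗ (A ↑ 5 ⊕ q ↑ 2 ⊗ C ↑ 5) ∎)
    where open ≈-Reasoning

  private
    N : F₂[[q]]
    N = A ↑ 5 ⊕ q ⊗ B ↑ 5 ⊕ q ↑ 2 ⊗ C ↑ 5

    N≈E+qB⁵ : N ≈ E ⊕ q ⊗ B ↑ 5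
    N≈E+qB⁵ = ≈-trans
      (solve 3 (λ x y z → x :+ y :+ z := (x :+ z) :+ y) ≈-refl (A ↑ 5) (q ⊗ B ↑ 5) (q ↑ 2 ⊗ C ↑ 5))
      (⊕-congʳ (≈-sym E≈A⁵+q²C⁵))

    -- Both sides equal E B + q B⁶, the left one through N = E + q B⁵ and the right one through the
    -- assumed identity between E and B.
    BN≈E⁶ : B ⊗ N ≈ E ↑ 6
    BN≈E⁶ = begin
      B ⊗ N                      ≈⟨ ⊗-congˡ N≈E+qB⁵ ⟩
      B ⊗ (E ⊕ q ⊗ B ↑ 5)        ≈⟨ solve 3 (λ b e t → b :* (e :+ t :* b :^ 5) := e :* b :+ t :* b :^ 6) ≈-refl B E q ⟩
      E ⊗ B ⊕ q ⊗ B ↑ 6          ≈⟨ ⊕-congʳ (≈-sym E⁶+qB⁶≈EB) ⟩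
      E ↑ 6 ⊕ q ⊗ B ↑ 6 ⊕ q ⊗ B ↑ 6 ≈⟨ solve 2 (λ x y → x :+ y :+ y := x) ≈-refl (E ↑ 6) (q ⊗ B ↑ 6) ⟩
      E ↑ 6 ∎
      where open ≈-Reasoning

    N₀ : N 0 ≡ true
    N₀ = trans (at N≈E+qB⁵ 0) (trans (⊕-at E (q ⊗ B ↑ 5) 0) (cong₂ _xor_ E₀ (at (q⊗ (B ↑ 5)) 0)))

    P : F₂[[q]]
    P = interleave (cofactor A B C)

    P-splits : P splits-as cofactor A B C
    P-splits = interleave-splits (cofactor A B C)

    PE-splits : P ⊗ E splits-as dilated N
    PE-splits = splits-resp (splits-⊗ P-splits E-splits)
      (cofactor-E-c₀ A B C q AC≈B²) (cofactor-E-c₁ A B C q AC≈B²) (cofactor-E-c₂ A B C q AC≈B²)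
      (cofactor-E-c₃ A B C q AC≈B²) (cofactor-E-c₄ A B C q AC≈B²)

  -- V carries the coefficients of G at 25 m + 24. Since 25 m - 26 = 25 (m - 2) + 24, the values in
  -- question are the coefficients of q² V.
  W V : F₂[[q]]
  W = section 4 G
  V = section 4 W

  private
    -- P E and X⁸ are series in q⁵, so section 4 of (P E) G = X⁸ P reads N W = B⁸ B⁴; a further
    -- factor B turns N into E⁶.
    E⁶W≈B¹³ : E ↑ 6 ⊗ W ≈ B ↑ 13
    E⁶W≈B¹³ = begin
      E ↑ 6 ⊗ W                ≈⟨ ⊗-congʳ (≈-sym BN≈E⁶) ⟩
      B ⊗ N ⊗ W                ≈⟨ ⊗-assoc B N W ⟩
      B ⊗ (N ⊗ W)              ≈⟨ ⊗-congˡ (≈-sym (s₄ (splits-dilated-⊗ PE-splits (split {G} {⟨ section 0 G , section 1 G , section 2 G , section 3 G , W ⟩} ≈-refl ≈-refl ≈-refl ≈-refl ≈-refl)))) ⟩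
      B ⊗ section 4 (P ⊗ E ⊗ G) ≈⟨ ⊗-congˡ (pointwise λ n → at PEG≈X⁸P (4 + n * 5)) ⟩
      B ⊗ section 4 (X ↑ 8 ⊗ P) ≈⟨ ⊗-congˡ (s₄ (splits-dilated-⊗ (splits-dilated-↑ X-splits 8) P-splits)) ⟩
      B ⊗ (B ↑ 8 ⊗ (B ↑ 2) ↑ 2) ≈⟨ solve 1 (λ b → b :* (b :^ 8 :* (b :^ 2) :^ 2) := b :^ 13) ≈-refl B ⟩
      B ↑ 13 ∎
      where
      open ≈-Reasoning
      PEG≈X⁸P : P ⊗ E ⊗ G ≈ X ↑ 8 ⊗ P
      PEG≈X⁸P = ≈-trans (solve 3 (λ p e g → p :* e :* g := g :* e :* p) ≈-refl P E G) (⊗-congʳ GE≈X⁸)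

    β : F₂[[q]]
    β = q ⊗ B ↑ 5

    -- Six of the eight factors E cancel the denominator of W = B¹³ / E⁶, and what is left over, (P⁴
    -- E)², is a square; seven or nine factors would not leave one.
    N⁸V : N ↑ 8 ⊗ V ≈ E ↑ 13 ⊗ (B ↑ 2 ⊗ (E ↑ 3 ⊕ β ↑ 3)) ↑ 2
    N⁸V = begin
      N ↑ 8 ⊗ V
        ≈⟨ ≈-sym (s₄ (splits-dilated-⊗ (splits-dilated-↑ PE-splits 8) (split {W} {⟨ section 0 W , section 1 W , section 2 W , section 3 W , V ⟩} ≈-refl ≈-refl ≈-refl ≈-refl ≈-refl))) ⟩
      section 4 ((P ⊗ E) ↑ 8 ⊗ W)
        ≈⟨ pointwise (λ n → at PEW (4 + n * 5)) ⟩
      section 4 (B ↑ 13 ⊗ ((P ↑ 2) ↑ 2 ⊗ E) ↑ 2)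
        ≈⟨ s₄ (splits-dilated-⊗ (splits-dilated-↑ B-splits 13) (splits-² (splits-⊗ (splits-² (splits-² P-splits)) E-splits))) ⟩
      E ↑ 13 ⊗ c₂ (frobenius (frobenius (cofactor A B C)) ⋆ e) ↑ 2
        ≈⟨ ⊗-congˡ (↑-cong 2 (cofactor⁴-E-c₂ A B C q AC≈B²)) ⟩
      E ↑ 13 ⊗ (B ↑ 2 ⊗ ((A ↑ 5 ⊕ q ↑ 2 ⊗ C ↑ 5) ↑ 3 ⊕ β ↑ 3)) ↑ 2
        ≈⟨ ⊗-congˡ (↑-cong 2 (⊗-congˡ (⊕-congʳ (↑-cong 3 (≈-sym E≈A⁵+q²C⁵))))) ⟩
      E ↑ 13 ⊗ (B ↑ 2 ⊗ (E ↑ 3 ⊕ β ↑ 3)) ↑ 2 ∎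
      where
      open ≈-Reasoning
      PEW : (P ⊗ E) ↑ 8 ⊗ W ≈ B ↑ 13 ⊗ ((P ↑ 2) ↑ 2 ⊗ E) ↑ 2
      PEW = ≈-trans (solve 3 (λ p e w → (p :* e) :^ 8 :* w := (e :^ 6 :* w) :* ((p :^ 2) :^ 2 :* e) :^ 2) ≈-refl P E W) (⊗-congʳ E⁶W≈B¹³)

  -- After multiplication by N⁸ E¹⁷ only E and β = q B⁵ remain, and the claim is E³⁰ times the
  -- square of β (E³ + β³) + (E + β) E³ = (E + β)⁴.
  B⁶D≈E¹³ : B ↑ 6 ⊗ (q ↑ 2 ⊗ V ⊕ H) ≈ E ↑ 13
  B⁶D≈E¹³ = ⊗-cancelˡ {N ↑ 8 ⊗ E ↑ 17} (unit-⊗ {N ↑ 8} {E ↑ 17} (unit-↑ {N} N₀ 8) (unit-↑ {E} E₀ 17)) (begin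
    N ↑ 8 ⊗ E ↑ 17 ⊗ (B ↑ 6 ⊗ (q ↑ 2 ⊗ V ⊕ H))
      ≈⟨ solve 6 (λ n e b q v h → n :^ 8 :* e :^ 17 :* (b :^ 6 :* (q :^ 2 :* v :+ h)) :=
           e :^ 17 :* b :^ 6 :* q :^ 2 :* (n :^ 8 :* v) :+ n :^ 2 :* (b :* n) :^ 6 :* (h :* e :^ 17)) ≈-refl N E B q V H ⟩
    E ↑ 17 ⊗ B ↑ 6 ⊗ q ↑ 2 ⊗ (N ↑ 8 ⊗ V) ⊕ N ↑ 2 ⊗ (B ⊗ N) ↑ 6 ⊗ (H ⊗ E ↑ 17)
      ≈⟨ ⊕-cong (⊗-congˡ N⁸V) (⊗-cong (⊗-congˡ (↑-cong 6 BN≈E⁶)) HE¹⁷≈1) ⟩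
    E ↑ 17 ⊗ B ↑ 6 ⊗ q ↑ 2 ⊗ (E ↑ 13 ⊗ (B ↑ 2 ⊗ (E ↑ 3 ⊕ β ↑ 3)) ↑ 2) ⊕ N ↑ 2 ⊗ (E ↑ 6) ↑ 6 ⊗ 𝟙
      ≈⟨ ⊕-congˡ (⊗-congʳ (⊗-congʳ (⊗-cong N≈E+qB⁵ (⊗-congʳ N≈E+qB⁵)))) ⟩
    E ↑ 17 ⊗ B ↑ 6 ⊗ q ↑ 2 ⊗ (E ↑ 13 ⊗ (B ↑ 2 ⊗ (E ↑ 3 ⊕ β ↑ 3)) ↑ 2) ⊕ (E ⊕ β) ↑ 2 ⊗ (E ↑ 6) ↑ 6 ⊗ 𝟙
      ≈⟨ solve 3 (λ e b q → e :^ 17 :* b :^ 6 :* q :^ 2 :* (e :^ 13 :* (b :^ 2 :* (e :^ 3 :+ (q :* b :^ 5) :^ 3)) :^ 2) :+ (e :+ q :* b :^ 5) :^ 2 :* (e :^ 6) :^ 6 :* con true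
           := (e :+ q :* b :^ 5) :^ 8 :* e :^ 17 :* e :^ 13) ≈-refl E B q ⟩
    (E ⊕ β) ↑ 8 ⊗ E ↑ 17 ⊗ E ↑ 13
      ≈⟨ ⊗-congʳ (⊗-congʳ (≈-sym (↑-cong 8 N≈E+qB⁵))) ⟩
    N ↑ 8 ⊗ E ↑ 17 ⊗ E ↑ 13 ∎)
    where
    open ≈-Reasoning

  private
    E¹³-splits : E ↑ 13 splits-as frobenius (frobenius (frobenius e)) ⋆ (frobenius (frobenius e) ⋆ e)
    E¹³-splits = splits-respˡ
      (solve 1 (λ e → e :^ 13 := ((e :^ 2) :^ 2) :^ 2 :* ((e :^ 2) :^ 2 :* e)) ≈-refl E)
      (splits-⊗ (splits-² (splits-² (splits-² E-splits))) (splits-⊗ (splits-² (splits-² E-splits)) E-splits))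

    D : F₂[[q]]
    D = q ↑ 2 ⊗ V ⊕ H

    B⁶D-splits : B ↑ 6 ⊗ D splits-as ⟨ E ↑ 6 ⊗ section 0 D , E ↑ 6 ⊗ section 1 D , E ↑ 6 ⊗ section 2 D , E ↑ 6 ⊗ section 3 D , E ↑ 6 ⊗ section 4 D ⟩
    B⁶D-splits = splits-dilated-⊗ (splits-dilated-↑ B-splits 6)
      (split {D} {⟨ section 0 D , section 1 D , section 2 D , section 3 D , section 4 D ⟩} ≈-refl ≈-refl ≈-refl ≈-refl ≈-refl)

    E⁶-cancel : ∀ {f g} → E ↑ 6 ⊗ f ≈ g ⊗ (B ⊗ N) ↑ 2 → f ≈ g ⊗ E ↑ 6
    E⁶-cancel {f} {g} p = ⊗-cancelˡ (unit-↑ {E} E₀ 6) (begin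
      E ↑ 6 ⊗ f              ≈⟨ p ⟩
      g ⊗ (B ⊗ N) ↑ 2        ≈⟨ ⊗-congˡ (⊗-cong BN≈E⁶ (⊗-congʳ BN≈E⁶)) ⟩
      g ⊗ (E ↑ 6) ↑ 2        ≈⟨ solve 2 (λ g x → g :* x :^ 2 := x :* (g :* x)) ≈-refl g (E ↑ 6) ⟩
      E ↑ 6 ⊗ (g ⊗ E ↑ 6)    ∎)
      where open ≈-Reasoning

  section₂-D : section 2 (q ↑ 2 ⊗ V ⊕ H) ≈ A ⊗ E ↑ 6
  section₂-D = E⁶-cancel (≈-trans (≈-sym (s₂ B⁶D-splits))
    (≈-trans (pointwise λ n → at B⁶D≈E¹³ (2 + n * 5)) (≈-trans (s₂ E¹³-splits) (E¹³-c₂ A B C q AC≈B²))))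

  section₄-D : section 4 (q ↑ 2 ⊗ V ⊕ H) ≈ C ⊗ E ↑ 6
  section₄-D = E⁶-cancel (≈-trans (≈-sym (s₄ B⁶D-splits))
    (≈-trans (pointwise λ n → at B⁶D≈E¹³ (4 + n * 5)) (≈-trans (s₄ E¹³-splits) (E¹³-c₄ A B C q AC≈B²))))

-- Reduction modulo 2 and infinite products

odd : ℕ → Bool
odd zero    = false
odd (suc n) = not (odd n)

odd-+ : ∀ m n → odd (m + n) ≡ odd m xor odd n
odd-+ zero    n = refl
odd-+ (suc m) n = trans (cong not (odd-+ m n)) (Boolₚ.not-distribˡ-xor (odd m) (odd n))

odd-* : ∀ m n → odd (m * n) ≡ odd m ∧ odd n
odd-* zero    n = refl
odd-* (suc m) n = trans (odd-+ n (m * n)) (trans (cong (odd n xor_) (odd-* m n)) (lemma (odd m) (odd n)))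
  where
  lemma : ∀ a b → b xor (a ∧ b) ≡ not a ∧ b
  lemma true  true  = refl
  lemma true  false = refl
  lemma false true  = refl
  lemma false false = refl

oddℤ : ℤ → Bool
oddℤ z = odd ∣ z ∣

oddℤ-⊖ : ∀ m n → oddℤ (m ⊖ n) ≡ odd m xor odd n
oddℤ-⊖ zero    zero    = refl
oddℤ-⊖ zero    (suc n) = refl
oddℤ-⊖ (suc m) zero    = sym (Boolₚ.xor-identityʳ _)
oddℤ-⊖ (suc m) (suc n) = begin
  oddℤ (suc m ⊖ suc n)      ≡⟨ cong oddℤ (ℤₚ.[1+m]⊖[1+n]≡m⊖n m n) ⟩
  oddℤ (m ⊖ n)              ≡⟨ oddℤ-⊖ m n ⟩
  odd m xor odd n           ≡⟨ sym (Boolₚ.xor-annihilates-not (odd m) (odd n)) ⟩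
  not (odd m) xor not (odd n) ∎
  where open ≡-Reasoning

oddℤ-+ : ∀ x y → oddℤ (x ℤ.+ y) ≡ oddℤ x xor oddℤ y
oddℤ-+ (+ m)    (+ n)    = odd-+ m n
oddℤ-+ (+ m)    -[1+ n ] = oddℤ-⊖ m (suc n)
oddℤ-+ -[1+ m ] (+ n)    = trans (oddℤ-⊖ n (suc m)) (Boolₚ.xor-comm (odd n) (odd (suc m)))
oddℤ-+ -[1+ m ] -[1+ n ] = begin
  not (not (odd (m + n)))        ≡⟨ Boolₚ.not-involutive _ ⟩
  odd (m + n)                    ≡⟨ odd-+ m n ⟩
  odd m xor odd n                ≡⟨ sym (Boolₚ.xor-annihilates-not (odd m) (odd n)) ⟩
  not (odd m) xor not (odd n)    ∎
  where open ≡-Reasoning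

oddℤ-* : ∀ x y → oddℤ (x ℤ.* y) ≡ oddℤ x ∧ oddℤ y
oddℤ-* x y = trans (cong odd (ℤₚ.abs-* x y)) (odd-* ∣ x ∣ ∣ y ∣)

n%2≡odd : ∀ n → n % 2 ≡ (if odd n then 1 else 0)
n%2≡odd zero          = refl
n%2≡odd (suc zero)    = refl
n%2≡odd (suc (suc n)) = begin
  suc (suc n) % 2                       ≡⟨ cong (_% 2) (ℕₚ.+-comm 2 n) ⟩
  (n + 2) % 2                           ≡⟨ [m+n]%n≡m%n n 2 ⟩
  n % 2                                 ≡⟨ n%2≡odd n ⟩
  (if odd n then 1 else 0)              ≡⟨ cong (if_then 1 else 0) (sym (Boolₚ.not-involutive (odd n))) ⟩
  (if not (not (odd n)) then 1 else 0)  ∎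
  where open ≡-Reasoning

mod₂ : Series → F₂[[q]]
mod₂ f n = oddℤ (f n)

parityDiffers-mod₂ : ∀ a b n → parityDiffers a b n ≡ true → oddℤ (a n) xor oddℤ (b n) ≡ true
parityDiffers-mod₂ a b n d = by-parity (oddℤ (a n)) (oddℤ (b n)) refl refl
  where
  equal : oddℤ (a n) ≡ oddℤ (b n) → parityDiffers a b n ≢ true
  equal p r with parity (a n) ≟ parity (b n)
  ... | yes _ = contradiction r λ ()
  ... | no ¬p = ¬p (trans (n%2≡odd ∣ a n ∣) (trans (cong (if_then 1 else 0) p) (sym (n%2≡odd ∣ b n ∣))))
  by-parity : ∀ x y → oddℤ (a n) ≡ x → oddℤ (b n) ≡ y → x xor y ≡ true
  by-parity true  false _ _ = refl
  by-parity false true  _ _ = refl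
  by-parity true  true  p q = contradiction d (equal (trans p (sym q)))
  by-parity false false p q = contradiction d (equal (trans p (sym q)))

sumTo-suc : ∀ n f → sumTo (suc n) f ≡ f 0 ℤ.+ sumTo n (λ k → f (suc k))
sumTo-suc zero    f = refl
sumTo-suc (suc n) f = trans (cong (ℤ._+ f (suc (suc n))) (sumTo-suc n f))
                            (ℤₚ.+-assoc (f 0) (sumTo n (λ k → f (suc k))) (f (suc (suc n))))

opaque
  unfolding _⊗_

  mod₂-⊛′ : ∀ f g n → mod₂ (f ⊛ g) n ≡ (mod₂ f ⊗ mod₂ g) n
  mod₂-⊛′ f g zero    = oddℤ-* (f 0) (g 0)
  mod₂-⊛′ f g (suc n) = begin
    oddℤ (sumTo (suc n) (λ k → f k ℤ.* g (suc n ∸ k)))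
      ≡⟨ cong oddℤ (sumTo-suc n (λ k → f k ℤ.* g (suc n ∸ k))) ⟩
    oddℤ (f 0 ℤ.* g (suc n) ℤ.+ ((λ i → f (suc i)) ⊛ g) n)
      ≡⟨ oddℤ-+ (f 0 ℤ.* g (suc n)) (((λ i → f (suc i)) ⊛ g) n) ⟩
    oddℤ (f 0 ℤ.* g (suc n)) xor mod₂ ((λ i → f (suc i)) ⊛ g) n
      ≡⟨ cong₂ _xor_ (oddℤ-* (f 0) (g (suc n))) (mod₂-⊛′ (λ i → f (suc i)) g n) ⟩
    (mod₂ f ⊗ mod₂ g) (suc n) ∎
    where open ≡-Reasoning

mod₂-⊛ : ∀ f g → mod₂ (f ⊛ g) ≈ mod₂ f ⊗ mod₂ g
mod₂-⊛ f g = pointwise (mod₂-⊛′ f g)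

mod₂-one : mod₂ oneS ≈ 𝟙
mod₂-one = pointwise λ { zero → refl ; (suc n) → refl }

mod₂-^S : ∀ f k → mod₂ (f ^S k) ≈ mod₂ f ↑ k
mod₂-^S f zero    = mod₂-one
mod₂-^S f (suc k) = ≈-trans (mod₂-⊛ f (f ^S k)) (⊗-congˡ (mod₂-^S f k))

∏ : ℕ → (ℕ → F₂[[q]]) → F₂[[q]]
∏ zero    F = 𝟙
∏ (suc n) F = ∏ n F ⊗ F (suc n)

mod₂-prodS : ∀ F G → (∀ i → mod₂ (F (suc i)) ≈ G (suc i)) → ∀ n → mod₂ (prodS n F) ≈ ∏ n G
mod₂-prodS F G p zero    = mod₂-one
mod₂-prodS F G p (suc n) = ≈-trans (mod₂-⊛ (prodS n F) (F (suc n))) (⊗-cong (mod₂-prodS F G p n) (p n))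

∏-cong : ∀ {F G} → (∀ i → F (suc i) ≈ G (suc i)) → ∀ n → ∏ n F ≈ ∏ n G
∏-cong p zero    = ≈-refl
∏-cong p (suc n) = ⊗-cong (∏-cong p n) (p n)

∏-⊗ : ∀ F G n → ∏ n (λ i → F i ⊗ G i) ≈ ∏ n F ⊗ ∏ n G
∏-⊗ F G zero    = ≈-sym (⊗-identityˡ 𝟙)
∏-⊗ F G (suc n) = ≈-trans (⊗-congʳ (∏-⊗ F G n))
  (solve 4 (λ a b c d → (a :* b) :* (c :* d) := (a :* c) :* (b :* d)) ≈-refl (∏ n F) (∏ n G) (F (suc n)) (G (suc n)))

-- f ≈[ n ] g: equality modulo qⁿ⁺¹.
infix 4 _≈[_]_
_≈[_]_ : F₂[[q]] → ℕ → F₂[[q]] → Set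
f ≈[ n ] g = ∀ m → m ≤ n → f m ≡ g m

opaque
  unfolding _⊗_

  ⊗-cong-upto : ∀ {f f′ g g′} n → f ≈[ n ] f′ → g ≈[ n ] g′ → (f ⊗ g) n ≡ (f′ ⊗ g′) n
  ⊗-cong-upto zero    p r = cong₂ _∧_ (p 0 z≤n) (r 0 z≤n)
  ⊗-cong-upto (suc n) p r = cong₂ _xor_ (cong₂ _∧_ (p 0 z≤n) (r (suc n) ℕₚ.≤-refl))
    (⊗-cong-upto n (λ m m≤n → p (suc m) (s≤s m≤n)) (λ m m≤n → r m (ℕₚ.m≤n⇒m≤1+n m≤n)))

Tame : (ℕ → F₂[[q]]) → Set
Tame F = ∀ i → F (suc i) ≈[ i ] 𝟙

∏∞ : (ℕ → F₂[[q]]) → F₂[[q]]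
∏∞ F n = ∏ n F n

∏-stable : ∀ {F} → Tame F → ∀ {n N} → n ≤′ N → ∏ N F n ≡ ∏∞ F n
∏-stable         t ≤′-refl = refl
∏-stable {F} t {n} {suc N} (≤′-step n≤N) = trans
  (⊗-cong-upto {∏ N F} {∏ N F} {F (suc N)} {𝟙} n (λ _ _ → refl) (λ m m≤n → t N m (ℕₚ.≤-trans m≤n (ℕₚ.≤′⇒≤ n≤N))))
  (trans (at (⊗-identityʳ (∏ N F)) n) (∏-stable t n≤N))

∏∞-cong : ∀ {F G} → (∀ i → F (suc i) ≈ G (suc i)) → ∏∞ F ≈ ∏∞ G
∏∞-cong p = pointwise λ n → at (∏-cong p n) n

∏∞-⊗ : ∀ {F G} → Tame F → Tame G → ∏∞ F ⊗ ∏∞ G ≈ ∏∞ (λ i → F i ⊗ G i)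
∏∞-⊗ {F} {G} tF tG = pointwise λ n → trans
  (⊗-cong-upto {∏∞ F} {∏ n F} {∏∞ G} {∏ n G} n (λ m m≤n → sym (∏-stable tF (ℕₚ.≤⇒≤′ m≤n))) (λ m m≤n → sym (∏-stable tG (ℕₚ.≤⇒≤′ m≤n))))
  (sym (at (∏-⊗ F G n) n))

Tame-⊗ : ∀ {F G} → Tame F → Tame G → Tame (λ i → F i ⊗ G i)
Tame-⊗ {F} {G} tF tG i m m≤i = trans
  (⊗-cong-upto {F (suc i)} {𝟙} {G (suc i)} {𝟙} m (λ k k≤m → tF i k (ℕₚ.≤-trans k≤m m≤i)) (λ k k≤m → tG i k (ℕₚ.≤-trans k≤m m≤i)))
  (at (⊗-identityˡ 𝟙) m)

Tame-↑ : ∀ {F} → Tame F → ∀ k → Tame (λ i → F i ↑ k)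
Tame-↑ t zero    i m _ = refl
Tame-↑ {F} t (suc k) = Tame-⊗ {F} {λ i → F i ↑ k} t (Tame-↑ {F} t k)

∏∞-one : ∏∞ (λ _ → 𝟙) ≈ 𝟙
∏∞-one = pointwise λ n → at (one n) n
  where
  one : ∀ n → ∏ n (λ _ → 𝟙) ≈ 𝟙
  one zero    = ≈-refl
  one (suc n) = ≈-trans (⊗-identityʳ _) (one n)

∏∞-↑ : ∀ {F} → Tame F → ∀ k → ∏∞ F ↑ k ≈ ∏∞ (λ i → F i ↑ k)
∏∞-↑ t zero    = ≈-sym ∏∞-one
∏∞-↑ {F} t (suc k) = ≈-trans (⊗-congˡ (∏∞-↑ {F} t k)) (∏∞-⊗ {F} {λ i → F i ↑ k} t (Tame-↑ {F} t k))

-- Powers of q, the factors 1 - qᵈ and the Euler products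

q↑⊗-low : ∀ d f n → n < d → (q ↑ d ⊗ f) n ≡ false
q↑⊗-low (suc d) f zero    _         = trans (at (≈-trans (⊗-assoc q (q ↑ d) f) (q⊗ (q ↑ d ⊗ f))) 0) refl
q↑⊗-low (suc d) f (suc n) (s≤s n<d) = trans (at (≈-trans (⊗-assoc q (q ↑ d) f) (q⊗ (q ↑ d ⊗ f))) (suc n)) (q↑⊗-low d f n n<d)

q↑⊗-high : ∀ d f n → (q ↑ d ⊗ f) (d + n) ≡ f n
q↑⊗-high zero    f n = at (⊗-identityˡ f) n
q↑⊗-high (suc d) f n = trans (at (≈-trans (⊗-assoc q (q ↑ d) f) (q⊗ (q ↑ d ⊗ f))) (suc d + n)) (q↑⊗-high d f n)

q↑-at : ∀ d m → (q ↑ d) m ≡ does (m ≟ d)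
q↑-at zero    zero    = refl
q↑-at zero    (suc m) = refl
q↑-at (suc d) zero    = at (q⊗ (q ↑ d)) 0
q↑-at (suc d) (suc m) = trans (at (q⊗ (q ↑ d)) (suc m)) (q↑-at d m)

1+q↑ : ℕ → F₂[[q]]
1+q↑ d = 𝟙 ⊕ q ↑ d

mod₂-oneMinusS : ∀ d → mod₂ (oneMinusS (suc d)) ≈ 1+q↑ (suc d)
mod₂-oneMinusS d = pointwise λ m → trans (lemma m) (sym (trans (⊕-at 𝟙 (q ↑ suc d) m) (cong (𝟙 m xor_) (q↑-at (suc d) m))))
  where
  lemma : ∀ m → mod₂ (oneMinusS (suc d)) m ≡ 𝟙 m xor does (m ≟ suc d)
  lemma zero = refl
  lemma (suc m) with suc m ≟ suc d
  ... | yes p = sym (dec-true (m ≟ d) (ℕₚ.suc-injective p))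
  ... | no ¬p = sym (dec-false (m ≟ d) λ p → ¬p (cong suc p))

-- The coefficients of `geomS j` have period j + 1. Adding the shift by j + 1 cancels all but the
-- first period, in which only the constant term is nonzero.
geomS-inverse : ∀ j → mod₂ (geomS j) ⊗ 1+q↑ (suc j) ≈ 𝟙
geomS-inverse j = ≈-trans
  (solve 2 (λ g x → g :* (con true :+ x) := g :+ x :* g) ≈-refl g (q ↑ suc j))
  (pointwise λ n → trans (⊕-at g (q ↑ suc j ⊗ g) n) (lemma n))
  where
  g : F₂[[q]]
  g = mod₂ (geomS j)
  lemma : ∀ n → g n xor (q ↑ suc j ⊗ g) n ≡ 𝟙 n
  lemma n with n ℕₚ.<? suc j
  ... | yes n<d = trans (cong (g n xor_) (q↑⊗-low (suc j) g n n<d)) (trans (Boolₚ.xor-identityʳ (g n)) (low n n<d))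
    where
    low : ∀ n → n < suc j → g n ≡ 𝟙 n
    low zero    _   = refl
    low (suc n) n<d rewrite m<n⇒m%n≡m n<d = refl
  ... | no n≮d = subst (λ n → g n xor (q ↑ suc j ⊗ g) n ≡ 𝟙 n) (ℕₚ.m+[n∸m]≡n (ℕₚ.≮⇒≥ n≮d)) (high (n ∸ suc j))
    where
    periodic : ∀ k → g (suc j + k) ≡ g k
    periodic k = cong (λ r → oddℤ (if ⌊ r ≟ 0 ⌋ then + 1 else + 0)) (trans (cong (_% suc j) (ℕₚ.+-comm (suc j) k)) ([m+n]%n≡m%n k (suc j)))
    high : ∀ k → g (suc j + k) xor (q ↑ suc j ⊗ g) (suc j + k) ≡ false
    high k = trans (cong₂ _xor_ (periodic k) (q↑⊗-high (suc j) g k)) (Boolₚ.xor-same (g k))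

mod₂-geomS : ∀ j → mod₂ (geomS j) ≈[ j ] 𝟙
mod₂-geomS j zero    _   = refl
mod₂-geomS j (suc m) m≤j rewrite m<n⇒m%n≡m (s≤s m≤j) = refl

1+q↑-tame : ∀ k → Tame (λ i → 1+q↑ (suc k * i))
1+q↑-tame k i m m≤i = trans (⊕-at 𝟙 (q ↑ d) m) (trans (cong (𝟙 m xor_) (trans (q↑-at d m) (dec-false (m ≟ d) m≢d))) (Boolₚ.xor-identityʳ (𝟙 m)))
  where
  d : ℕ
  d = suc k * suc i
  m≢d : m ≢ d
  m≢d = ℕₚ.<⇒≢ (ℕₚ.≤-trans (s≤s m≤i) (ℕₚ.m≤m+n (suc i) (k * suc i)))

-- For k ≥ 1, the product ∏ (1 - qⁱ) modulo 2 with q replaced by qᵏ.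
euler : ℕ → F₂[[q]]
euler k = ∏∞ (λ i → 1+q↑ (k * i))

euler-² : ∀ k → euler (suc k) ↑ 2 ≈ euler (2 * suc k)
euler-² k = ≈-trans (∏∞-↑ {λ i → 1+q↑ (suc k * i)} (1+q↑-tame k) 2) (∏∞-cong λ i → ≈-trans
  (solve 1 (λ x → (con true :+ x) :^ 2 := con true :+ x :* x) ≈-refl (q ↑ (suc k * suc i)))
  (⊕-congˡ (≈-trans (≈-sym (↑-homo-+ q (suc k * suc i) (suc k * suc i))) (≈-reflexive (cong (q ↑_) (double (suc k) (suc i)))))))
  where
  ≈-reflexive : ∀ {f g} → f ≡ g → f ≈ g
  ≈-reflexive refl = ≈-refl
  double : ∀ a b → a * b + a * b ≡ 2 * a * b
  double = solve-∀

euler-splits : ∀ k → euler (5 * suc k) splits-as dilated (euler (suc k))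
euler-splits k = split
  (pointwise λ n → trans (at (s₀ (finite (n * 5))) n) (stable n 0))
  (pointwise λ n → at (s₁ (finite (1 + n * 5))) n) (pointwise λ n → at (s₂ (finite (2 + n * 5))) n)
  (pointwise λ n → at (s₃ (finite (3 + n * 5))) n) (pointwise λ n → at (s₄ (finite (4 + n * 5))) n)
  where
  -- Coefficient n * 5 of the left side is read from n * 5 factors, coefficient n of `euler (suc k)`
  -- from n factors.
  stable : ∀ n r → ∏ (n * 5) (λ i → 1+q↑ (suc k * i)) n ≡ euler (suc k) n
  stable n _ = ∏-stable {λ i → 1+q↑ (suc k * i)} (1+q↑-tame k) (ℕₚ.≤⇒≤′ (ℕₚ.m≤m*n n 5))
  𝟙-splits : 𝟙 splits-as dilated 𝟙
  𝟙-splits = splits-dilated-↑ {𝟙} {𝟙} (split (pointwise λ { zero → refl ; (suc n) → refl }) (pointwise λ _ → refl) (pointwise λ _ → refl) (pointwise λ _ → refl) (pointwise λ _ → refl)) 0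
  q↑-splits : ∀ d → q ↑ (d * 5) splits-as dilated (q ↑ d)
  q↑-splits zero    = 𝟙-splits
  q↑-splits (suc d) = splits-resp (splits-q (splits-q (splits-q (splits-q (splits-q (q↑-splits d))))))
    ≈-refl (⊗-zeroʳ q) (⊗-zeroʳ q) (⊗-zeroʳ q) (⊗-zeroʳ q)
  factor : ∀ i → 1+q↑ (5 * suc k * i) splits-as dilated (1+q↑ (suc k * i))
  factor i = subst (λ d → 1+q↑ d splits-as dilated (1+q↑ (suc k * i))) (reorder (suc k) i)
    (splits-resp (splits-⊕ 𝟙-splits (q↑-splits (suc k * i))) ≈-refl (⊕-identityʳ 𝟘) (⊕-identityʳ 𝟘) (⊕-identityʳ 𝟘) (⊕-identityʳ 𝟘))
    where
    reorder : ∀ k i → k * i * 5 ≡ 5 * k * i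
    reorder = solve-∀
  finite : ∀ N → ∏ N (λ i → 1+q↑ (5 * suc k * i)) splits-as dilated (∏ N (λ i → 1+q↑ (suc k * i)))
  finite zero    = 𝟙-splits
  finite (suc N) = splits-resp (splits-dilated-⊗ (finite N) (factor (suc N))) ≈-refl (⊗-zeroʳ _) (⊗-zeroʳ _) (⊗-zeroʳ _) (⊗-zeroʳ _)

geomS-inverse′ : ∀ i → mod₂ (geomS i) ⊗ 1+q↑ (1 * suc i) ≈ 𝟙
geomS-inverse′ i = subst (λ d → mod₂ (geomS i) ⊗ 1+q↑ d ≈ 𝟙) (sym (ℕₚ.*-identityˡ (suc i))) (geomS-inverse i)

mod₂-regular : ∀ k → mod₂ (coeffInfProd (λ i → oneMinusS (suc k * i) ⊛ geomS (i ∸ 1))) ⊗ euler 1 ≈ euler (suc k)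
mod₂-regular k = begin
  mod₂ (coeffInfProd (λ i → oneMinusS (suc k * i) ⊛ geomS (i ∸ 1))) ⊗ euler 1
    ≈⟨ ⊗-congʳ (pointwise λ n → at (mod₂-prodS (λ i → oneMinusS (suc k * i) ⊛ geomS (i ∸ 1)) F F-factor n) n) ⟩
  ∏∞ F ⊗ euler 1
    ≈⟨ ∏∞-⊗ {F} {λ i → 1+q↑ (1 * i)} (Tame-⊗ {λ i → 1+q↑ (suc k * i)} {λ i → mod₂ (geomS (i ∸ 1))} (1+q↑-tame k) mod₂-geomS) (1+q↑-tame 0) ⟩
  ∏∞ (λ i → F i ⊗ 1+q↑ (1 * i))
    ≈⟨ ∏∞-cong {λ i → F i ⊗ 1+q↑ (1 * i)} {λ i → 1+q↑ (suc k * i)} cancel ⟩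
  euler (suc k) ∎
  where
  open ≈-Reasoning
  F : ℕ → F₂[[q]]
  F i = 1+q↑ (suc k * i) ⊗ mod₂ (geomS (i ∸ 1))
  F-factor : ∀ i → mod₂ (oneMinusS (suc k * suc i) ⊛ geomS i) ≈ F (suc i)
  F-factor i = ≈-trans (mod₂-⊛ (oneMinusS (suc k * suc i)) (geomS i)) (⊗-congʳ (mod₂-oneMinusS (i + k * suc i)))
  cancel : ∀ i → F (suc i) ⊗ 1+q↑ (1 * suc i) ≈ 1+q↑ (suc k * suc i)
  cancel i = ≈-trans (⊗-assoc (1+q↑ (suc k * suc i)) (mod₂ (geomS i)) (1+q↑ (1 * suc i)))
    (≈-trans (⊗-congˡ (geomS-inverse′ i)) (⊗-identityʳ (1+q↑ (suc k * suc i))))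

euler-⁸ : ∀ k → euler (2 * (2 * (2 * suc k))) ≈ euler (suc k) ↑ 8
euler-⁸ k = begin
  euler (2 * (2 * (2 * suc k)))    ≈⟨ ≈-sym (euler-² (k₂ + 1 * suc k₂)) ⟩
  euler (2 * (2 * suc k)) ↑ 2      ≈⟨ ↑-cong 2 (≈-sym (euler-² k₂)) ⟩
  (euler (2 * suc k) ↑ 2) ↑ 2      ≈⟨ ↑-cong 2 (↑-cong 2 (≈-sym (euler-² k))) ⟩
  ((euler (suc k) ↑ 2) ↑ 2) ↑ 2    ≈⟨ solve 1 (λ e → ((e :^ 2) :^ 2) :^ 2 := e :^ 8) ≈-refl (euler (suc k)) ⟩
  euler (suc k) ↑ 8                ∎
  where
  open ≈-Reasoning
  k₂ : ℕ
  k₂ = k + 1 * suc k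

-- 200 = 8 · 25, and passing from q to q⁸ is the eighth power modulo 2.
mod₂-b200 : mod₂ b200 ⊗ euler 1 ≈ euler 25 ↑ 8
mod₂-b200 = ≈-trans (mod₂-regular 199) (euler-⁸ 24)

↑-inverse : ∀ {f g} → f ⊗ g ≈ 𝟙 → ∀ k → f ↑ k ⊗ g ↑ k ≈ 𝟙
↑-inverse p zero = ⊗-identityˡ 𝟙
↑-inverse {f} {g} p (suc k) = ≈-trans
  (solve 4 (λ a b c d → (a :* b) :* (c :* d) := (a :* c) :* (b :* d)) ≈-refl f (f ↑ k) g (g ↑ k))
  (≈-trans (⊗-cong p (↑-inverse p k)) (⊗-identityˡ 𝟙))

mod₂-multipartitions : ∀ k → mod₂ (coeffInfProd (λ i → geomS (i ∸ 1) ^S k)) ⊗ euler 1 ↑ k ≈ 𝟙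
mod₂-multipartitions k = begin
  mod₂ (coeffInfProd (λ i → geomS (i ∸ 1) ^S k)) ⊗ euler 1 ↑ k
    ≈⟨ ⊗-cong (pointwise λ n → at (mod₂-prodS (λ i → geomS (i ∸ 1) ^S k) (λ i → g i ↑ k) (λ i → mod₂-^S (geomS i) k) n) n) (∏∞-↑ {u} (1+q↑-tame 0) k) ⟩
  ∏∞ (λ i → g i ↑ k) ⊗ ∏∞ (λ i → u i ↑ k)
    ≈⟨ ∏∞-⊗ {λ i → g i ↑ k} {λ i → u i ↑ k} (Tame-↑ {g} mod₂-geomS k) (Tame-↑ {u} (1+q↑-tame 0) k) ⟩
  ∏∞ (λ i → g i ↑ k ⊗ u i ↑ k)
    ≈⟨ ∏∞-cong {λ i → g i ↑ k ⊗ u i ↑ k} {λ _ → 𝟙} (λ i → ↑-inverse (geomS-inverse′ i) k) ⟩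
  ∏∞ (λ _ → 𝟙)
    ≈⟨ ∏∞-one ⟩
  𝟙 ∎
  where
  open ≈-Reasoning
  g u : ℕ → F₂[[q]]
  g i = mod₂ (geomS (i ∸ 1))
  u i = 1+q↑ (1 * i)

mod₂-p17 : mod₂ p17 ⊗ euler 1 ↑ 17 ≈ 𝟙
mod₂-p17 = mod₂-multipartitions 17

-- Euler's pentagonal number theorem modulo 2

-- Exclusive or agrees with disjunction, the squares being distinct, and it is what a sum of powers
-- of q produces in its coefficients.
isSquareUpTo : ℕ → ℕ → Bool
isSquareUpTo zero    v = does (v ≟ 0)
isSquareUpTo (suc k) v = isSquareUpTo k v xor does (v ≟ suc k * suc k)

isSquare : ℕ → Bool
isSquare v = isSquareUpTo v v

isSquareUpTo-none : ∀ k v → (∀ j → j ≤ k → v ≢ j * j) → isSquareUpTo k v ≡ false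
isSquareUpTo-none zero    v p = dec-false (v ≟ 0) (p 0 z≤n)
isSquareUpTo-none (suc k) v p = cong₂ _xor_
  (isSquareUpTo-none k v (λ j j≤k → p j (ℕₚ.m≤n⇒m≤1+n j≤k))) (dec-false (v ≟ suc k * suc k) (p (suc k) ℕₚ.≤-refl))

isSquareUpTo-sound : ∀ k v → isSquareUpTo k v ≡ true → ∃[ r ] v ≡ r * r
isSquareUpTo-sound zero    zero    _ = 0 , refl
isSquareUpTo-sound (suc k) v p with v ≟ suc k * suc k
... | yes q = suc k , q
... | no ¬q = isSquareUpTo-sound k v
  (trans (sym (Boolₚ.xor-identityʳ _)) (trans (cong (isSquareUpTo k v xor_) (sym (dec-false (v ≟ suc k * suc k) ¬q))) p))

isSquareUpTo-stable : ∀ {k l v} → k ≤′ l → v ≤ k * k → isSquareUpTo l v ≡ isSquareUpTo k v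
isSquareUpTo-stable ≤′-refl v≤k² = refl
isSquareUpTo-stable {k} {suc l} {v} (≤′-step k≤l) v≤k² = trans
  (cong₂ _xor_ (isSquareUpTo-stable k≤l v≤k²) (dec-false (v ≟ suc l * suc l) v≢))
  (Boolₚ.xor-identityʳ _)
  where
  v≢ : v ≢ suc l * suc l
  v≢ = ℕₚ.<⇒≢ (ℕₚ.≤-<-trans v≤k² (ℕₚ.*-mono-< (s≤s (ℕₚ.≤′⇒≤ k≤l)) (s≤s (ℕₚ.≤′⇒≤ k≤l))))

isSquare-sound : ∀ v → isSquare v ≡ true → ∃[ r ] v ≡ r * r
isSquare-sound v = isSquareUpTo-sound v v

isSquare-complete : ∀ r → isSquare (r * r) ≡ true
isSquare-complete zero    = refl
isSquare-complete (suc r) = trans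
  (isSquareUpTo-stable (ℕₚ.≤⇒≤′ (ℕₚ.m≤m*n (suc r) (suc r))) ℕₚ.≤-refl)
  (cong₂ _xor_ (isSquareUpTo-none r (suc r * suc r) (λ j j≤r p → ℕₚ.<⇒≢ (ℕₚ.*-mono-< (s≤s j≤r) (s≤s j≤r)) (sym p)))
               (dec-true (suc r * suc r ≟ suc r * suc r) refl))

triangle : ℕ → ℕ
triangle zero    = 0
triangle (suc n) = suc n + triangle n

2*triangle : ∀ n → 2 * triangle n ≡ n * suc n
2*triangle zero    = refl
2*triangle (suc n) = trans (ℕₚ.*-distribˡ-+ 2 (suc n) (triangle n)) (trans (cong (λ t → 2 * suc n + t) (2*triangle n)) (lemma n))
  where
  lemma : ∀ n → 2 * suc n + n * suc n ≡ suc n * suc (suc n)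
  lemma = solve-∀

-- ∏ (1 - qᵏ) over s < k ≤ n.
segment : ℕ → ℕ → F₂[[q]]
segment s zero    = 𝟙
segment s (suc n) = segment s n ⊗ (if does (s ≤? n) then 1+q↑ (suc n) else 𝟙)

segment-suc : ∀ {s n} → s ≤ n → segment s (suc n) ≈ segment s n ⊗ 1+q↑ (suc n)
segment-suc {s} {n} s≤n rewrite dec-true (s ≤? n) s≤n = ≈-refl

segment-empty : ∀ {s n} → n ≤ s → segment s n ≈ 𝟙
segment-empty {s} {zero}  _   = ≈-refl
segment-empty {s} {suc n} n<s rewrite dec-false (s ≤? n) (ℕₚ.<⇒≱ n<s) =
  ≈-trans (⊗-identityʳ (segment s n)) (segment-empty (ℕₚ.<⇒≤ n<s))

segment-pred : ∀ {s n} → s <′ n → segment s n ≈ segment (suc s) n ⊗ 1+q↑ (suc s)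
segment-pred {s} ≤′-refl = begin
  segment s (suc s)                      ≈⟨ segment-suc {s} ℕₚ.≤-refl ⟩
  segment s s ⊗ 1+q↑ (suc s)             ≈⟨ ⊗-congʳ (≈-trans (segment-empty {s} ℕₚ.≤-refl) (≈-sym (segment-empty {suc s} ℕₚ.≤-refl))) ⟩
  segment (suc s) (suc s) ⊗ 1+q↑ (suc s) ∎
  where open ≈-Reasoning
segment-pred {s} {suc n} (≤′-step s<n) = begin
  segment s (suc n)                               ≈⟨ segment-suc (ℕₚ.<⇒≤ (ℕₚ.≤′⇒≤ s<n)) ⟩
  segment s n ⊗ 1+q↑ (suc n)                      ≈⟨ ⊗-congʳ (segment-pred s<n) ⟩
  segment (suc s) n ⊗ 1+q↑ (suc s) ⊗ 1+q↑ (suc n) ≈⟨ solve 3 (λ a b c → a :* b :* c := a :* c :* b) ≈-refl (segment (suc s) n) (1+q↑ (suc s)) (1+q↑ (suc n)) ⟩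
  segment (suc s) n ⊗ 1+q↑ (suc n) ⊗ 1+q↑ (suc s) ≈⟨ ⊗-congʳ (≈-sym (segment-suc (ℕₚ.≤′⇒≤ s<n))) ⟩
  segment (suc s) (suc n) ⊗ 1+q↑ (suc s)          ∎
  where open ≈-Reasoning

Σ≤ : ℕ → (ℕ → F₂[[q]]) → F₂[[q]]
Σ≤ zero    f = f 0
Σ≤ (suc n) f = Σ≤ n f ⊕ f (suc n)

-- Shanks' finite form: Σ_{s≤n} shanks s n telescopes in n.
shanks : ℕ → ℕ → F₂[[q]]
shanks s n = segment s n ⊗ q ↑ (s * n + triangle s)

private
  carry : ℕ → ℕ → F₂[[q]]
  carry s n = segment s n ⊗ q ↑ (suc s * n + triangle (suc s))

  q↑-cong : ∀ {m n} → m ≡ n → q ↑ m ≈ q ↑ n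
  q↑-cong refl = ≈-refl

  -- Adding the summand m + 1 turns `carry m n` into `carry (suc m) n`, so the sums for n and n + 1
  -- differ by a single term. At m = n its segment is empty and a pure power of q, the next
  -- pentagonal one, is left.
  shanks-telescope : ∀ {m n} → m ≤ n → Σ≤ m (λ s → shanks s (suc n)) ≈ Σ≤ m (λ s → shanks s n) ⊕ carry m n
  shanks-telescope {zero} {n} z≤n = begin
    segment 0 (suc n) ⊗ 𝟙
      ≈⟨ ⊗-congʳ (segment-suc {0} {n} z≤n) ⟩
    segment 0 n ⊗ 1+q↑ (suc n) ⊗ 𝟙
      ≈⟨ solve 2 (λ x y → x :* (con true :+ y) :* con true := x :* con true :+ x :* y) ≈-refl (segment 0 n) (q ↑ suc n) ⟩
    segment 0 n ⊗ 𝟙 ⊕ segment 0 n ⊗ q ↑ suc n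
      ≈⟨ ⊕-congˡ (⊗-congˡ (q↑-cong (sym (trans (ℕₚ.+-comm (1 * n) 1) (cong suc (ℕₚ.*-identityˡ n)))))) ⟩
    segment 0 n ⊗ 𝟙 ⊕ carry 0 n ∎
    where open ≈-Reasoning
  shanks-telescope {suc m} {n} m<n = begin
    Σ≤ m (λ s → shanks s (suc n)) ⊕ segment (suc m) (suc n) ⊗ q ↑ (suc m * suc n + triangle (suc m))
      ≈⟨ ⊕-cong (shanks-telescope (ℕₚ.<⇒≤ m<n)) (⊗-cong (segment-suc m<n) (≈-trans (q↑-cong exponent₁) (↑-homo-+ q (suc m) w))) ⟩
    S ⊕ carry m n ⊕ x ⊗ 1+q↑ (suc n) ⊗ (q ↑ suc m ⊗ q ↑ w)
      ≈⟨ ⊕-congʳ (⊕-congˡ (⊗-congʳ (segment-pred (ℕₚ.≤⇒≤′ m<n)))) ⟩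
    S ⊕ x ⊗ 1+q↑ (suc m) ⊗ q ↑ w ⊕ x ⊗ 1+q↑ (suc n) ⊗ (q ↑ suc m ⊗ q ↑ w)
      ≈⟨ solve 5 (λ S x a b y → S :+ x :* (con true :+ a) :* y :+ x :* (con true :+ b) :* (a :* y)
                              := S :+ x :* y :+ x :* ((a :* b) :* y)) ≈-refl S x (q ↑ suc m) (q ↑ suc n) (q ↑ w) ⟩
    S ⊕ x ⊗ q ↑ w ⊕ x ⊗ (q ↑ suc m ⊗ q ↑ suc n ⊗ q ↑ w)
      ≈⟨ ⊕-congˡ (⊗-congˡ (≈-sym (≈-trans (q↑-cong exponent₂) (≈-trans (↑-homo-+ q (suc m + suc n) w) (⊗-congʳ (↑-homo-+ q (suc m) (suc n))))))) ⟩
    S ⊕ shanks (suc m) n ⊕ carry (suc m) n ∎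
    where
    open ≈-Reasoning
    S x : F₂[[q]]
    S = Σ≤ m (λ s → shanks s n)
    x = segment (suc m) n
    w : ℕ
    w = suc m * n + triangle (suc m)
    exponent₁ : suc m * suc n + triangle (suc m) ≡ suc m + w
    exponent₁ = lemma m n (triangle (suc m))
      where
      lemma : ∀ m n t → suc m * suc n + t ≡ suc m + (suc m * n + t)
      lemma = solve-∀
    exponent₂ : suc (suc m) * n + triangle (suc (suc m)) ≡ suc m + suc n + w
    exponent₂ = lemma m n (triangle (suc m))
      where
      lemma : ∀ m n t → suc (suc m) * n + (suc (suc m) + t) ≡ suc m + suc n + (suc m * n + t)
      lemma = solve-∀

-- With k = suc n the two new exponents are k (3 k - 1) / 2 and k (3 k + 1) / 2.
pentagonal : ℕ → F₂[[q]]
pentagonal zero    = 𝟙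
pentagonal (suc n) = pentagonal n ⊕ q ↑ (suc n * n + triangle (suc n)) ⊕ q ↑ (suc n * suc n + triangle (suc n))

Σshanks≈pentagonal : ∀ n → Σ≤ n (λ s → shanks s n) ≈ pentagonal n
Σshanks≈pentagonal zero    = ⊗-identityˡ 𝟙
Σshanks≈pentagonal (suc n) = ⊕-cong
  (≈-trans (shanks-telescope {n} {n} ℕₚ.≤-refl) (⊕-cong (Σshanks≈pentagonal n) (≈-trans (⊗-congʳ (segment-empty {n} ℕₚ.≤-refl)) (⊗-identityˡ _))))
  (≈-trans (⊗-congʳ (segment-empty {suc n} ℕₚ.≤-refl)) (⊗-identityˡ _))

-- The summands of Shanks' sum with s ≥ 1 are divisible by a power of q beyond qⁿ, so coefficient n
-- sees only the product, the summand s = 0.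
euler-pentagonal : ∀ n → euler 1 n ≡ pentagonal n n
euler-pentagonal n = trans (at (segment-∏ n) n) (trans (sym (low n)) (at (Σshanks≈pentagonal n) n))
  where
  segment-∏ : ∀ n → ∏ n (λ i → 1+q↑ (1 * i)) ≈ segment 0 n
  segment-∏ zero    = ≈-refl
  segment-∏ (suc n) = ⊗-cong (segment-∏ n) (⊕-congˡ (q↑-cong (ℕₚ.*-identityˡ (suc n))))
  low : ∀ k → Σ≤ k (λ s → shanks s n) n ≡ segment 0 n n
  low zero    = at (⊗-identityʳ (segment 0 n)) n
  low (suc k) = trans (⊕-at (Σ≤ k (λ s → shanks s n)) (shanks (suc k) n) n)
    (trans (cong₂ _xor_ (low k) (trans (at (⊗-comm (segment (suc k) n) (q ↑ d)) n) (q↑⊗-low d (segment (suc k) n) n n<d)))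
           (Boolₚ.xor-identityʳ _))
    where
    d : ℕ
    d = suc k * n + triangle (suc k)
    n<d : n < d
    n<d = ℕₚ.≤-trans (ℕₚ.≤-reflexive (ℕₚ.+-comm 1 n)) (ℕₚ.+-mono-≤ (ℕₚ.m≤m+n n (k * n)) (s≤s z≤n))

-- The step from n to n + 1 admits the six roots 6 n + 2, ..., 6 n + 7. Squares of 6 n + 5 and 6 n +
-- 7 are 1 + 24 d for the two new exponents d; the other four squares are not 1 modulo 12.
pentagonal-isSquare : ∀ n m → pentagonal n m ≡ isSquareUpTo (1 + n * 6) (1 + m * 24)
pentagonal-isSquare zero    zero    = refl
pentagonal-isSquare zero    (suc m) = refl
pentagonal-isSquare (suc n) m = begin
  (pentagonal n ⊕ q ↑ a ⊕ q ↑ b) m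
    ≡⟨ trans (⊕-at (pentagonal n ⊕ q ↑ a) (q ↑ b) m) (cong (_xor (q ↑ b) m) (⊕-at (pentagonal n) (q ↑ a) m)) ⟩
  (pentagonal n m xor (q ↑ a) m) xor (q ↑ b) m
    ≡⟨ cong₂ _xor_ (cong₂ _xor_ (pentagonal-isSquare n m) (trans (q↑-at a m) (hit a 5 (eq-a n (triangle n) (2*triangle n)))))
                   (trans (q↑-at b m) (hit b 7 (eq-b n (triangle n) (2*triangle n)))) ⟩
  (s xor g 5) xor g 7
    ≡⟨ pad s (g 2) (g 3) (g 4) (g 5) (g 6) (g 7) (miss 2 4 refl (res₂ n) λ ()) (miss 3 9 refl (res₃ n) λ ()) (miss 4 16 refl (res₄ n) λ ()) (miss 6 36 refl (res₆ n) λ ()) ⟩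
  isSquareUpTo (7 + n * 6) (1 + m * 24) ∎
  where
  open ≡-Reasoning
  a b : ℕ
  a = suc n * n + triangle (suc n)
  b = suc n * suc n + triangle (suc n)
  s : Bool
  s = isSquareUpTo (1 + n * 6) (1 + m * 24)
  g : ℕ → Bool
  g k = does (1 + m * 24 ≟ (k + n * 6) * (k + n * 6))
  hit : ∀ d k → (k + n * 6) * (k + n * 6) ≡ 1 + d * 24 → does (m ≟ d) ≡ g k
  hit d k e = does-⇔ (mk⇔ (λ { refl → sym e }) (λ e′ → ℕₚ.*-cancelʳ-≡ m d 24 (ℕₚ.suc-injective (trans e′ e)))) (m ≟ d) (1 + m * 24 ≟ (k + n * 6) * (k + n * 6))
  miss : ∀ k r {c} → c ≡ r → (k + n * 6) * (k + n * 6) ≡ c + (n * (3 * n + k)) * 12 → r % 12 ≢ 1 → g k ≡ false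
  miss k r refl e r≢1 = dec-false (1 + m * 24 ≟ (k + n * 6) * (k + n * 6)) λ p → r≢1 (begin
    r % 12                        ≡⟨ sym ([m+kn]%n≡m%n r (n * (3 * n + k)) 12) ⟩
    (r + n * (3 * n + k) * 12) % 12  ≡⟨ cong (_% 12) (sym (trans p e)) ⟩
    (1 + m * 24) % 12             ≡⟨ cong (λ t → (1 + t) % 12) (sym (ℕₚ.*-assoc m 2 12)) ⟩
    (1 + m * 2 * 12) % 12         ≡⟨ [m+kn]%n≡m%n 1 (m * 2) 12 ⟩
    1                             ∎)
  res₂ : ∀ n → (2 + n * 6) * (2 + n * 6) ≡ 4 + (n * (3 * n + 2)) * 12
  res₂ = solve-∀
  res₃ : ∀ n → (3 + n * 6) * (3 + n * 6) ≡ 9 + (n * (3 * n + 3)) * 12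
  res₃ = solve-∀
  res₄ : ∀ n → (4 + n * 6) * (4 + n * 6) ≡ 16 + (n * (3 * n + 4)) * 12
  res₄ = solve-∀
  res₆ : ∀ n → (6 + n * 6) * (6 + n * 6) ≡ 36 + (n * (3 * n + 6)) * 12
  res₆ = solve-∀
  eq-a : ∀ n t → 2 * t ≡ n * suc n → (5 + n * 6) * (5 + n * 6) ≡ 1 + (suc n * n + (suc n + t)) * 24
  eq-a n t p = trans (l n) (trans (cong (λ x → 1 + (suc n * n + suc n) * 24 + 12 * x) (sym p)) (r n t))
    where
    l : ∀ n → (5 + n * 6) * (5 + n * 6) ≡ 1 + (suc n * n + suc n) * 24 + 12 * (n * suc n)
    l = solve-∀
    r : ∀ n t → 1 + (suc n * n + suc n) * 24 + 12 * (2 * t) ≡ 1 + (suc n * n + (suc n + t)) * 24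
    r = solve-∀
  eq-b : ∀ n t → 2 * t ≡ n * suc n → (7 + n * 6) * (7 + n * 6) ≡ 1 + (suc n * suc n + (suc n + t)) * 24
  eq-b n t p = trans (l n) (trans (cong (λ x → 1 + (suc n * suc n + suc n) * 24 + 12 * x) (sym p)) (r n t))
    where
    l : ∀ n → (7 + n * 6) * (7 + n * 6) ≡ 1 + (suc n * suc n + suc n) * 24 + 12 * (n * suc n)
    l = solve-∀
    r : ∀ n t → 1 + (suc n * suc n + suc n) * 24 + 12 * (2 * t) ≡ 1 + (suc n * suc n + (suc n + t)) * 24
    r = solve-∀
  pad : ∀ s x₂ x₃ x₄ x₅ x₆ x₇ → x₂ ≡ false → x₃ ≡ false → x₄ ≡ false → x₆ ≡ false →
        (s xor x₅) xor x₇ ≡ (((((s xor x₂) xor x₃) xor x₄) xor x₅) xor x₆) xor x₇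
  pad s _ _ _ x₅ _ x₇ refl refl refl refl
    rewrite Boolₚ.xor-identityʳ s | Boolₚ.xor-identityʳ s | Boolₚ.xor-identityʳ s | Boolₚ.xor-identityʳ (s xor x₅) = refl

euler-isSquare : ∀ m → euler 1 m ≡ isSquare (1 + m * 24)
euler-isSquare m = trans (euler-pentagonal m) (trans (pentagonal-isSquare m m)
  (sym (isSquareUpTo-stable (ℕₚ.≤⇒≤′ (s≤s (ℕₚ.*-monoʳ-≤ m (ℕₚ.m≤m+n 6 18)))) (square-large m))))
  where
  square-large : ∀ m → 1 + m * 24 ≤ (1 + m * 6) * (1 + m * 6)
  square-large zero    = s≤s z≤n
  square-large (suc m) = subst (1 + suc m * 24 ≤_) (sym (lemma m)) (ℕₚ.m≤m+n _ _)
    where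
    lemma : ∀ m → (1 + suc m * 6) * (1 + suc m * 6) ≡ 1 + suc m * 24 + (24 + m * 60 + m * m * 36)
    lemma = solve-∀

-- Parity of the number of elements of a list satisfying a Boolean predicate

⨁ : ∀ {A : Set} → (A → Bool) → List A → Bool
⨁ P []       = false
⨁ P (x ∷ xs) = P x xor ⨁ P xs

⨁-cong : ∀ {A : Set} {P Q : A → Bool} → (∀ x → P x ≡ Q x) → ∀ xs → ⨁ P xs ≡ ⨁ Q xs
⨁-cong p []       = refl
⨁-cong p (x ∷ xs) = cong₂ _xor_ (p x) (⨁-cong p xs)

⨁-xor : ∀ {A : Set} (P Q : A → Bool) xs → ⨁ (λ x → P x xor Q x) xs ≡ ⨁ P xs xor ⨁ Q xs
⨁-xor P Q []       = refl
⨁-xor P Q (x ∷ xs) = trans (cong ((P x xor Q x) xor_) (⨁-xor P Q xs)) (xor-middle (P x) (Q x) (⨁ P xs) (⨁ Q xs))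

⨁-++ : ∀ {A : Set} (P : A → Bool) xs ys → ⨁ P (xs ++ ys) ≡ ⨁ P xs xor ⨁ P ys
⨁-++ P []       ys = refl
⨁-++ P (x ∷ xs) ys = trans (cong (P x xor_) (⨁-++ P xs ys)) (sym (Boolₚ.xor-assoc (P x) (⨁ P xs) (⨁ P ys)))

⨁-map : ∀ {A B : Set} (P : B → Bool) (f : A → B) xs → ⨁ P (map f xs) ≡ ⨁ (λ x → P (f x)) xs
⨁-map P f []       = refl
⨁-map P f (x ∷ xs) = cong (P (f x) xor_) (⨁-map P f xs)

⨁-applyUpTo : ∀ {A : Set} (P : A → Bool) f n → ⨁ P (applyUpTo f n) ≡ ⨁ (λ k → P (f k)) (upTo n)
⨁-applyUpTo P f zero    = refl
⨁-applyUpTo P f (suc n) = cong (P (f 0) xor_)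
  (trans (⨁-applyUpTo P (λ k → f (suc k)) n) (sym (⨁-applyUpTo (λ k → P (f k)) suc n)))

opaque
  unfolding _⊗_

  ⊗-⨁ : ∀ f g n → (f ⊗ g) n ≡ ⨁ (λ k → f k ∧ g (n ∸ k)) (upTo (suc n))
  ⊗-⨁ f g zero    = sym (Boolₚ.xor-identityʳ _)
  ⊗-⨁ f g (suc n) = cong ((f 0 ∧ g (suc n)) xor_)
    (trans (⊗-⨁ (tl f) g n) (sym (⨁-applyUpTo (λ k → f k ∧ g (suc n ∸ k)) suc (suc n))))

⨁-none : ∀ {A : Set} (P : A → Bool) xs → (∀ x → x ∈ xs → P x ≢ true) → ⨁ P xs ≡ false
⨁-none P []       h = refl
⨁-none P (x ∷ xs) h with P x in eq
... | true  = contradiction eq (h x (here refl))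
... | false = ⨁-none P xs (λ y y∈ → h y (there y∈))

∧-true : ∀ {a b} → a ∧ b ≡ true → a ≡ true × b ≡ true
∧-true {true} {true} _ = refl , refl

does-true : ∀ {A : Set} (a? : Dec A) → does a? ≡ true → A
does-true (yes a) _ = a

module Pairing {A : Set} (_≟A_ : DecidableEquality A) where

  _without_ : (A → Bool) → A → A → Bool
  (P without y) x = P x ∧ not (does (x ≟A y))

  without-≢ : ∀ {P x y} → x ≢ y → (P without y) x ≡ P x
  without-≢ {P} {x} {y} x≢y rewrite dec-false (x ≟A y) x≢y = Boolₚ.∧-identityʳ (P x)

  without-true : ∀ {P x y} → (P without y) x ≡ true → P x ≡ true × x ≢ y
  without-true {P} {x} {y} p with ∧-true {P x} p
  ... | px , r = px , λ { refl → contradiction (trans (sym (cong not (dec-true (x ≟A x) refl))) r) λ () }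

  ⨁-without-∉ : ∀ P {y} xs → All (y ≢_) xs → ⨁ (P without y) xs ≡ ⨁ P xs
  ⨁-without-∉ P []       []         = refl
  ⨁-without-∉ P (x ∷ xs) (y≢x ∷ h) = cong₂ _xor_ (without-≢ {P} λ x≡y → y≢x (sym x≡y)) (⨁-without-∉ P xs h)

  ⨁-without : ∀ P {y} xs → Unique xs → y ∈ xs → P y ≡ true → ⨁ P xs ≡ not (⨁ (P without y) xs)
  ⨁-without P {y} (x ∷ xs) (x∉ ∷ u) (here refl) py = begin
    P y xor ⨁ P xs                           ≡⟨ cong (_xor ⨁ P xs) py ⟩
    not (⨁ P xs)                             ≡⟨ cong not (sym (⨁-without-∉ P xs x∉)) ⟩
    not (⨁ (P without y) xs)                 ≡⟨ cong (λ b → not (b xor ⨁ (P without y) xs)) (sym off) ⟩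
    not (⨁ (P without y) (y ∷ xs))           ∎
    where
    open ≡-Reasoning
    off : (P without y) y ≡ false
    off = trans (cong (λ b → P y ∧ not b) (dec-true (y ≟A y) refl)) (Boolₚ.∧-zeroʳ (P y))
  ⨁-without P {y} (x ∷ xs) (x∉ ∷ u) (there y∈xs) py = begin
    P x xor ⨁ P xs                              ≡⟨ cong₂ _xor_ (sym (without-≢ {P} (All.lookup x∉ y∈xs))) (⨁-without P xs u y∈xs py) ⟩
    (P without y) x xor not (⨁ (P without y) xs) ≡⟨ sym (Boolₚ.not-distribʳ-xor ((P without y) x) (⨁ (P without y) xs)) ⟩
    not (⨁ (P without y) (x ∷ xs))              ∎
    where open ≡-Reasoning

  record Matching (_~_ : A → A → Set) (P : A → Bool) : Set where
    field
      symmetric   : ∀ {x y} → P x ≡ true → P y ≡ true → x ~ y → y ~ x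
      functional  : ∀ {x y z} → P x ≡ true → P y ≡ true → P z ≡ true → x ~ y → x ~ z → y ≡ z
      irreflexive : ∀ {x y} → P x ≡ true → P y ≡ true → x ~ y → x ≢ y
  open Matching

  Matching-without : ∀ {_~_ P} y → Matching _~_ P → Matching _~_ (P without y)
  Matching-without {P = P} y m = record
    { symmetric   = λ px py → symmetric m (w px) (w py)
    ; functional  = λ px py pz → functional m (w px) (w py) (w pz)
    ; irreflexive = λ px py → irreflexive m (w px) (w py) }
    where
    w : ∀ {x} → (P without y) x ≡ true → P x ≡ true
    w p = proj₁ (without-true {P} p)

  -- Finding the partner of an element may instead produce an exception.
  perfect-matching⇒even : ∀ {Exception : Set} {_~_ P} → Matching _~_ P → ∀ xs → Unique xs →
    (∀ x → x ∈ xs → P x ≡ true → Exception ⊎ ∃[ y ] (y ∈ xs × P y ≡ true × x ~ y)) →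
    Exception ⊎ ⨁ P xs ≡ false
  perfect-matching⇒even m []       _        _     = inj₂ refl
  perfect-matching⇒even {_~_ = _~_} {P} m (x ∷ xs) (x∉ ∷ u) match with P x in px
  ... | false = perfect-matching⇒even m xs u match′
    where
    match′ : ∀ z → z ∈ xs → P z ≡ true → _ ⊎ ∃[ y ] (y ∈ xs × P y ≡ true × z ~ y)
    match′ z z∈ pz with match z (there z∈) pz
    ... | inj₁ e = inj₁ e
    ... | inj₂ (y , here refl , py , _) = contradiction (trans (sym px) py) λ ()
    ... | inj₂ (y , there y∈ , py , z~y) = inj₂ (y , y∈ , py , z~y)
  ... | true with match x (here refl) px
  ...   | inj₁ e = inj₁ e
  ...   | inj₂ (y , here refl , py , x~y) = ⊥-elim (irreflexive m px py x~y refl)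
  -- The pair x, y contributes nothing to the parity. What remains is still matched: a partner x of
  -- z would force z = y, and a partner y of z would force z = x.
  ...   | inj₂ (y , there y∈ , py , x~y) with perfect-matching⇒even (Matching-without y m) xs u match′
    where
    match′ : ∀ z → z ∈ xs → (P without y) z ≡ true → _ ⊎ ∃[ w ] (w ∈ xs × (P without y) w ≡ true × z ~ w)
    match′ z z∈ p′z with without-true {P} p′z
    ... | pz , z≢y with match z (there z∈) pz
    ...   | inj₁ e = inj₁ e
    ...   | inj₂ (w , here refl , pw , z~w) = ⊥-elim (z≢y (functional m pw pz py (symmetric m pz pw z~w) x~y))
    ...   | inj₂ (w , there w∈ , pw , z~w) = inj₂ (w , w∈ , trans (without-≢ {P} w≢y) pw , z~w)
      where
      w≢y : w ≢ y
      w≢y refl = All.lookup x∉ z∈ (sym (functional m pw pz px (symmetric m pz pw z~w) (symmetric m px pw x~y)))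
  ...     | inj₁ e = inj₁ e
  ...     | inj₂ even = inj₂ (trans (cong not (⨁-without P xs u y∈ py)) (trans (Boolₚ.not-involutive _) even))

  ⨁-unique : ∀ P xs → Unique xs → ∀ x → x ∈ xs → P x ≡ true → (∀ y → P y ≡ true → y ≡ x) → ⨁ P xs ≡ true
  ⨁-unique P xs u x x∈ px h = trans (⨁-without P xs u x∈ px)
    (cong not (⨁-none (P without x) xs λ y _ p → let py , y≢x = without-true {P} p in y≢x (h y py)))

-- Squares of integers and their roots modulo 6

square-abs : ∀ x → x ℤ.* x ≡ + (∣ x ∣ * ∣ x ∣)
square-abs (+ n)    = sym (ℤₚ.pos-* n n)
square-abs -[1+ n ] = refl

square-injective : ∀ {m n} → m * m ≡ n * n → m ≡ n
square-injective {m} {n} p with ℕₚ.<-cmp m n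
... | tri< m<n _ _ = contradiction p (ℕₚ.<⇒≢ (ℕₚ.*-mono-< m<n m<n))
... | tri≈ _ m≡n _ = m≡n
... | tri> _ _ n<m = contradiction (sym p) (ℕₚ.<⇒≢ (ℕₚ.*-mono-< n<m n<m))

abs-injective : ∀ x y → ∣ x ∣ ≡ ∣ y ∣ → x ≡ y ⊎ x ≡ ℤ.- y
abs-injective (+ m)    (+ n)    p = inj₁ (cong (λ t → + t) p)
abs-injective (+ m)    -[1+ n ] p = inj₂ (cong (λ t → + t) p)
abs-injective -[1+ m ] (+ n)    p = inj₂ (cong (λ t → ℤ.- (+ t)) p)
abs-injective -[1+ m ] -[1+ n ] p = inj₁ (cong (λ t → ℤ.- (+ t)) p)

square-injectiveℤ : ∀ {x y} → x ℤ.* x ≡ y ℤ.* y → x ≡ y ⊎ x ≡ ℤ.- y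
square-injectiveℤ {x} {y} p =
  abs-injective x y (square-injective (ℤₚ.+-injective (trans (sym (square-abs x)) (trans p (square-abs y)))))

1%3 : ∀ i → (1 + i * 24) % 3 ≡ 1
1%3 i = trans (cong (λ t → (1 + t) % 3) (sym (ℕₚ.*-assoc i 8 3))) ([m+kn]%n≡m%n 1 (i * 8) 3)

3∤root : ∀ {r i} ρ → r * r ≡ 1 + i * 24 → r ≢ ρ * 3
3∤root {r} {i} ρ p refl = contradiction (trans (sym (trans (cong (_% 3) p) (1%3 i))) (trans (cong (_% 3) (lemma ρ)) ([m+kn]%n≡m%n 0 (ρ * 3 * ρ) 3))) λ ()
  where
  lemma : ∀ ρ → ρ * 3 * (ρ * 3) ≡ 0 + ρ * 3 * ρ * 3
  lemma = solve-∀

residue₆ : ∀ r → ∃[ ρ ] ∃[ a ] (ρ < 6 × r ≡ ρ + a * 6)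
residue₆ r = r % 6 , r / 6 , m%n<n r 6 , m≡m%n+[m/n]*n r 6

±1mod6 : ℕ → Set
±1mod6 r = ∃[ a ] (r ≡ 1 + a * 6 ⊎ r ≡ 5 + a * 6)

odd-1+24* : ∀ i → odd (1 + i * 24) ≡ true
odd-1+24* i = cong not (trans (odd-* i 24) (Boolₚ.∧-zeroʳ (odd i)))

odd-*6 : ∀ a → odd (a * 6) ≡ false
odd-*6 a = trans (odd-* a 6) (Boolₚ.∧-zeroʳ (odd a))

odd-square : ∀ n → odd (n * n) ≡ odd n
odd-square n = trans (odd-* n n) (Boolₚ.∧-idem (odd n))

root⇒±1mod6 : ∀ {r i} → r * r ≡ 1 + i * 24 → ±1mod6 r
root⇒±1mod6 {r} {i} p with residue₆ r
... | 1 , a , _ , e = a , inj₁ e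
... | 5 , a , _ , e = a , inj₂ e
... | 0 , a , _ , refl = ⊥-elim (3∤root {0 + a * 6} {i} (a * 2) p (sym (ℕₚ.*-assoc a 2 3)))
... | 3 , a , _ , refl = ⊥-elim (3∤root {3 + a * 6} {i} (1 + a * 2) p (lemma a))
  where
  lemma : ∀ a → 3 + a * 6 ≡ (1 + a * 2) * 3
  lemma = solve-∀
... | 2 , a , _ , refl = contradiction (trans (sym (trans (cong odd p) (odd-1+24* i))) (trans (odd-square (2 + a * 6)) (cong (λ b → not (not b)) (odd-*6 a)))) λ ()
... | 4 , a , _ , refl = contradiction (trans (sym (trans (cong odd p) (odd-1+24* i))) (trans (odd-square (4 + a * 6)) (cong (λ b → not (not (not (not b)))) (odd-*6 a)))) λ ()
... | suc (suc (suc (suc (suc (suc ρ))))) , a , s≤s (s≤s (s≤s (s≤s (s≤s (s≤s ()))))) , _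

-- The case distinction behind the matching in `Descent`: a root r divisible by 3 is paired through
-- s ↦ -s, any other odd r belongs to an exponent i.
odd⇒root : ∀ r → odd r ≡ true → (∃[ ρ ] r ≡ ρ * 3) ⊎ (∃[ i ] r * r ≡ 1 + i * 24)
odd⇒root r p with residue₆ r
... | 0 , a , _ , refl = inj₁ (a * 2 , sym (ℕₚ.*-assoc a 2 3))
... | 1 , a , _ , refl = inj₂ (a * a + triangle a , lemma a (triangle a) (2*triangle a))
  where
  lemma : ∀ a t → 2 * t ≡ a * suc a → (1 + a * 6) * (1 + a * 6) ≡ 1 + (a * a + t) * 24
  lemma a t h = trans (l a) (trans (cong (λ x → 1 + a * a * 24 + 12 * x) (sym h)) (r′ a t))
    where
    l : ∀ a → (1 + a * 6) * (1 + a * 6) ≡ 1 + a * a * 24 + 12 * (a * suc a)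
    l = solve-∀
    r′ : ∀ a t → 1 + a * a * 24 + 12 * (2 * t) ≡ 1 + (a * a + t) * 24
    r′ = solve-∀
... | 2 , a , _ , refl = contradiction (trans (sym p) (cong (λ b → not (not b)) (odd-*6 a))) λ ()
... | 3 , a , _ , refl = inj₁ (1 + a * 2 , lemma a)
  where
  lemma : ∀ a → 3 + a * 6 ≡ (1 + a * 2) * 3
  lemma = solve-∀
... | 4 , a , _ , refl = contradiction (trans (sym p) (cong (λ b → not (not (not (not b)))) (odd-*6 a))) λ ()
... | 5 , a , _ , refl = inj₂ (a * a + a + (suc a + triangle a) , lemma a (triangle a) (2*triangle a))
  where
  lemma : ∀ a t → 2 * t ≡ a * suc a → (5 + a * 6) * (5 + a * 6) ≡ 1 + (a * a + a + (suc a + t)) * 24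
  lemma a t h = trans (l a) (trans (cong (λ x → 25 + a * a * 24 + a * 48 + 12 * x) (sym h)) (r′ a t))
    where
    l : ∀ a → (5 + a * 6) * (5 + a * 6) ≡ 25 + a * a * 24 + a * 48 + 12 * (a * suc a)
    l = solve-∀
    r′ : ∀ a t → 25 + a * a * 24 + a * 48 + 12 * (2 * t) ≡ 1 + (a * a + a + (suc a + t)) * 24
    r′ = solve-∀
... | suc (suc (suc (suc (suc (suc ρ))))) , a , s≤s (s≤s (s≤s (s≤s (s≤s (s≤s ()))))) , _

-- One of s and -s is congruent to r modulo 6, which makes k = (±s - r) / (1 + c) an integer when 1
-- + c divides 6.
±1mod6-congruent : ∀ {r s} → ±1mod6 r → ±1mod6 s → ∃[ k ] (+ s ≡ + r ℤ.+ + 6 ℤ.* k ⊎ ℤ.- (+ s) ≡ + r ℤ.+ + 6 ℤ.* k)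
±1mod6-congruent {r} {s} (a , p) (b , p′) = cases p p′
  where
  pos : ∀ u a → + (u + a * 6) ≡ + u ℤ.+ + a ℤ.* + 6
  pos u a = cong (λ t → + u ℤ.+ t) (ℤₚ.pos-* a 6)
  equal : ∀ u a b → u ℤ.+ b ℤ.* + 6 ≡ u ℤ.+ a ℤ.* + 6 ℤ.+ + 6 ℤ.* (b ℤ.- a)
  equal = ℤSolver.solve-∀
  opposite₁ : ∀ a b → ℤ.- (+ 5 ℤ.+ b ℤ.* + 6) ≡ + 1 ℤ.+ a ℤ.* + 6 ℤ.+ + 6 ℤ.* ℤ.- (+ 1 ℤ.+ a ℤ.+ b)
  opposite₁ = ℤSolver.solve-∀
  opposite₅ : ∀ a b → ℤ.- (+ 1 ℤ.+ b ℤ.* + 6) ≡ + 5 ℤ.+ a ℤ.* + 6 ℤ.+ + 6 ℤ.* ℤ.- (+ 1 ℤ.+ a ℤ.+ b)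
  opposite₅ = ℤSolver.solve-∀
  k₋ k₊ : ℤ
  k₋ = + b ℤ.- + a
  k₊ = ℤ.- (+ 1 ℤ.+ + a ℤ.+ + b)
  cases : r ≡ 1 + a * 6 ⊎ r ≡ 5 + a * 6 → s ≡ 1 + b * 6 ⊎ s ≡ 5 + b * 6 →
          ∃[ k ] (+ s ≡ + r ℤ.+ + 6 ℤ.* k ⊎ ℤ.- (+ s) ≡ + r ℤ.+ + 6 ℤ.* k)
  cases (inj₁ refl) (inj₁ refl) = k₋ , inj₁ (trans (pos 1 b) (trans (equal (+ 1) (+ a) (+ b)) (cong (λ t → t ℤ.+ + 6 ℤ.* k₋) (sym (pos 1 a)))))
  cases (inj₂ refl) (inj₂ refl) = k₋ , inj₁ (trans (pos 5 b) (trans (equal (+ 5) (+ a) (+ b)) (cong (λ t → t ℤ.+ + 6 ℤ.* k₋) (sym (pos 5 a)))))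
  cases (inj₁ refl) (inj₂ refl) = k₊ , inj₂ (trans (cong ℤ.-_ (pos 5 b)) (trans (opposite₁ (+ a) (+ b)) (cong (λ t → t ℤ.+ + 6 ℤ.* k₊) (sym (pos 1 a)))))
  cases (inj₂ refl) (inj₁ refl) = k₊ , inj₂ (trans (cong ℤ.-_ (pos 1 b)) (trans (opposite₅ (+ a) (+ b)) (cong (λ t → t ℤ.+ + 6 ℤ.* k₊) (sym (pos 5 a)))))

-- Counting the solutions of r² + c s² = (1 + c) M through the form x² + c y² = M

ℤ≤ : ℕ → List ℤ
ℤ≤ n = map +_ (upTo (suc n)) ++ map -[1+_] (upTo n)

ℤ≤-unique : ∀ n → Unique (ℤ≤ n)
ℤ≤-unique n = Unique.++⁺ (Unique.map⁺ ℤₚ.+-injective (Unique.upTo⁺ (suc n))) (Unique.map⁺ ℤₚ.-[1+-injective (Unique.upTo⁺ n)) disjoint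
  where
  disjoint : ∀ {x} → ¬ (x ∈ map +_ (upTo (suc n)) × x ∈ map -[1+_] (upTo n))
  disjoint (p , p′) with ∈-map⁻ +_ p | ∈-map⁻ -[1+_] p′
  ... | _ , _ , refl | _ , _ , ()

∈-ℤ≤ : ∀ {n} x → ∣ x ∣ ≤ n → x ∈ ℤ≤ n
∈-ℤ≤ {n} (+ m)    h = ∈-++⁺ˡ (∈-map⁺ +_ (∈-upTo⁺ (s≤s h)))
∈-ℤ≤ {n} -[1+ m ] h = ∈-++⁺ʳ (map +_ (upTo (suc n))) (∈-map⁺ -[1+_] (∈-upTo⁺ h))

n≤n² : ∀ n → n ≤ n * n
n≤n² zero    = z≤n
n≤n² (suc n) = ℕₚ.m≤m*n (suc n) (suc n)

+-cancelˡ : ∀ a {x y} → a ℤ.+ x ≡ a ℤ.+ y → x ≡ y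
+-cancelˡ a {x} {y} p = trans (lemma a x) (trans (cong (λ t → t ℤ.- a) p) (sym (lemma a y)))
  where
  lemma : ∀ a x → x ≡ a ℤ.+ x ℤ.- a
  lemma = ℤSolver.solve-∀

≡-from-⇔ : ∀ {a b : Bool} → (a ≡ true → b ≡ true) → (b ≡ true → a ≡ true) → a ≡ b
≡-from-⇔ {true}  {b}     f g = sym (f refl)
≡-from-⇔ {false} {true}  f g = g refl
≡-from-⇔ {false} {false} f g = refl

-- d = 6 / (1 + c) and g = (1 + c) / 3. The exponent is e: if r² = 1 + 24 i and s² = 1 + 24 i′ with
-- i + c i′ = e, then r² + c s² = (1 + c) + 24 e = (1 + c) M.
module FormCount
  (c₁ d g e M : ℕ) (d*[1+c]≡6 : d * suc (suc c₁) ≡ 6) (1+c≡g*3 : suc (suc c₁) ≡ g * 3)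
  ([1+c]*M≡ : suc (suc c₁) * M ≡ suc (suc c₁) + 24 * e) (M-odd : odd M ≡ true)
  (F G : F₂[[q]]) (F-isSquare : ∀ i → F i ≡ isSquare (1 + i * 24))
  (G-sound : ∀ j → G j ≡ true → ∃[ s ] ∃[ i ] (j ≡ i * suc c₁ × s * s ≡ 1 + i * 24))
  (G-complete : ∀ j s → suc c₁ * (s * s) ≡ suc c₁ + 24 * j → G j ≡ true)
  where

  private
    c : ℕ
    c = suc c₁

  -- The form x² + c y² at x = r + c k and y = k. Then r = x - c y and s = x + y = r + (1 + c) k,
  -- and integrality of x and y is built in.
  norm : ℕ → ℤ → ℤ
  norm r k = (+ r ℤ.+ + c ℤ.* k) ℤ.* (+ r ℤ.+ + c ℤ.* k) ℤ.+ + c ℤ.* (k ℤ.* k)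

  Solution : ℕ × ℤ → Bool
  Solution (r , k) = does (norm r k ℤ.≟ + M)

  private
    solves : ∀ {r k} → Solution (r , k) ≡ true → norm r k ≡ + M
    solves {r} {k} = does-true (norm r k ℤ.≟ + M)

    solution : ∀ {r k} → norm r k ≡ + M → Solution (r , k) ≡ true
    solution {r} {k} = dec-true (norm r k ℤ.≟ + M)

    -- Modulo 2 squares may be dropped: x² + c y² = (r + c k) + c k = r.
    r-odd : ∀ {r k} → norm r k ≡ + M → odd r ≡ true
    r-odd {r} {k} p = trans (sym (bits (odd r) (odd c) (oddℤ k))) (trans (sym parity-norm) (trans (cong oddℤ p) M-odd))
      where
      bits : ∀ R C K → ((R xor (C ∧ K)) ∧ (R xor (C ∧ K))) xor (C ∧ (K ∧ K)) ≡ R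
      bits true  true  true  = refl
      bits true  true  false = refl
      bits true  false K     = refl
      bits false true  true  = refl
      bits false true  false = refl
      bits false false K     = refl
      x : ℤ
      x = + r ℤ.+ + c ℤ.* k
      parity-x : oddℤ x ≡ odd r xor (odd c ∧ oddℤ k)
      parity-x = trans (oddℤ-+ (+ r) (+ c ℤ.* k)) (cong (odd r xor_) (oddℤ-* (+ c) k))
      parity-norm : oddℤ (norm r k) ≡ ((odd r xor (odd c ∧ oddℤ k)) ∧ (odd r xor (odd c ∧ oddℤ k))) xor (odd c ∧ (oddℤ k ∧ oddℤ k))
      parity-norm = trans (oddℤ-+ (x ℤ.* x) (+ c ℤ.* (k ℤ.* k))) (cong₂ _xor_
        (trans (oddℤ-* x x) (cong₂ _∧_ parity-x parity-x))
        (trans (oddℤ-* (+ c) (k ℤ.* k)) (cong (odd c ∧_) (oddℤ-* k k))))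

    r≢0 : ∀ {k} → norm 0 k ≢ + M
    r≢0 {k} p = contradiction (r-odd {0} {k} p) λ ()

    bound : ℕ
    bound = M + c * M

    box : List (ℕ × ℤ)
    box = cartesianProduct (upTo (suc bound)) (ℤ≤ bound)

    box-unique : Unique box
    box-unique = Unique.cartesianProduct⁺ (Unique.upTo⁺ (suc bound)) (ℤ≤-unique bound)

    in-box : ∀ {r k} → norm r k ≡ + M → (r , k) ∈ box
    in-box {r} {k} p = ∈-cartesianProduct⁺ (∈-upTo⁺ (s≤s r≤)) (∈-ℤ≤ k (ℕₚ.≤-trans k≤M (ℕₚ.m≤m+n M (c * M))))
      where
      x : ℤ
      x = + r ℤ.+ + c ℤ.* k
      sum : ∣ x ∣ * ∣ x ∣ + c * (∣ k ∣ * ∣ k ∣) ≡ M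
      sum = ℤₚ.+-injective (trans (sym (cong₂ ℤ._+_ (square-abs x)
        (trans (cong (λ t → + c ℤ.* t) (square-abs k)) (sym (ℤₚ.pos-* c (∣ k ∣ * ∣ k ∣)))))) p)
      k≤M : ∣ k ∣ ≤ M
      k≤M = ℕₚ.≤-trans (n≤n² ∣ k ∣) (ℕₚ.≤-trans (ℕₚ.m≤n*m (∣ k ∣ * ∣ k ∣) c) (subst (c * (∣ k ∣ * ∣ k ∣) ≤_) sum (ℕₚ.m≤n+m (c * (∣ k ∣ * ∣ k ∣)) (∣ x ∣ * ∣ x ∣))))
      x≤M : ∣ x ∣ ≤ M
      x≤M = ℕₚ.≤-trans (n≤n² ∣ x ∣) (subst (∣ x ∣ * ∣ x ∣ ≤_) sum (ℕₚ.m≤m+n (∣ x ∣ * ∣ x ∣) (c * (∣ k ∣ * ∣ k ∣))))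
      r≤ : r ≤ bound
      r≤ = begin
        r                              ≡⟨ cong ∣_∣ (lemma (+ r) (+ c ℤ.* k)) ⟩
        ∣ x ℤ.- + c ℤ.* k ∣            ≤⟨ ℤₚ.∣i-j∣≤∣i∣+∣j∣ x (+ c ℤ.* k) ⟩
        ∣ x ∣ + ∣ + c ℤ.* k ∣          ≡⟨ cong (λ t → ∣ x ∣ + t) (ℤₚ.abs-* (+ c) k) ⟩
        ∣ x ∣ + c * ∣ k ∣              ≤⟨ ℕₚ.+-mono-≤ x≤M (ℕₚ.*-monoʳ-≤ c k≤M) ⟩
        M + c * M                      ∎
        where
        open ℕₚ.≤-Reasoning
        lemma : ∀ r y → r ≡ r ℤ.+ y ℤ.- y
        lemma = ℤSolver.solve-∀

    -- With s = r + (1 + c) k.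
    scaled-norm : ∀ r k → + suc c ℤ.* norm r k ≡ + r ℤ.* + r ℤ.+ + c ℤ.* ((+ r ℤ.+ + suc c ℤ.* k) ℤ.* (+ r ℤ.+ + suc c ℤ.* k))
    scaled-norm r k = lemma (+ r) (+ c) k
      where
      lemma : ∀ r c k → (+ 1 ℤ.+ c) ℤ.* ((r ℤ.+ c ℤ.* k) ℤ.* (r ℤ.+ c ℤ.* k) ℤ.+ c ℤ.* (k ℤ.* k))
                        ≡ r ℤ.* r ℤ.+ c ℤ.* ((r ℤ.+ (+ 1 ℤ.+ c) ℤ.* k) ℤ.* (r ℤ.+ (+ 1 ℤ.+ c) ℤ.* k))
      lemma = ℤSolver.solve-∀

  -- The involution (x, y) ↦ (x, -y) in the coordinates x = r + c k, y = k, normalised to r ≥ 0.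
  module Reflection
    (sq₂ : Bool) (sq₂-sound : sq₂ ≡ true → ∃[ t ] M ≡ c * (t * t)) (sq₂-complete : ∀ t → M ≡ c * (t * t) → sq₂ ≡ true)
    where

    private
      -- The solutions on the axis y = 0, present when M is a square, those on the axis x = 0,
      -- present when M = c t², and the others, on which the reflection has no fixed point.
      y-zero x-zero generic : ℕ × ℤ → Bool
      y-zero  (r , k) = Solution (r , k) ∧ does (k ℤ.≟ + 0)
      x-zero  (r , k) = Solution (r , k) ∧ does (+ r ℤ.≟ ℤ.- (+ c ℤ.* k))
      generic (r , k) = Solution (r , k) ∧ (not (does (k ℤ.≟ + 0)) ∧ not (does (+ r ℤ.≟ ℤ.- (+ c ℤ.* k))))

      trichotomy : ∀ x → Solution x ≡ (y-zero x xor x-zero x) xor generic x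
      trichotomy (r , k) = cases (Solution (r , k)) (k ℤ.≟ + 0) (+ r ℤ.≟ ℤ.- (+ c ℤ.* k)) exclusive
        where
        exclusive : Solution (r , k) ≡ true → k ≡ + 0 → + r ≢ ℤ.- (+ c ℤ.* k)
        exclusive s refl p with trans p (cong ℤ.-_ (ℤₚ.*-zeroʳ (+ c)))
        ... | refl = r≢0 {+ 0} (solves {0} {+ 0} s)
        cases : ∀ b {A B : Set} (a? : Dec A) (b? : Dec B) → (b ≡ true → A → ¬ B) →
                b ≡ ((b ∧ does a?) xor (b ∧ does b?)) xor (b ∧ (not (does a?) ∧ not (does b?)))
        cases false _       _       h = refl
        cases true  (yes a) (yes b) h = contradiction b (h refl a)
        cases true  (yes a) (no ¬b) h = refl
        cases true  (no ¬a) (yes b) h = refl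
        cases true  (no ¬a) (no ¬b) h = refl

      open Pairing (Productₚ.≡-dec _≟_ ℤ._≟_)

      ⨁-y-zero : ⨁ y-zero box ≡ isSquare M
      ⨁-y-zero with isSquare M in eq
      ... | true with t , refl ← isSquare-sound M eq =
        ⨁-unique y-zero box box-unique (t , + 0) (in-box {t} {+ 0} norm-t) (cong₂ _∧_ (solution {t} {+ 0} norm-t) refl) unique
        where
        norm-0 : ∀ r → norm r (+ 0) ≡ + (r * r)
        norm-0 r = trans (lemma (+ r) (+ c)) (sym (ℤₚ.pos-* r r))
          where
          lemma : ∀ r c → (r ℤ.+ c ℤ.* + 0) ℤ.* (r ℤ.+ c ℤ.* + 0) ℤ.+ c ℤ.* (+ 0 ℤ.* + 0) ≡ r ℤ.* r
          lemma = ℤSolver.solve-∀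
        norm-t : norm t (+ 0) ≡ + (t * t)
        norm-t = norm-0 t
        unique : ∀ y → y-zero y ≡ true → y ≡ (t , + 0)
        unique (r , k) p with ∧-true {Solution (r , k)} p
        ... | s , z with does-true (k ℤ.≟ + 0) z
        ... | refl = cong (_, + 0) (square-injective (ℤₚ.+-injective (trans (sym (norm-0 r)) (solves {r} {+ 0} s))))
      ... | false = ⨁-none y-zero box none
        where
        lemma : ∀ r c → (r ℤ.+ c ℤ.* + 0) ℤ.* (r ℤ.+ c ℤ.* + 0) ℤ.+ c ℤ.* (+ 0 ℤ.* + 0) ≡ r ℤ.* r
        lemma = ℤSolver.solve-∀
        none : ∀ y → y ∈ box → y-zero y ≢ true
        none (r , k) _ p with ∧-true {Solution (r , k)} p
        ... | s , z with does-true (k ℤ.≟ + 0) z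
        ... | refl = contradiction (trans (sym eq) (subst (λ m → isSquare m ≡ true)
          (ℤₚ.+-injective (trans (ℤₚ.pos-* r r) (trans (sym (lemma (+ r) (+ c))) (solves {r} {+ 0} s)))) (isSquare-complete r))) λ ()

      norm-x-zero : ∀ {r k} → + r ≡ ℤ.- (+ c ℤ.* k) → norm r k ≡ + (c * (∣ k ∣ * ∣ k ∣))
      norm-x-zero {r} {k} p = begin
        norm r k                             ≡⟨ cong (λ x → (x ℤ.+ + c ℤ.* k) ℤ.* (x ℤ.+ + c ℤ.* k) ℤ.+ + c ℤ.* (k ℤ.* k)) p ⟩
        _                                    ≡⟨ lemma (+ c) k ⟩
        + c ℤ.* (k ℤ.* k)                    ≡⟨ cong (λ x → + c ℤ.* x) (square-abs k) ⟩
        + c ℤ.* + (∣ k ∣ * ∣ k ∣)            ≡⟨ sym (ℤₚ.pos-* c (∣ k ∣ * ∣ k ∣)) ⟩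
        + (c * (∣ k ∣ * ∣ k ∣))              ∎
        where
        open ≡-Reasoning
        lemma : ∀ c k → (ℤ.- (c ℤ.* k) ℤ.+ c ℤ.* k) ℤ.* (ℤ.- (c ℤ.* k) ℤ.+ c ℤ.* k) ℤ.+ c ℤ.* (k ℤ.* k) ≡ c ℤ.* (k ℤ.* k)
        lemma = ℤSolver.solve-∀

      ⨁-x-zero : ∀ b → sq₂ ≡ b → ⨁ x-zero box ≡ b
      ⨁-x-zero false eq = ⨁-none x-zero box none
        where
        none : ∀ y → y ∈ box → x-zero y ≢ true
        none (r , k) _ p with ∧-true {Solution (r , k)} p
        ... | s , z = contradiction (trans (sym eq) (sq₂-complete ∣ k ∣ (sym (ℤₚ.+-injective
          (trans (sym (norm-x-zero {r} {k} (does-true (+ r ℤ.≟ ℤ.- (+ c ℤ.* k)) z))) (solves {r} {k} s)))))) λ ()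
      ⨁-x-zero true eq with sq₂-sound eq
      ... | t , M≡ = ⨁-unique x-zero box box-unique (c * t , ℤ.- + t) (in-box {c * t} {ℤ.- + t} norm-t)
                          (cong₂ _∧_ (solution {c * t} {ℤ.- + t} norm-t) (dec-true (+ (c * t) ℤ.≟ ℤ.- (+ c ℤ.* ℤ.- + t)) on-axis)) unique
        where
        on-axis : + (c * t) ≡ ℤ.- (+ c ℤ.* ℤ.- + t)
        on-axis = trans (ℤₚ.pos-* c t) (lemma (+ c) (+ t))
          where
          lemma : ∀ c t → c ℤ.* t ≡ ℤ.- (c ℤ.* ℤ.- t)
          lemma = ℤSolver.solve-∀
        norm-t : norm (c * t) (ℤ.- + t) ≡ + M
        norm-t = trans (norm-x-zero {c * t} {ℤ.- + t} on-axis) (cong +_ (trans (cong (λ a → c * (a * a)) (ℤₚ.∣-i∣≡∣i∣ (+ t))) (sym M≡)))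
        unique : ∀ y → x-zero y ≡ true → y ≡ (c * t , ℤ.- + t)
        unique (r , k) p with ∧-true {Solution (r , k)} p
        ... | s , z = finish k (does-true (+ r ℤ.≟ ℤ.- (+ c ℤ.* k)) z) ∣k∣≡t
          where
          axis : + r ≡ ℤ.- (+ c ℤ.* k)
          axis = does-true (+ r ℤ.≟ ℤ.- (+ c ℤ.* k)) z
          ∣k∣≡t : ∣ k ∣ ≡ t
          ∣k∣≡t = square-injective (ℕₚ.*-cancelˡ-≡ (∣ k ∣ * ∣ k ∣) (t * t) c
            (trans (ℤₚ.+-injective (trans (sym (norm-x-zero {r} {k} axis)) (solves {r} {k} s))) M≡))
          finish : ∀ k → + r ≡ ℤ.- (+ c ℤ.* k) → ∣ k ∣ ≡ t → (r , k) ≡ (c * t , ℤ.- + t)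
          finish (+ zero)  q refl = cong₂ _,_ (ℤₚ.+-injective (trans q (trans (cong ℤ.-_ (ℤₚ.*-zeroʳ (+ c))) (cong +_ (sym (ℕₚ.*-zeroʳ c)))))) refl
          finish (+ suc n) q _    = contradiction q λ ()
          finish -[1+ n ]  q refl = cong₂ _,_ (ℤₚ.+-injective q) refl

      -- At (x, -y) the coordinate r = x - c y becomes x + c y = r + 2 c k. If this is negative, the
      -- opposite point (-x, y) is the normalised one.
      data _~_ : ℕ × ℤ → ℕ × ℤ → Set where
        negate-y : ∀ {r k r′ k′} → + r′ ≡ + r ℤ.+ + 2 ℤ.* (+ c ℤ.* k) → k′ ≡ ℤ.- k → (r , k) ~ (r′ , k′)
        negate-x : ∀ {r k r′ k′} → + r′ ≡ ℤ.- (+ r ℤ.+ + 2 ℤ.* (+ c ℤ.* k)) → k′ ≡ k → (r , k) ~ (r′ , k′)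

      parts : ∀ {r k} → generic (r , k) ≡ true → norm r k ≡ + M × k ≢ + 0 × + r ≢ ℤ.- (+ c ℤ.* k)
      parts {r} {k} p with ∧-true {Solution (r , k)} p
      ... | s , z with ∧-true {not (does (k ℤ.≟ + 0))} z
      ... | z₁ , z₂ = solves {r} {k} s , (λ q → contradiction (trans (sym z₁) (cong not (dec-true (k ℤ.≟ + 0) q))) λ ())
                    , (λ q → contradiction (trans (sym z₂) (cong not (dec-true (+ r ℤ.≟ ℤ.- (+ c ℤ.* k)) q))) λ ())

      assemble : ∀ {r k} → norm r k ≡ + M → k ≢ + 0 → + r ≢ ℤ.- (+ c ℤ.* k) → generic (r , k) ≡ true
      assemble {r} {k} s z₁ z₂ = cong₂ _∧_ (solution {r} {k} s)
        (cong₂ _∧_ (cong not (dec-false (k ℤ.≟ + 0) z₁)) (cong not (dec-false (+ r ℤ.≟ ℤ.- (+ c ℤ.* k)) z₂)))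

      both-signs : ∀ {r r′ t} → + r ≡ t → + r′ ≡ ℤ.- t → r ≡ 0
      both-signs {zero}  refl _ = refl
      both-signs {suc r} refl ()

      generic-r≢0 : ∀ {k} → generic (0 , k) ≢ true
      generic-r≢0 {k} p = r≢0 {k} (proj₁ (parts {0} {k} p))

      matching : Matching _~_ generic
      matching = record { symmetric = λ {x} {y} _ _ → symm {x} {y} ; functional = λ {x} {y} {z} px → func {x} {y} {z} ; irreflexive = λ {x} {y} → irrefl {x} {y} }
        where
        symm : ∀ {x y} → x ~ y → y ~ x
        symm {r , k} {r′ , k′} (negate-y p refl) = negate-y (trans (lemma (+ r) (+ c) k) (cong (λ t → t ℤ.+ + 2 ℤ.* (+ c ℤ.* ℤ.- k)) (sym p))) (sym (ℤₚ.neg-involutive k))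
          where
          lemma : ∀ r c k → r ≡ r ℤ.+ + 2 ℤ.* (c ℤ.* k) ℤ.+ + 2 ℤ.* (c ℤ.* ℤ.- k)
          lemma = ℤSolver.solve-∀
        symm {r , k} {r′ , k′} (negate-x p refl) = negate-x (trans (lemma (+ r) (+ c) k) (cong (λ t → ℤ.- (t ℤ.+ + 2 ℤ.* (+ c ℤ.* k))) (sym p))) refl
          where
          lemma : ∀ r c k → r ≡ ℤ.- (ℤ.- (r ℤ.+ + 2 ℤ.* (c ℤ.* k)) ℤ.+ + 2 ℤ.* (c ℤ.* k))
          lemma = ℤSolver.solve-∀
        func : ∀ {x y z} → generic y ≡ true → generic z ≡ true → x ~ y → x ~ z → y ≡ z
        func _ _ (negate-y p refl) (negate-y p′ refl) = cong (_, _) (ℤₚ.+-injective (trans p (sym p′)))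
        func _ _ (negate-x p refl) (negate-x p′ refl) = cong (_, _) (ℤₚ.+-injective (trans p (sym p′)))
        func {y = r , k} py _ (negate-y p refl) (negate-x p′ refl) with both-signs p p′
        ... | refl = contradiction py (generic-r≢0 {k})
        func {z = r , k} _ pz (negate-x p refl) (negate-y p′ refl) with both-signs p′ p
        ... | refl = contradiction pz (generic-r≢0 {k})
        irrefl : ∀ {x y} → generic x ≡ true → generic y ≡ true → x ~ y → x ≢ y
        irrefl {r , k} px _ (negate-y p q) refl = proj₁ (proj₂ (parts {r} {k} px)) (self-negative k q)
          where
          self-negative : ∀ k → k ≡ ℤ.- k → k ≡ + 0
          self-negative (+ zero)  _ = refl
          self-negative (+ suc n) ()
          self-negative -[1+ n ]  ()
        irrefl {r , k} px _ (negate-x p q) refl = proj₂ (proj₂ (parts {r} {k} px))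
          (ℤₚ.*-cancelˡ-≡ (+ 2) (+ r) (ℤ.- (+ c ℤ.* k)) (trans (lemma₁ (+ r)) (trans (cong (λ t → + r ℤ.+ t) p) (lemma₂ (+ r) (+ c) k))))
          where
          lemma₁ : ∀ r → + 2 ℤ.* r ≡ r ℤ.+ r
          lemma₁ = ℤSolver.solve-∀
          lemma₂ : ∀ r c k → r ℤ.+ ℤ.- (r ℤ.+ + 2 ℤ.* (c ℤ.* k)) ≡ + 2 ℤ.* ℤ.- (c ℤ.* k)
          lemma₂ = ℤSolver.solve-∀

      partner : ∀ x → x ∈ box → generic x ≡ true → ⊥ ⊎ ∃[ y ] (y ∈ box × generic y ≡ true × x ~ y)
      partner (r , k) _ p with parts {r} {k} p | ℤₚ.+∣i∣≡i⊎+∣i∣≡-i (+ r ℤ.+ + 2 ℤ.* (+ c ℤ.* k))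
      ... | n , k≢0 , r≢ | inj₁ q = inj₂ ((t , ℤ.- k) , in-box {t} {ℤ.- k} n′ , assemble {t} {ℤ.- k} n′ -k≢0 r′≢ , negate-y q refl)
        where
        t : ℕ
        t = ∣ + r ℤ.+ + 2 ℤ.* (+ c ℤ.* k) ∣
        n′ : norm t (ℤ.- k) ≡ + M
        n′ = trans (cong (λ x → (x ℤ.+ + c ℤ.* ℤ.- k) ℤ.* (x ℤ.+ + c ℤ.* ℤ.- k) ℤ.+ + c ℤ.* (ℤ.- k ℤ.* ℤ.- k)) q) (trans (lemma (+ r) (+ c) k) n)
          where
          lemma : ∀ r c k → (r ℤ.+ + 2 ℤ.* (c ℤ.* k) ℤ.+ c ℤ.* ℤ.- k) ℤ.* (r ℤ.+ + 2 ℤ.* (c ℤ.* k) ℤ.+ c ℤ.* ℤ.- k) ℤ.+ c ℤ.* (ℤ.- k ℤ.* ℤ.- k)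
                            ≡ (r ℤ.+ c ℤ.* k) ℤ.* (r ℤ.+ c ℤ.* k) ℤ.+ c ℤ.* (k ℤ.* k)
          lemma = ℤSolver.solve-∀
        -k≢0 : ℤ.- k ≢ + 0
        -k≢0 e = k≢0 (trans (sym (ℤₚ.neg-involutive k)) (cong ℤ.-_ e))
        r′≢ : + t ≢ ℤ.- (+ c ℤ.* ℤ.- k)
        r′≢ e = r≢ (trans (lemma₁ (+ r) (+ c) k) (trans (cong (λ x → x ℤ.- + 2 ℤ.* (+ c ℤ.* k)) (trans (sym q) e)) (lemma₂ (+ c) k)))
          where
          lemma₁ : ∀ r c k → r ≡ r ℤ.+ + 2 ℤ.* (c ℤ.* k) ℤ.- + 2 ℤ.* (c ℤ.* k)
          lemma₁ = ℤSolver.solve-∀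
          lemma₂ : ∀ c k → ℤ.- (c ℤ.* ℤ.- k) ℤ.- + 2 ℤ.* (c ℤ.* k) ≡ ℤ.- (c ℤ.* k)
          lemma₂ = ℤSolver.solve-∀
      ... | n , k≢0 , r≢ | inj₂ q = inj₂ ((t , k) , in-box {t} {k} n′ , assemble {t} {k} n′ k≢0 r′≢ , negate-x q refl)
        where
        t : ℕ
        t = ∣ + r ℤ.+ + 2 ℤ.* (+ c ℤ.* k) ∣
        n′ : norm t k ≡ + M
        n′ = trans (cong (λ x → (x ℤ.+ + c ℤ.* k) ℤ.* (x ℤ.+ + c ℤ.* k) ℤ.+ + c ℤ.* (k ℤ.* k)) q) (trans (lemma (+ r) (+ c) k) n)
          where
          lemma : ∀ r c k → (ℤ.- (r ℤ.+ + 2 ℤ.* (c ℤ.* k)) ℤ.+ c ℤ.* k) ℤ.* (ℤ.- (r ℤ.+ + 2 ℤ.* (c ℤ.* k)) ℤ.+ c ℤ.* k) ℤ.+ c ℤ.* (k ℤ.* k)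
                            ≡ (r ℤ.+ c ℤ.* k) ℤ.* (r ℤ.+ c ℤ.* k) ℤ.+ c ℤ.* (k ℤ.* k)
          lemma = ℤSolver.solve-∀
        r′≢ : + t ≢ ℤ.- (+ c ℤ.* k)
        r′≢ e = r≢ (trans (lemma₁ (+ r) (+ c) k) (trans (cong (λ x → ℤ.- x ℤ.- + 2 ℤ.* (+ c ℤ.* k)) (trans (sym q) e)) (lemma₂ (+ c) k)))
          where
          lemma₁ : ∀ r c k → r ≡ ℤ.- (ℤ.- (r ℤ.+ + 2 ℤ.* (c ℤ.* k))) ℤ.- + 2 ℤ.* (c ℤ.* k)
          lemma₁ = ℤSolver.solve-∀
          lemma₂ : ∀ c k → ℤ.- (ℤ.- (c ℤ.* k)) ℤ.- + 2 ℤ.* (c ℤ.* k) ≡ ℤ.- (c ℤ.* k)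
          lemma₂ = ℤSolver.solve-∀

    ⨁-solutions : ⨁ Solution box ≡ isSquare M xor sq₂
    ⨁-solutions with perfect-matching⇒even matching box box-unique partner
    ... | inj₂ even = begin
      ⨁ Solution box                                          ≡⟨ ⨁-cong trichotomy box ⟩
      ⨁ (λ x → (y-zero x xor x-zero x) xor generic x) box     ≡⟨ ⨁-xor (λ x → y-zero x xor x-zero x) generic box ⟩
      ⨁ (λ x → y-zero x xor x-zero x) box xor ⨁ generic box   ≡⟨ cong₂ _xor_ (⨁-xor y-zero x-zero box) even ⟩
      (⨁ y-zero box xor ⨁ x-zero box) xor false               ≡⟨ Boolₚ.xor-identityʳ _ ⟩
      ⨁ y-zero box xor ⨁ x-zero box                           ≡⟨ cong₂ _xor_ ⨁-y-zero (⨁-x-zero sq₂ refl) ⟩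
      isSquare M xor sq₂                                      ∎
      where open ≡-Reasoning

  -- The solutions with 3 ∤ r are the pairs of exponents counted by F ⊗ G; on those with 3 ∣ r, s ↦ -s acts freely.
  module Descent (no-fixed : ∀ ρ k → norm (ρ * 3) k ≡ + M → k ℤ.+ k ≢ ℤ.- + (d * ρ)) where

    private
      Element : Set
      Element = ℕ ⊎ (ℕ × ℤ)

      Term : Element → Bool
      Term (inj₁ i) = F i ∧ G (e ∸ i)
      Term (inj₂ x) = Solution x

      terms : List Element
      terms = map inj₁ (upTo (suc e)) ++ map inj₂ box

      terms-unique : Unique terms
      terms-unique = Unique.++⁺ (Unique.map⁺ Sumₚ.inj₁-injective (Unique.upTo⁺ (suc e))) (Unique.map⁺ Sumₚ.inj₂-injective box-unique) disjoint
        where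
        disjoint : ∀ {x} → ¬ (x ∈ map inj₁ (upTo (suc e)) × x ∈ map inj₂ box)
        disjoint (p , p′) with ∈-map⁻ inj₁ p | ∈-map⁻ inj₂ p′
        ... | _ , _ , refl | _ , _ , ()

      -- For r = 3 ρ the condition s + s′ = 0, that is 2 r + (1 + c)(k + k′) = 0, becomes k + k′ =
      -- -d ρ because d (1 + c) = 6.
      data _~_ : Element → Element → Set where
        primitiveˡ   : ∀ {i r k} → r * r ≡ 1 + i * 24 → inj₁ i ~ inj₂ (r , k)
        primitiveʳ   : ∀ {i r k} → r * r ≡ 1 + i * 24 → inj₂ (r , k) ~ inj₁ i
        imprimitive  : ∀ {r k k′} ρ → r ≡ ρ * 3 → k ℤ.+ k′ ≡ ℤ.- + (d * ρ) → inj₂ (r , k) ~ inj₂ (r , k′)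

      open Pairing (Sumₚ.≡-dec _≟_ (Productₚ.≡-dec _≟_ ℤ._≟_))

      [1+c]*d≡6 : + suc c ℤ.* + d ≡ + 6
      [1+c]*d≡6 = trans (sym (ℤₚ.pos-* (suc c) d)) (cong +_ (trans (ℕₚ.*-comm (suc c) d) d*[1+c]≡6))

      s²-determined : ∀ {r k k′} → norm r k ≡ + M → norm r k′ ≡ + M →
                      (+ r ℤ.+ + suc c ℤ.* k) ℤ.* (+ r ℤ.+ + suc c ℤ.* k) ≡ (+ r ℤ.+ + suc c ℤ.* k′) ℤ.* (+ r ℤ.+ + suc c ℤ.* k′)
      s²-determined {r} {k} {k′} p p′ = ℤₚ.*-cancelˡ-≡ (+ c) _ _ (+-cancelˡ (+ r ℤ.* + r)
        (trans (sym (scaled-norm r k)) (trans (cong (λ t → + suc c ℤ.* t) (trans p (sym p′))) (scaled-norm r k′))))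

      -- r determines s², and s = -s′ would mean 2 r + (1 + c)(k + k′) = 0; as 3 divides 1 + c, it
      -- would divide r.
      k-determined : ∀ {r i k k′} → r * r ≡ 1 + i * 24 → norm r k ≡ + M → norm r k′ ≡ + M → k ≡ k′
      k-determined {r} {i} {k} {k′} r² p p′ with square-injectiveℤ (s²-determined {r} {k} {k′} p p′)
      ... | inj₁ s≡s′ = ℤₚ.*-cancelˡ-≡ (+ suc c) k k′ (+-cancelˡ (+ r) s≡s′)
      ... | inj₂ s≡-s′ = ⊥-elim (3∤root {r} {i} ∣ z ∣ r² (trans (cong ∣_∣ 3∣r) (ℤₚ.abs-* z (+ 3))))
        where
        z : ℤ
        z = + r ℤ.+ + g ℤ.* (k ℤ.+ k′)
        3∣r : + r ≡ z ℤ.* + 3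
        3∣r = begin
          + r                                                       ≡⟨ lemma₁ (+ r) (+ suc c) k k′ ⟩
          + 3 ℤ.* + r ℤ.+ + suc c ℤ.* (k ℤ.+ k′) ℤ.- ((+ r ℤ.+ + suc c ℤ.* k) ℤ.+ (+ r ℤ.+ + suc c ℤ.* k′))
            ≡⟨ cong (λ t → + 3 ℤ.* + r ℤ.+ + suc c ℤ.* (k ℤ.+ k′) ℤ.- (t ℤ.+ (+ r ℤ.+ + suc c ℤ.* k′))) s≡-s′ ⟩
          + 3 ℤ.* + r ℤ.+ + suc c ℤ.* (k ℤ.+ k′) ℤ.- (ℤ.- (+ r ℤ.+ + suc c ℤ.* k′) ℤ.+ (+ r ℤ.+ + suc c ℤ.* k′))
            ≡⟨ cong (λ t → + 3 ℤ.* + r ℤ.+ t ℤ.* (k ℤ.+ k′) ℤ.- (ℤ.- (+ r ℤ.+ + suc c ℤ.* k′) ℤ.+ (+ r ℤ.+ + suc c ℤ.* k′))) (trans (cong +_ 1+c≡g*3) (ℤₚ.pos-* g 3)) ⟩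
          + 3 ℤ.* + r ℤ.+ + g ℤ.* + 3 ℤ.* (k ℤ.+ k′) ℤ.- (ℤ.- (+ r ℤ.+ + suc c ℤ.* k′) ℤ.+ (+ r ℤ.+ + suc c ℤ.* k′))
            ≡⟨ lemma₂ (+ r) (+ suc c) (+ g) k k′ ⟩
          z ℤ.* + 3 ∎
          where
          open ≡-Reasoning
          lemma₁ : ∀ r m k k′ → r ≡ + 3 ℤ.* r ℤ.+ m ℤ.* (k ℤ.+ k′) ℤ.- ((r ℤ.+ m ℤ.* k) ℤ.+ (r ℤ.+ m ℤ.* k′))
          lemma₁ = ℤSolver.solve-∀
          lemma₂ : ∀ r m g k k′ → + 3 ℤ.* r ℤ.+ g ℤ.* + 3 ℤ.* (k ℤ.+ k′) ℤ.- (ℤ.- (r ℤ.+ m ℤ.* k′) ℤ.+ (r ℤ.+ m ℤ.* k′))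
                                   ≡ (r ℤ.+ g ℤ.* (k ℤ.+ k′)) ℤ.* + 3
          lemma₂ = ℤSolver.solve-∀

      matching : Matching _~_ Term
      matching = record { symmetric = symm ; functional = func ; irreflexive = irrefl }
        where
        symm : ∀ {x y} → Term x ≡ true → Term y ≡ true → x ~ y → y ~ x
        symm _ _ (primitiveˡ p)          = primitiveʳ p
        symm _ _ (primitiveʳ p)          = primitiveˡ p
        symm _ _ (imprimitive {r} {k} {k′} ρ p q) = imprimitive ρ p (trans (ℤₚ.+-comm k′ k) q)
        func : ∀ {x y z} → Term x ≡ true → Term y ≡ true → Term z ≡ true → x ~ y → x ~ z → y ≡ z
        func _ py pz (primitiveˡ {i} {r} {k} p) (primitiveˡ {_} {r′} {k′} p′) with square-injective {r} {r′} (trans p (sym p′))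
        ... | refl = cong (λ k → inj₂ (r , k)) (k-determined {r} {i} {k} {k′} p (solves {r} {k} py) (solves {r} {k′} pz))
        func _ _ _ (primitiveʳ {i} p) (primitiveʳ {i′} p′) = cong inj₁ (ℕₚ.*-cancelʳ-≡ i i′ 24 (ℕₚ.suc-injective (trans (sym p) p′)))
        func _ _ _ (primitiveʳ {i} {r} p) (imprimitive ρ r≡ _) = ⊥-elim (3∤root {r} {i} ρ p r≡)
        func _ _ _ (imprimitive {r} ρ r≡ _) (primitiveʳ {i} p) = ⊥-elim (3∤root {r} {i} ρ p r≡)
        func _ _ _ (imprimitive {r} {k} {k₁} ρ₁ p₁ q₁) (imprimitive {k′ = k₂} ρ₂ p₂ q₂) =
          cong (λ k → inj₂ (r , k)) (+-cancelˡ k (trans q₁ (trans (cong (λ ρ → ℤ.- + (d * ρ)) (ℕₚ.*-cancelʳ-≡ ρ₁ ρ₂ 3 (trans (sym p₁) p₂))) (sym q₂))))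
        irrefl : ∀ {x y} → Term x ≡ true → Term y ≡ true → x ~ y → x ≢ y
        irrefl _ _ (primitiveˡ _) ()
        irrefl _ _ (primitiveʳ _) ()
        irrefl px _ (imprimitive {r} {k} ρ refl q) refl = no-fixed ρ k (solves {r} {k} px) q

      norm-from-s : ∀ r k s → (+ r ℤ.+ + suc c ℤ.* k) ℤ.* (+ r ℤ.+ + suc c ℤ.* k) ≡ s → + r ℤ.* + r ℤ.+ + c ℤ.* s ≡ + suc c ℤ.* + M → norm r k ≡ + M
      norm-from-s r k s p q = ℤₚ.*-cancelˡ-≡ (+ suc c) (norm r k) (+ M) (trans (scaled-norm r k) (trans (cong (λ t → + r ℤ.* + r ℤ.+ + c ℤ.* t) p) q))

      partner-of-index : ∀ i → i ≤ e → F i ∧ G (e ∸ i) ≡ true → ∃[ y ] (y ∈ terms × Term y ≡ true × inj₁ i ~ y)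
      partner-of-index i i≤e p with ∧-true {F i} p
      ... | f , g with isSquare-sound (1 + i * 24) (trans (sym (F-isSquare i)) f) | G-sound (e ∸ i) g
      ... | r , r² | s , i′ , e∸i≡ , s² with ±1mod6-congruent (root⇒±1mod6 {r} {i} (sym r²)) (root⇒±1mod6 {s} {i′} s²)
      ... | k₀ , congruent = inj₂ (r , k) , ∈-++⁺ʳ (map inj₁ (upTo (suc e))) (∈-map⁺ inj₂ (in-box {r} {k} n)) , solution {r} {k} n , primitiveˡ (sym r²)
        where
        -- Up to its sign s is r + 6 k₀, and 6 = (1 + c) d.
        k : ℤ
        k = + d ℤ.* k₀
        shift-by-6 : + r ℤ.+ + suc c ℤ.* k ≡ + r ℤ.+ + 6 ℤ.* k₀
        shift-by-6 = cong (λ t → + r ℤ.+ t) (trans (sym (ℤₚ.*-assoc (+ suc c) (+ d) k₀)) (cong (λ t → t ℤ.* k₀) [1+c]*d≡6))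
        square : ∀ {x} → + s ≡ x ⊎ ℤ.- + s ≡ x → x ℤ.* x ≡ + s ℤ.* + s
        square (inj₁ refl) = refl
        square (inj₂ refl) = lemma (+ s)
          where
          lemma : ∀ s → ℤ.- s ℤ.* ℤ.- s ≡ s ℤ.* s
          lemma = ℤSolver.solve-∀
        total : r * r + c * (s * s) ≡ suc c * M
        total = begin
          r * r + c * (s * s)                        ≡⟨ cong₂ (λ x y → x + c * y) (sym r²) s² ⟩
          1 + i * 24 + c * (1 + i′ * 24)             ≡⟨ lemma i i′ c ⟩
          suc c + 24 * (i + i′ * c)                  ≡⟨ cong (λ x → suc c + 24 * (i + x)) (sym e∸i≡) ⟩
          suc c + 24 * (i + (e ∸ i))                 ≡⟨ cong (λ x → suc c + 24 * x) (ℕₚ.m+[n∸m]≡n i≤e) ⟩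
          suc c + 24 * e                             ≡⟨ sym [1+c]*M≡ ⟩
          suc c * M                                  ∎
          where
          open ≡-Reasoning
          lemma : ∀ i i′ c → 1 + i * 24 + c * (1 + i′ * 24) ≡ suc c + 24 * (i + i′ * c)
          lemma = solve-∀
        n : norm r k ≡ + M
        n = norm-from-s r k (+ s ℤ.* + s) (trans (cong (λ t → t ℤ.* t) shift-by-6) (square congruent)) (begin
          + r ℤ.* + r ℤ.+ + c ℤ.* (+ s ℤ.* + s)  ≡⟨ cong₂ (λ x y → x ℤ.+ + c ℤ.* y) (sym (ℤₚ.pos-* r r)) (sym (ℤₚ.pos-* s s)) ⟩
          + (r * r) ℤ.+ + c ℤ.* + (s * s)        ≡⟨ cong (λ x → + (r * r) ℤ.+ x) (sym (ℤₚ.pos-* c (s * s))) ⟩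
          + (r * r + c * (s * s))                ≡⟨ cong +_ total ⟩
          + (suc c * M)                          ≡⟨ ℤₚ.pos-* (suc c) M ⟩
          + suc c ℤ.* + M                        ∎)
          where open ≡-Reasoning

      partner-imprimitive : ∀ r k ρ → r ≡ ρ * 3 → norm r k ≡ + M → ∃[ y ] (y ∈ terms × Term y ≡ true × inj₂ (r , k) ~ y)
      partner-imprimitive r k ρ r≡ p = inj₂ (r , k′) , ∈-++⁺ʳ (map inj₁ (upTo (suc e))) (∈-map⁺ inj₂ (in-box {r} {k′} n)) , solution {r} {k′} n , imprimitive ρ r≡ (lemma k (+ (d * ρ)))
        where
        k′ : ℤ
        k′ = ℤ.- k ℤ.- + (d * ρ)
        lemma : ∀ k t → k ℤ.+ (ℤ.- k ℤ.- t) ≡ ℤ.- t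
        lemma = ℤSolver.solve-∀
        [1+c]dρ : + suc c ℤ.* + (d * ρ) ≡ + 2 ℤ.* + r
        [1+c]dρ = begin
          + suc c ℤ.* + (d * ρ)        ≡⟨ cong (λ t → + suc c ℤ.* t) (ℤₚ.pos-* d ρ) ⟩
          + suc c ℤ.* (+ d ℤ.* + ρ)    ≡⟨ sym (ℤₚ.*-assoc (+ suc c) (+ d) (+ ρ)) ⟩
          + suc c ℤ.* + d ℤ.* + ρ      ≡⟨ cong (λ t → t ℤ.* + ρ) [1+c]*d≡6 ⟩
          + 6 ℤ.* + ρ                  ≡⟨ lemma₆ (+ ρ) ⟩
          + 2 ℤ.* (+ ρ ℤ.* + 3)        ≡⟨ cong (λ t → + 2 ℤ.* t) (trans (sym (ℤₚ.pos-* ρ 3)) (cong +_ (sym r≡))) ⟩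
          + 2 ℤ.* + r                  ∎
          where
          open ≡-Reasoning
          lemma₆ : ∀ ρ → + 6 ℤ.* ρ ≡ + 2 ℤ.* (ρ ℤ.* + 3)
          lemma₆ = ℤSolver.solve-∀
        opposite : + r ℤ.+ + suc c ℤ.* k′ ≡ ℤ.- (+ r ℤ.+ + suc c ℤ.* k)
        opposite = trans (lemma₁ (+ r) (+ suc c) k (+ (d * ρ))) (trans (cong (λ t → + r ℤ.- + suc c ℤ.* k ℤ.- t) [1+c]dρ) (lemma₂ (+ r) (+ suc c) k))
          where
          lemma₁ : ∀ r m k t → r ℤ.+ m ℤ.* (ℤ.- k ℤ.- t) ≡ r ℤ.- m ℤ.* k ℤ.- m ℤ.* t
          lemma₁ = ℤSolver.solve-∀
          lemma₂ : ∀ r m k → r ℤ.- m ℤ.* k ℤ.- + 2 ℤ.* r ≡ ℤ.- (r ℤ.+ m ℤ.* k)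
          lemma₂ = ℤSolver.solve-∀
        n : norm r k′ ≡ + M
        n = norm-from-s r k′ ((+ r ℤ.+ + suc c ℤ.* k) ℤ.* (+ r ℤ.+ + suc c ℤ.* k))
          (trans (cong (λ t → t ℤ.* t) opposite) (lemma₃ (+ r ℤ.+ + suc c ℤ.* k)))
          (trans (sym (scaled-norm r k)) (cong (λ t → + suc c ℤ.* t) p))
          where
          lemma₃ : ∀ x → ℤ.- x ℤ.* ℤ.- x ≡ x ℤ.* x
          lemma₃ = ℤSolver.solve-∀

      partner-primitive : ∀ r k i → r * r ≡ 1 + i * 24 → norm r k ≡ + M → ∃[ y ] (y ∈ terms × Term y ≡ true × inj₂ (r , k) ~ y)
      partner-primitive r k i r² p = inj₁ i , ∈-++⁺ˡ (∈-map⁺ inj₁ (∈-upTo⁺ (s≤s i≤e)))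
        , cong₂ _∧_ (trans (F-isSquare i) (subst (λ v → isSquare v ≡ true) r² (isSquare-complete r))) (G-complete (e ∸ i) s cs²) , primitiveʳ r²
        where
        s : ℕ
        s = ∣ + r ℤ.+ + suc c ℤ.* k ∣
        total : i * 24 + c * (s * s) ≡ c + 24 * e
        total = ℕₚ.suc-injective (trans (cong (λ t → t + c * (s * s)) (sym r²)) (trans (ℤₚ.+-injective (begin
          + (r * r) ℤ.+ + (c * (s * s))        ≡⟨ cong₂ ℤ._+_ (ℤₚ.pos-* r r) (ℤₚ.pos-* c (s * s)) ⟩
          + r ℤ.* + r ℤ.+ + c ℤ.* + (s * s)    ≡⟨ cong (λ t → + r ℤ.* + r ℤ.+ + c ℤ.* t) (sym (square-abs (+ r ℤ.+ + suc c ℤ.* k))) ⟩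
          _                                    ≡⟨ sym (scaled-norm r k) ⟩
          + suc c ℤ.* norm r k                 ≡⟨ cong (λ t → + suc c ℤ.* t) p ⟩
          + suc c ℤ.* + M                      ≡⟨ sym (ℤₚ.pos-* (suc c) M) ⟩
          + (suc c * M)                        ∎)) [1+c]*M≡))
          where open ≡-Reasoning
        -- Needed for i ≤ e, without which e ∸ i would be truncated. If s were 0, then r² = (1 + c)
        -- M would be divisible by 3.
        s≢0 : s ≢ 0
        s≢0 s≡0 = contradiction (begin
          1                        ≡⟨ sym (1%3 i) ⟩
          (1 + i * 24) % 3         ≡⟨ cong (λ t → suc t % 3) (trans (sym (ℕₚ.+-identityʳ (i * 24))) (trans (cong (λ t → i * 24 + t) (sym (trans (cong (λ t → c * (t * t)) s≡0) (ℕₚ.*-zeroʳ c)))) total)) ⟩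
          (suc c + 24 * e) % 3     ≡⟨ cong (λ t → (t + 24 * e) % 3) 1+c≡g*3 ⟩
          (g * 3 + 24 * e) % 3     ≡⟨ cong (_% 3) (lemma g e) ⟩
          (0 + (g + 8 * e) * 3) % 3 ≡⟨ [m+kn]%n≡m%n 0 (g + 8 * e) 3 ⟩
          0                        ∎) λ ()
          where
          open ≡-Reasoning
          lemma : ∀ g e → g * 3 + 24 * e ≡ 0 + (g + 8 * e) * 3
          lemma = solve-∀
        1≤s² : 1 ≤ s * s
        1≤s² = ℕₚ.≤-trans (ℕₚ.n≢0⇒n>0 s≢0) (n≤n² s)
        i≤e : i ≤ e
        i≤e = ℕₚ.*-cancelˡ-≤ 24 (ℕₚ.+-cancelʳ-≤ c (24 * i) (24 * e) (begin
          24 * i + c                ≡⟨ cong₂ _+_ (ℕₚ.*-comm 24 i) (sym (ℕₚ.*-identityʳ c)) ⟩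
          i * 24 + c * 1            ≤⟨ ℕₚ.+-monoʳ-≤ (i * 24) (ℕₚ.*-monoʳ-≤ c 1≤s²) ⟩
          i * 24 + c * (s * s)      ≡⟨ total ⟩
          c + 24 * e                ≡⟨ ℕₚ.+-comm c (24 * e) ⟩
          24 * e + c                ∎))
          where open ℕₚ.≤-Reasoning
        cs² : c * (s * s) ≡ c + 24 * (e ∸ i)
        cs² = ℕₚ.+-cancelˡ-≡ (i * 24) _ _ (trans total (trans (cong (λ t → c + 24 * t) (sym (ℕₚ.m+[n∸m]≡n i≤e))) (lemma c i (e ∸ i))))
          where
          lemma : ∀ c i j → c + 24 * (i + j) ≡ i * 24 + (c + 24 * j)
          lemma = solve-∀

      partner : ∀ x → x ∈ terms → Term x ≡ true → ⊥ ⊎ ∃[ y ] (y ∈ terms × Term y ≡ true × x ~ y)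
      partner (inj₁ i) x∈ p with ∈-++⁻ (map inj₁ (upTo (suc e))) x∈
      ... | inj₁ i∈ with ∈-map⁻ inj₁ i∈
      ...   | _ , i∈upTo , refl = inj₂ (partner-of-index i (ℕₚ.≤-pred (∈-upTo⁻ i∈upTo)) p)
      partner (inj₁ i) x∈ p | inj₂ i∈ with ∈-map⁻ inj₂ i∈
      ...   | _ , _ , ()
      partner (inj₂ (r , k)) _ p with odd⇒root r (r-odd {r} {k} (solves {r} {k} p))
      ... | inj₁ (ρ , r≡) = inj₂ (partner-imprimitive r k ρ r≡ (solves {r} {k} p))
      ... | inj₂ (i , r²) = inj₂ (partner-primitive r k i r² (solves {r} {k} p))

    ⊗-counts-solutions : (F ⊗ G) e ≡ ⨁ Solution box
    ⊗-counts-solutions with perfect-matching⇒even matching terms terms-unique partner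
    ... | inj₂ even = begin
      (F ⊗ G) e                                                 ≡⟨ ⊗-⨁ F G e ⟩
      ⨁ (λ i → F i ∧ G (e ∸ i)) (upTo (suc e))                  ≡⟨ sym (⨁-map Term inj₁ (upTo (suc e))) ⟩
      ⨁ Term (map inj₁ (upTo (suc e)))                          ≡⟨ xor-false _ _ (trans (sym (⨁-++ Term (map inj₁ (upTo (suc e))) (map inj₂ box))) even) ⟩
      ⨁ Term (map inj₂ box)                                     ≡⟨ ⨁-map Term inj₂ box ⟩
      ⨁ Solution box                                            ∎
      where
      open ≡-Reasoning
      xor-false : ∀ a b → a xor b ≡ false → a ≡ b
      xor-false false false _ = refl
      xor-false true  true  _ = refl

-- The parity difference as a count of representations by y² + 30 x²

square-even : ∀ f i → (f ↑ 2) (i * 2) ≡ f i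
square-odd  : ∀ f i → (f ↑ 2) (1 + i * 2) ≡ false
square-even f i = trans (at (⊗-congˡ (⊗-identityʳ f)) (i * 2)) (go f i)
  where
  opaque
    unfolding _⊗_
    go : ∀ f i → (f ⊗ f) (i * 2) ≡ f i
    go f zero    = Boolₚ.∧-idem (f 0)
    go f (suc i) = trans (cong ((f 0 ∧ f (2 + i * 2)) xor_) (⊗-tlʳ (tl f) f (i * 2)))
      (trans (sym (Boolₚ.xor-assoc (f 0 ∧ f (2 + i * 2)) (f (2 + i * 2) ∧ f 0) ((tl f ⊗ tl f) (i * 2))))
      (trans (cong (_xor (tl f ⊗ tl f) (i * 2)) (trans (cong ((f 0 ∧ f (2 + i * 2)) xor_) (Boolₚ.∧-comm (f (2 + i * 2)) (f 0))) (Boolₚ.xor-same (f 0 ∧ f (2 + i * 2)))))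
        (go (tl f) i)))
square-odd f i = trans (at (⊗-congˡ (⊗-identityʳ f)) (1 + i * 2)) (go f i)
  where
  opaque
    unfolding _⊗_
    go : ∀ f i → (f ⊗ f) (1 + i * 2) ≡ false
    go f zero    = trans (cong ((f 0 ∧ f 1) xor_) (Boolₚ.∧-comm (f 1) (f 0))) (Boolₚ.xor-same (f 0 ∧ f 1))
    go f (suc i) = trans (cong ((f 0 ∧ f (3 + i * 2)) xor_) (⊗-tlʳ (tl f) f (1 + i * 2)))
      (trans (sym (Boolₚ.xor-assoc (f 0 ∧ f (3 + i * 2)) (f (3 + i * 2) ∧ f 0) ((tl f ⊗ tl f) (1 + i * 2))))
      (trans (cong (_xor (tl f ⊗ tl f) (1 + i * 2)) (trans (cong ((f 0 ∧ f (3 + i * 2)) xor_) (Boolₚ.∧-comm (f (3 + i * 2)) (f 0))) (Boolₚ.xor-same (f 0 ∧ f (3 + i * 2)))))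
        (go (tl f) i)))

not-square : ∀ v → (∀ r → v ≢ r * r) → isSquare v ≡ false
not-square v h with isSquare v in eq
... | false = refl
... | true  = let r , p = isSquare-sound v eq in contradiction p (h r)

halve : ∀ j → ∃[ i ] (j ≡ i * 2 ⊎ j ≡ 1 + i * 2)
halve zero = 0 , inj₁ refl
halve (suc j) with halve j
... | i , inj₁ refl = i , inj₂ refl
... | i , inj₂ refl = suc i , inj₁ refl

odd-square-mod8 : ∀ r → odd r ≡ true → ∃[ t ] r * r ≡ 1 + t * 8
odd-square-mod8 r p with halve r
... | i , inj₁ refl = contradiction (trans (sym p) (trans (odd-* i 2) (Boolₚ.∧-zeroʳ (odd i)))) λ ()
... | i , inj₂ refl = triangle i , lemma i (triangle i) (2*triangle i)
  where
  lemma : ∀ i t → 2 * t ≡ i * suc i → (1 + i * 2) * (1 + i * 2) ≡ 1 + t * 8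
  lemma i t h = trans (l i) (trans (cong (λ x → 1 + 4 * x) (sym h)) (r′ t))
    where
    l : ∀ i → (1 + i * 2) * (1 + i * 2) ≡ 1 + 4 * (i * suc i)
    l = solve-∀
    r′ : ∀ t → 1 + 4 * (2 * t) ≡ 1 + t * 8
    r′ = solve-∀

5+8*-not-square : ∀ i r → 5 + 8 * i ≢ r * r
5+8*-not-square i r p with odd-square-mod8 r (trans (sym (odd-square r)) (trans (cong odd (sym p)) (cong (λ b → not (not (not (not (not b))))) (odd-* 8 i))))
... | t , r² = contradiction (begin
  5                  ≡⟨ sym ([m+kn]%n≡m%n 5 i 8) ⟩
  (5 + i * 8) % 8    ≡⟨ cong (λ x → (5 + x) % 8) (ℕₚ.*-comm i 8) ⟩
  (5 + 8 * i) % 8    ≡⟨ cong (_% 8) (trans p r²) ⟩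
  (1 + t * 8) % 8    ≡⟨ [m+kn]%n≡m%n 1 t 8 ⟩
  1                  ∎) λ ()
  where open ≡-Reasoning

residue₅ : ∀ r → ∃[ ρ ] ∃[ a ] (ρ < 5 × r ≡ ρ + a * 5)
residue₅ r = r % 5 , r / 5 , m%n<n r 5 , m≡m%n+[m/n]*n r 5

square-mod5 : ∀ r → (∃[ t ] r ≡ t * 5) ⊎ (r * r) % 5 ≡ 1 ⊎ (r * r) % 5 ≡ 4
square-mod5 r with residue₅ r
... | ρ , a , ρ<5 , refl = cases ρ ρ<5
  where
  expand : ∀ ρ a → (ρ + a * 5) * (ρ + a * 5) ≡ ρ * ρ + (a * (2 * ρ + a * 5)) * 5
  expand = solve-∀
  reduce : ∀ ρ → ((ρ + a * 5) * (ρ + a * 5)) % 5 ≡ (ρ * ρ) % 5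
  reduce ρ = trans (cong (_% 5) (expand ρ a)) ([m+kn]%n≡m%n (ρ * ρ) (a * (2 * ρ + a * 5)) 5)
  cases : ∀ ρ → ρ < 5 → (∃[ t ] ρ + a * 5 ≡ t * 5) ⊎ ((ρ + a * 5) * (ρ + a * 5)) % 5 ≡ 1 ⊎ ((ρ + a * 5) * (ρ + a * 5)) % 5 ≡ 4
  cases 0 _ = inj₁ (a , refl)
  cases 1 _ = inj₂ (inj₁ (reduce 1))
  cases 2 _ = inj₂ (inj₂ (reduce 2))
  cases 3 _ = inj₂ (inj₂ (reduce 3))
  cases 4 _ = inj₂ (inj₁ (reduce 4))
  cases (suc (suc (suc (suc (suc ρ))))) (s≤s (s≤s (s≤s (s≤s (s≤s ())))))

5∣root : ∀ {v} r → v * 5 ≡ r * r → ∃[ t ] r ≡ t * 5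
5∣root {v} r p with square-mod5 r
... | inj₁ h = h
... | inj₂ (inj₁ h) = contradiction (trans (sym h) (trans (cong (_% 5) (sym p)) ([m+kn]%n≡m%n 0 v 5))) λ ()
... | inj₂ (inj₂ h) = contradiction (trans (sym h) (trans (cong (_% 5) (sym p)) ([m+kn]%n≡m%n 0 v 5))) λ ()

not-square-mod5 : ∀ {v} ρ a → v ≡ ρ + a * 5 → ρ % 5 ≢ 0 → ρ % 5 ≢ 1 → ρ % 5 ≢ 4 → ∀ r → v ≢ r * r
not-square-mod5 ρ a v≡ h₀ h₁ h₄ r p with square-mod5 r
... | inj₁ (t , refl) = h₀ (trans (sym residue) (trans (cong (_% 5) (lemma t)) ([m+kn]%n≡m%n 0 (t * 5 * t) 5)))
  where
  residue : (t * 5 * (t * 5)) % 5 ≡ ρ % 5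
  residue = trans (cong (_% 5) (trans (sym p) v≡)) ([m+kn]%n≡m%n ρ a 5)
  lemma : ∀ t → t * 5 * (t * 5) ≡ 0 + t * 5 * t * 5
  lemma = solve-∀
... | inj₂ (inj₁ h) = h₁ (trans (sym (trans (cong (_% 5) (trans (sym p) v≡)) ([m+kn]%n≡m%n ρ a 5))) h)
... | inj₂ (inj₂ h) = h₄ (trans (sym (trans (cong (_% 5) (trans (sym p) v≡)) ([m+kn]%n≡m%n ρ a 5))) h)

-- Opaque, so that conversion checking never evaluates their coefficients.
opaque
  E B X : F₂[[q]]
  E = euler 1
  B = euler 5
  X = euler 25

  E-isSquare : ∀ i → E i ≡ isSquare (1 + i * 24)
  E-isSquare = euler-isSquare

  B-splits : B splits-as dilated E
  B-splits = euler-splits 0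

  X-splits : X splits-as dilated B
  X-splits = euler-splits 4

  b200₂ p17₂ : F₂[[q]]
  b200₂ = mod₂ b200
  p17₂ = mod₂ p17

  b200₂-at : ∀ n → b200₂ n ≡ oddℤ (b200 n)
  b200₂-at n = refl

  p17₂-at : ∀ n → p17₂ n ≡ oddℤ (p17 n)
  p17₂-at n = refl

  b200₂-E : b200₂ ⊗ E ≈ X ↑ 8
  b200₂-E = mod₂-b200

  p17₂-E : p17₂ ⊗ E ↑ 17 ≈ 𝟙
  p17₂-E = mod₂-p17

-- Exponents of E, E(q⁵) and their powers

dilated-sound : ∀ {f g} → f splits-as dilated g → ∀ j → f j ≡ true → ∃[ i ] (j ≡ i * 5 × g i ≡ true)
dilated-sound (split a b c d e) j p with residue₅ j
... | 0 , i , _ , refl = i , refl , trans (sym (at a i)) p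
... | 1 , i , _ , refl = contradiction (trans (sym (at b i)) p) λ ()
... | 2 , i , _ , refl = contradiction (trans (sym (at c i)) p) λ ()
... | 3 , i , _ , refl = contradiction (trans (sym (at d i)) p) λ ()
... | 4 , i , _ , refl = contradiction (trans (sym (at e i)) p) λ ()
... | suc (suc (suc (suc (suc ρ)))) , _ , s≤s (s≤s (s≤s (s≤s (s≤s ())))) , _

E-sound : ∀ i → E i ≡ true → ∃[ s ] s * s ≡ 1 + i * 24
E-sound i p = let s , q = isSquare-sound (1 + i * 24) (trans (sym (E-isSquare i)) p) in s , sym q

E-complete : ∀ i s → s * s ≡ 1 + i * 24 → E i ≡ true
E-complete i s p = trans (E-isSquare i) (subst (λ v → isSquare v ≡ true) p (isSquare-complete s))

B-sound : ∀ j → B j ≡ true → ∃[ s ] ∃[ i ] (j ≡ i * 5 × s * s ≡ 1 + i * 24)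
B-sound j p with dilated-sound B-splits j p
... | i , j≡ , Ei = let s , s² = E-sound i Ei in s , i , j≡ , s²

B-complete : ∀ j s → 5 * (s * s) ≡ 5 + 24 * j → B j ≡ true
B-complete j s p with residue₅ j
... | ρ , i , ρ<5 , refl = cases ρ ρ<5 p
  where
  absurd : ∀ ρ → 5 * (s * s) ≡ 5 + 24 * (ρ + i * 5) → (24 * ρ) % 5 ≡ 0
  absurd ρ p = begin
    (24 * ρ) % 5                       ≡⟨ sym ([m+kn]%n≡m%n (24 * ρ) (1 + 24 * i) 5) ⟩
    (24 * ρ + (1 + 24 * i) * 5) % 5    ≡⟨ cong (_% 5) (lemma ρ i) ⟩
    (5 + 24 * (ρ + i * 5)) % 5         ≡⟨ cong (_% 5) (trans (sym p) (ℕₚ.*-comm 5 (s * s))) ⟩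
    (0 + s * s * 5) % 5                ≡⟨ [m+kn]%n≡m%n 0 (s * s) 5 ⟩
    0                                  ∎
    where
    open ≡-Reasoning
    lemma : ∀ ρ i → 24 * ρ + (1 + 24 * i) * 5 ≡ 5 + 24 * (ρ + i * 5)
    lemma = solve-∀
  cases : ∀ ρ → ρ < 5 → 5 * (s * s) ≡ 5 + 24 * (ρ + i * 5) → B (ρ + i * 5) ≡ true
  cases 0 _ p = trans (at (s₀ B-splits) i) (E-complete i s (ℕₚ.*-cancelˡ-≡ (s * s) (1 + i * 24) 5 (trans p (lemma i))))
    where
    lemma : ∀ i → 5 + 24 * (i * 5) ≡ 5 * (1 + i * 24)
    lemma = solve-∀
  cases 1 _ p = contradiction (absurd 1 p) λ ()
  cases 2 _ p = contradiction (absurd 2 p) λ ()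
  cases 3 _ p = contradiction (absurd 3 p) λ ()
  cases 4 _ p = contradiction (absurd 4 p) λ ()
  cases (suc (suc (suc (suc (suc ρ))))) (s≤s (s≤s (s≤s (s≤s (s≤s ()))))) _

E²-sound : ∀ j → (E ↑ 2) j ≡ true → ∃[ s ] ∃[ i ] (j ≡ i * 2 × s * s ≡ 1 + i * 24)
E²-sound j p with halve j
... | i , inj₁ refl = let s , s² = E-sound i (trans (sym (square-even E i)) p) in s , i , refl , s²
... | i , inj₂ refl = contradiction (trans (sym (square-odd E i)) p) λ ()

-- s² = 1 + 12 j makes s odd and prime to 3, so s² is already 1 modulo 24 and j is even.
E²-complete : ∀ j s → 2 * (s * s) ≡ 2 + 24 * j → (E ↑ 2) j ≡ true
E²-complete j s p = finish (odd⇒root s s-odd)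
  where
  open ≡-Reasoning
  s² : s * s ≡ 1 + 12 * j
  s² = ℕₚ.*-cancelˡ-≡ (s * s) (1 + 12 * j) 2 (trans p (lemma j))
    where
    lemma : ∀ j → 2 + 24 * j ≡ 2 * (1 + 12 * j)
    lemma = solve-∀
  s-odd : odd s ≡ true
  s-odd = trans (sym (odd-square s)) (trans (cong odd s²) (cong not (odd-* 12 j)))
  finish : (∃[ ρ ] s ≡ ρ * 3) ⊎ (∃[ i ] s * s ≡ 1 + i * 24) → (E ↑ 2) j ≡ true
  finish (inj₂ (i , r²)) = trans (cong (E ↑ 2) (sym i*2≡j)) (trans (square-even E i) (E-complete i s r²))
    where
    i*2≡j : i * 2 ≡ j
    i*2≡j = ℕₚ.*-cancelʳ-≡ (i * 2) j 12 (ℕₚ.suc-injective (begin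
      1 + i * 2 * 12  ≡⟨ cong suc (ℕₚ.*-assoc i 2 12) ⟩
      1 + i * 24      ≡⟨ sym r² ⟩
      s * s           ≡⟨ s² ⟩
      1 + 12 * j      ≡⟨ cong suc (ℕₚ.*-comm 12 j) ⟩
      1 + j * 12      ∎))
  finish (inj₁ (ρ , s≡)) = contradiction (begin
    0                        ≡⟨ sym ([m+kn]%n≡m%n 0 (ρ * 3 * ρ) 3) ⟩
    (ρ * 3 * ρ * 3) % 3      ≡⟨ cong (_% 3) (trans (ℕₚ.*-assoc (ρ * 3) ρ 3) (cong₂ _*_ (sym s≡) (sym s≡))) ⟩
    (s * s) % 3              ≡⟨ cong (_% 3) (trans s² (cong suc (lemma j))) ⟩
    (1 + 4 * j * 3) % 3      ≡⟨ [m+kn]%n≡m%n 1 (4 * j) 3 ⟩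
    1                        ∎) λ ()
    where
    lemma : ∀ j → 12 * j ≡ 4 * j * 3
    lemma = solve-∀

-- For c = 2 a fixed point of s ↦ -s has s = 0, k = -ρ and norm 3 ρ². This is excluded modulo 8,
-- where an odd square is 1.
3ρ²≢1+8e : ∀ ρ e → 3 * (ρ * ρ) ≢ 1 + 8 * e
3ρ²≢1+8e ρ e p with odd-square-mod8 ρ (trans (sym (odd-square ρ)) (trans (sym (odd-* 3 (ρ * ρ))) (trans (cong odd p) (cong not (odd-* 8 e)))))
... | t , ρ² = contradiction (begin
  3                          ≡⟨ sym ([m+kn]%n≡m%n 3 (3 * t) 8) ⟩
  (3 + 3 * t * 8) % 8        ≡⟨ cong (_% 8) (trans (lemma t) (trans (cong (3 *_) (sym ρ²)) (trans p (cong suc (ℕₚ.*-comm 8 e))))) ⟩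
  (1 + e * 8) % 8            ≡⟨ [m+kn]%n≡m%n 1 e 8 ⟩
  1                          ∎) λ ()
  where
  open ≡-Reasoning
  lemma : ∀ t → 3 + 3 * t * 8 ≡ 3 * (1 + t * 8)
  lemma = solve-∀

-- Jacobi's identity for ∏ (1 - qⁱ)³ modulo 2, from c = 2. As M = 1 + 8 e is odd, it is not 2 t²,
-- and only the axis y = 0 contributes.
E³-isSquare : ∀ e → (E ⊗ E ↑ 2) e ≡ isSquare (1 + 8 * e)
E³-isSquare e = trans (Descent.⊗-counts-solutions no-fixed) (trans (Reflection.⨁-solutions false (λ ()) even≢odd) (Boolₚ.xor-identityʳ _))
  where
  tripled : ∀ e → 3 * (1 + 8 * e) ≡ 3 + 24 * e
  tripled = solve-∀
  open FormCount 1 2 1 e (1 + 8 * e) refl refl (tripled e) (cong not (odd-* 8 e)) E (E ↑ 2) E-isSquare E²-sound E²-complete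
  even≢odd : ∀ t → 1 + 8 * e ≡ 2 * (t * t) → false ≡ true
  even≢odd t p = trans (sym (odd-* 2 (t * t))) (trans (cong odd (sym p)) (cong not (odd-* 8 e)))
  no-fixed : ∀ ρ k → norm (ρ * 3) k ≡ + (1 + 8 * e) → k ℤ.+ k ≢ ℤ.- + (2 * ρ)
  no-fixed ρ k p q = 3ρ²≢1+8e ρ e (ℤₚ.+-injective (begin
    + (3 * (ρ * ρ))                 ≡⟨ trans (ℤₚ.pos-* 3 (ρ * ρ)) (cong (λ t → + 3 ℤ.* t) (ℤₚ.pos-* ρ ρ)) ⟩
    + 3 ℤ.* (+ ρ ℤ.* + ρ)           ≡⟨ lemma₃ (+ ρ) ⟩
    _                               ≡⟨ cong₂ (λ r k → (r ℤ.+ + 2 ℤ.* k) ℤ.* (r ℤ.+ + 2 ℤ.* k) ℤ.+ + 2 ℤ.* (k ℤ.* k)) (sym (ℤₚ.pos-* ρ 3)) (sym k≡-ρ) ⟩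
    norm (ρ * 3) k                  ≡⟨ p ⟩
    + (1 + 8 * e)                   ∎))
    where
    open ≡-Reasoning
    lemma₃ : ∀ ρ → + 3 ℤ.* (ρ ℤ.* ρ) ≡ (ρ ℤ.* + 3 ℤ.+ + 2 ℤ.* ℤ.- ρ) ℤ.* (ρ ℤ.* + 3 ℤ.+ + 2 ℤ.* ℤ.- ρ) ℤ.+ + 2 ℤ.* (ℤ.- ρ ℤ.* ℤ.- ρ)
    lemma₃ = ℤSolver.solve-∀
    double : ∀ k → + 2 ℤ.* k ≡ k ℤ.+ k
    double = ℤSolver.solve-∀
    k≡-ρ : k ≡ ℤ.- + ρ
    k≡-ρ = ℤₚ.*-cancelˡ-≡ (+ 2) k (ℤ.- + ρ) (trans (double k) (trans q (trans (cong ℤ.-_ (ℤₚ.pos-* 2 ρ)) (ℤₚ.neg-distribʳ-* (+ 2) (+ ρ)))))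

E⁶≈ : E ↑ 6 ≈ (E ⊗ E ↑ 2) ↑ 2
E⁶≈ = solve 1 (λ e → e :^ 6 := (e :* e :^ 2) :^ 2) ≈-refl E

-- Squaring E³ doubles the exponents; at odd e the number 1 + 4 e is 5 modulo 8 and hence no square
-- either.
E⁶-isSquare : ∀ e → (E ↑ 6) e ≡ isSquare (1 + 4 * e)
E⁶-isSquare e = cases (halve e)
  where
  lemma₀ : ∀ i → 8 * i ≡ 4 * (i * 2)
  lemma₀ = solve-∀
  lemma₁ : ∀ i → 5 + 8 * i ≡ 1 + 4 * (1 + i * 2)
  lemma₁ = solve-∀
  cases : ∃[ i ] (e ≡ i * 2 ⊎ e ≡ 1 + i * 2) → (E ↑ 6) e ≡ isSquare (1 + 4 * e)
  cases (i , inj₁ e≡) = trans (at E⁶≈ e) (trans (cong ((E ⊗ E ↑ 2) ↑ 2) e≡) (trans (square-even (E ⊗ E ↑ 2) i)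
    (trans (E³-isSquare i) (cong (λ t → isSquare (1 + t)) (trans (lemma₀ i) (cong (4 *_) (sym e≡)))))))
  cases (i , inj₂ e≡) = trans (at E⁶≈ e) (trans (cong ((E ⊗ E ↑ 2) ↑ 2) e≡) (trans (square-odd (E ⊗ E ↑ 2) i)
    (sym (not-square (1 + 4 * e) λ r p → 5+8*-not-square i r (trans (lemma₁ i) (trans (cong (λ e → 1 + 4 * e) (sym e≡)) p))))))

B⁶-splits : B ↑ 6 splits-as dilated (E ↑ 6)
B⁶-splits = splits-dilated-↑ B-splits 6

-- The exponents of q B⁶ are e = 5 n + 1 with 1 + 4 n a square, and 1 + 4 e = 5 (1 + 4 n). So q B⁶
-- is the contribution of the axis x = 0 of x² + 5 y².
qB⁶-sound : ∀ e → (q ⊗ B ↑ 6) e ≡ true → ∃[ t ] 1 + 4 * e ≡ 5 * (t * t)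
qB⁶-sound zero    p = contradiction (trans (sym (at (q⊗ (B ↑ 6)) zero)) p) λ ()
qB⁶-sound (suc m) p = finish (dilated-sound B⁶-splits m (trans (sym (at (q⊗ (B ↑ 6)) (suc m))) p))
  where
  lemma : ∀ n → 1 + 4 * suc (n * 5) ≡ 5 * (1 + 4 * n)
  lemma = solve-∀
  finish : ∃[ n ] (m ≡ n * 5 × (E ↑ 6) n ≡ true) → ∃[ t ] 1 + 4 * suc m ≡ 5 * (t * t)
  finish (n , m≡ , E⁶n) =
    let t , t² = isSquare-sound (1 + 4 * n) (trans (sym (E⁶-isSquare n)) E⁶n)
    in t , trans (cong (λ m → 1 + 4 * suc m) m≡) (trans (lemma n) (cong (5 *_) t²))

qB⁶-complete : ∀ e t → 1 + 4 * e ≡ 5 * (t * t) → (q ⊗ B ↑ 6) e ≡ true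
qB⁶-complete zero    t p = contradiction (trans (cong (_% 5) p) (trans (cong (_% 5) (ℕₚ.*-comm 5 (t * t))) ([m+kn]%n≡m%n 0 (t * t) 5))) λ ()
qB⁶-complete (suc m) t p = trans (at (q⊗ (B ↑ 6)) (suc m)) (finish (residue₅ m))
  where
  absurd : ∀ ρ n → m ≡ ρ + n * 5 → (4 * ρ) % 5 ≡ 0
  absurd ρ n m≡ = begin
    (4 * ρ) % 5                        ≡⟨ sym ([m+kn]%n≡m%n (4 * ρ) (1 + 4 * n) 5) ⟩
    (4 * ρ + (1 + 4 * n) * 5) % 5      ≡⟨ cong (_% 5) (lemma ρ n) ⟩
    (1 + 4 * suc (ρ + n * 5)) % 5      ≡⟨ cong (λ m → (1 + 4 * suc m) % 5) (sym m≡) ⟩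
    (1 + 4 * suc m) % 5                ≡⟨ cong (_% 5) (trans p (ℕₚ.*-comm 5 (t * t))) ⟩
    (0 + t * t * 5) % 5                ≡⟨ [m+kn]%n≡m%n 0 (t * t) 5 ⟩
    0                                  ∎
    where
    open ≡-Reasoning
    lemma : ∀ ρ n → 4 * ρ + (1 + 4 * n) * 5 ≡ 1 + 4 * suc (ρ + n * 5)
    lemma = solve-∀
  finish : ∃[ ρ ] ∃[ n ] (ρ < 5 × m ≡ ρ + n * 5) → (B ↑ 6) m ≡ true
  finish (0 , n , _ , m≡) = trans (cong (B ↑ 6) m≡) (trans (at (s₀ B⁶-splits) n) (trans (E⁶-isSquare n) (subst (λ v → isSquare v ≡ true)
    (ℕₚ.*-cancelˡ-≡ (t * t) (1 + 4 * n) 5 (trans (sym p) (trans (cong (λ m → 1 + 4 * suc m) m≡) (lemma n)))) (isSquare-complete t))))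
    where
    lemma : ∀ n → 1 + 4 * suc (0 + n * 5) ≡ 5 * (1 + 4 * n)
    lemma = solve-∀
  finish (1 , n , _ , m≡) = contradiction (absurd 1 n m≡) λ ()
  finish (2 , n , _ , m≡) = contradiction (absurd 2 n m≡) λ ()
  finish (3 , n , _ , m≡) = contradiction (absurd 3 n m≡) λ ()
  finish (4 , n , _ , m≡) = contradiction (absurd 4 n m≡) λ ()
  finish (suc (suc (suc (suc (suc ρ)))) , _ , s≤s (s≤s (s≤s (s≤s (s≤s ())))) , _)

EB-isSquare : ∀ e → (E ⊗ B) e ≡ isSquare (1 + 4 * e) xor (q ⊗ B ↑ 6) e
EB-isSquare e = trans (Descent.⊗-counts-solutions no-fixed) (Reflection.⨁-solutions ((q ⊗ B ↑ 6) e) (qB⁶-sound e) (qB⁶-complete e))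
  where
  scaled : ∀ e → 6 * (1 + 4 * e) ≡ 6 + 24 * e
  scaled = solve-∀
  open FormCount 4 1 2 e (1 + 4 * e) refl refl (scaled e) (cong not (odd-* 4 e)) E B E-isSquare B-sound B-complete
  -- A fixed point has ρ = -2 k, hence r = -6 k, x = -k and norm 6 k², which is even, whereas M is
  -- odd.
  no-fixed : ∀ ρ k → norm (ρ * 3) k ≡ + (1 + 4 * e) → k ℤ.+ k ≢ ℤ.- + (1 * ρ)
  no-fixed ρ k p q = contradiction (begin
    true                                ≡⟨ sym (cong not (odd-* 4 e)) ⟩
    oddℤ (+ (1 + 4 * e))                ≡⟨ cong oddℤ (sym p) ⟩
    oddℤ (norm (ρ * 3) k)               ≡⟨ cong (λ r → oddℤ ((r ℤ.+ + 5 ℤ.* k) ℤ.* (r ℤ.+ + 5 ℤ.* k) ℤ.+ + 5 ℤ.* (k ℤ.* k))) 3ρ ⟩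
    _                                   ≡⟨ cong oddℤ (lemma k) ⟩
    oddℤ (+ 6 ℤ.* (k ℤ.* k))            ≡⟨ oddℤ-* (+ 6) (k ℤ.* k) ⟩
    false                               ∎) λ ()
    where
    open ≡-Reasoning
    lemma : ∀ k → (ℤ.- (k ℤ.+ k) ℤ.* + 3 ℤ.+ + 5 ℤ.* k) ℤ.* (ℤ.- (k ℤ.+ k) ℤ.* + 3 ℤ.+ + 5 ℤ.* k) ℤ.+ + 5 ℤ.* (k ℤ.* k) ≡ + 6 ℤ.* (k ℤ.* k)
    lemma = ℤSolver.solve-∀
    3ρ : + (ρ * 3) ≡ ℤ.- (k ℤ.+ k) ℤ.* + 3
    3ρ = trans (ℤₚ.pos-* ρ 3) (cong (λ t → t ℤ.* + 3) (trans (sym (ℤₚ.neg-involutive (+ ρ))) (cong ℤ.-_ (sym (trans q (cong (λ t → ℤ.- + t) (ℕₚ.*-identityˡ ρ)))))))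

E⁶+qB⁶≈EB : E ↑ 6 ⊕ q ⊗ B ↑ 6 ≈ E ⊗ B
E⁶+qB⁶≈EB = pointwise λ e → trans (⊕-at (E ↑ 6) (q ⊗ B ↑ 6) e)
  (trans (cong (_xor (q ⊗ B ↑ 6) e) (E⁶-isSquare e)) (sym (EB-isSquare e)))

-- 1 + 24 m is a quadratic nonresidue modulo 5 for m = 3 and m = 4, and for m = 1 it is divisible by
-- 5. In that case its root is too, and removing the factor 25 leads back to an exponent of E.
E-splits : E splits-as ⟨ section 0 E , B , section 2 E , 𝟘 , 𝟘 ⟩
E-splits = split ≈-refl (pointwise λ n → ≡-from-⇔ (to n) (from n)) ≈-refl
  (pointwise λ n → trans (E-isSquare (3 + n * 5)) (not-square (1 + (3 + n * 5) * 24) (not-square-mod5 73 (n * 24) (expand 3 n) (λ ()) (λ ()) (λ ()))))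
  (pointwise λ n → trans (E-isSquare (4 + n * 5)) (not-square (1 + (4 + n * 5) * 24) (not-square-mod5 97 (n * 24) (expand 4 n) (λ ()) (λ ()) (λ ()))))
  where
  expand : ∀ ρ n → 1 + (ρ + n * 5) * 24 ≡ (1 + ρ * 24) + n * 24 * 5
  expand = solve-∀
  to : ∀ n → section 1 E n ≡ true → B n ≡ true
  to n p = finish (isSquare-sound (1 + (1 + n * 5) * 24) (trans (sym (E-isSquare (1 + n * 5))) p))
    where
    lemma₁ : ∀ n → (5 + 24 * n) * 5 ≡ 1 + (1 + n * 5) * 24
    lemma₁ = solve-∀
    lemma₂ : ∀ t → 5 * (t * t) * 5 ≡ t * 5 * (t * 5)
    lemma₂ = solve-∀
    finish : ∃[ r ] 1 + (1 + n * 5) * 24 ≡ r * r → B n ≡ true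
    finish (r , r²) = let t , r≡ = 5∣root {5 + 24 * n} r (trans (lemma₁ n) r²) in
      B-complete n t (ℕₚ.*-cancelʳ-≡ (5 * (t * t)) (5 + 24 * n) 5
        (trans (lemma₂ t) (trans (cong₂ _*_ (sym r≡) (sym r≡)) (trans (sym r²) (sym (lemma₁ n))))))
  from : ∀ n → B n ≡ true → section 1 E n ≡ true
  from n p = finish (B-sound n p)
    where
    lemma₁ : ∀ s → 5 * s * (5 * s) ≡ 25 * (s * s)
    lemma₁ = solve-∀
    lemma₂ : ∀ i → 25 * (1 + i * 24) ≡ 1 + (1 + i * 5 * 5) * 24
    lemma₂ = solve-∀
    finish : ∃[ s ] ∃[ i ] (n ≡ i * 5 × s * s ≡ 1 + i * 24) → section 1 E n ≡ true
    finish (s , i , n≡ , s²) = E-complete (1 + n * 5) (5 * s)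
      (trans (lemma₁ s) (trans (cong (25 *_) s²) (trans (lemma₂ i) (cong (λ n → 1 + (1 + n * 5) * 24) (sym n≡)))))

-- The difference of the two generating functions

module D = Dissection {E} {section 0 E} {B} {section 2 E} {X} {b200₂} {p17₂}
  E-splits B-splits X-splits (E-isSquare 0) (trans (at (s₀ B-splits) 0) (E-isSquare 0)) (E-isSquare 0)
  E⁶+qB⁶≈EB b200₂-E p17₂-E

-- For x² = 1 + 4 (n - j) and y² = 1 + 24 c + 120 j the sum 30 x² + y² is 31 + 24 c + 120 n. The
-- residue c is 0 for the series A and 2 for C.
representations : ℕ → ℕ → Bool
representations c n = ⨁ (λ j → isSquare (1 + c * 24 + 120 * j) ∧ isSquare (1 + 4 * (n ∸ j))) (upTo (suc n))

section-E⁶ : ∀ c n → (section c E ⊗ E ↑ 6) n ≡ representations c n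
section-E⁶ c n = trans (⊗-⨁ (section c E) (E ↑ 6) n)
  (⨁-cong (λ j → cong₂ _∧_ (trans (E-isSquare (c + j * 5)) (cong isSquare (lemma c j))) (E⁶-isSquare (n ∸ j))) (upTo (suc n)))
  where
  lemma : ∀ c j → 1 + (c + j * 5) * 24 ≡ 1 + c * 24 + 120 * j
  lemma = solve-∀

-- For arguments from 2 on the subtraction 25 (2 + m) - 26 = 25 m + 24 is not truncated.
q²V-at : ∀ m → (q ↑ 2 ⊗ D.V) (2 + m) ≡ b200₂ (25 * (2 + m) ∸ 26)
q²V-at m = trans (q↑⊗-high 2 D.V m) (cong b200₂ (sym index))
  where
  lemma : ∀ m → 25 * (2 + m) ≡ 26 + (4 + (4 + m * 5) * 5)
  lemma = solve-∀
  index : 25 * (2 + m) ∸ 26 ≡ 4 + (4 + m * 5) * 5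
  index = trans (cong (_∸ 26) (lemma m)) (ℕₚ.m+n∸m≡n 26 (4 + (4 + m * 5) * 5))

parity-difference₂ : ∀ n → b200₂ (25 * (5 * n + 2) ∸ 26) xor p17₂ (5 * n + 2) ≡ representations 0 n
parity-difference₂ n = begin
  b200₂ (25 * (5 * n + 2) ∸ 26) xor p17₂ (5 * n + 2)
    ≡⟨ cong (λ m → b200₂ (25 * m ∸ 26) xor p17₂ m) (lemma n) ⟩
  b200₂ (25 * (2 + n * 5) ∸ 26) xor p17₂ (2 + n * 5)
    ≡⟨ sym (trans (⊕-at (q ↑ 2 ⊗ D.V) (p17₂) (2 + n * 5)) (cong (_xor p17₂ (2 + n * 5)) (q²V-at (n * 5)))) ⟩
  section 2 (q ↑ 2 ⊗ D.V ⊕ p17₂) n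
    ≡⟨ at D.section₂-D n ⟩
  (section 0 E ⊗ E ↑ 6) n
    ≡⟨ section-E⁶ 0 n ⟩
  representations 0 n ∎
  where
  open ≡-Reasoning
  lemma : ∀ n → 5 * n + 2 ≡ 2 + n * 5
  lemma = solve-∀

parity-difference₄ : ∀ n → b200₂ (25 * (5 * n + 4) ∸ 26) xor p17₂ (5 * n + 4) ≡ representations 2 n
parity-difference₄ n = begin
  b200₂ (25 * (5 * n + 4) ∸ 26) xor p17₂ (5 * n + 4)
    ≡⟨ cong (λ m → b200₂ (25 * m ∸ 26) xor p17₂ m) (lemma n) ⟩
  b200₂ (25 * (4 + n * 5) ∸ 26) xor p17₂ (4 + n * 5)
    ≡⟨ sym (trans (⊕-at (q ↑ 2 ⊗ D.V) (p17₂) (4 + n * 5)) (cong (_xor p17₂ (4 + n * 5)) (q²V-at (2 + n * 5)))) ⟩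
  section 4 (q ↑ 2 ⊗ D.V ⊕ p17₂) n
    ≡⟨ at D.section₄-D n ⟩
  (section 2 E ⊗ E ↑ 6) n
    ≡⟨ section-E⁶ 2 n ⟩
  representations 2 n ∎
  where
  open ≡-Reasoning
  lemma : ∀ n → 5 * n + 4 ≡ 4 + n * 5
  lemma = solve-∀

differ₂⇒representations : ∀ n → parityDiffers (λ n → b200 (25 * (5 * n + 2) ∸ 26)) (λ n → p17 (5 * n + 2)) n ≡ true → representations 0 n ≡ true
differ₂⇒representations n p = trans (sym (parity-difference₂ n))
  (trans (cong₂ _xor_ (b200₂-at (25 * (5 * n + 2) ∸ 26)) (p17₂-at (5 * n + 2)))
         (parityDiffers-mod₂ (λ n → b200 (25 * (5 * n + 2) ∸ 26)) (λ n → p17 (5 * n + 2)) n p))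

differ₄⇒representations : ∀ n → parityDiffers (λ n → b200 (25 * (5 * n + 4) ∸ 26)) (λ n → p17 (5 * n + 4)) n ≡ true → representations 2 n ≡ true
differ₄⇒representations n p = trans (sym (parity-difference₄ n))
  (trans (cong₂ _xor_ (b200₂-at (25 * (5 * n + 4) ∸ 26)) (p17₂-at (5 * n + 4)))
         (parityDiffers-mod₂ (λ n → b200 (25 * (5 * n + 4) ∸ 26)) (λ n → p17 (5 * n + 4)) n p))

-- Reduction of the positive forms a z² + 2 b z w + c w² with a c - b² = 30

square-mod3 : ∀ r → (r * r) % 3 ≡ 0 ⊎ (r * r) % 3 ≡ 1
square-mod3 r = cases (r % 3) (r / 3) (m%n<n r 3) (m≡m%n+[m/n]*n r 3)
  where
  expand : ∀ ρ a → (ρ + a * 3) * (ρ + a * 3) ≡ ρ * ρ + (a * (2 * ρ + a * 3)) * 3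
  expand = solve-∀
  reduce : ∀ ρ a → r ≡ ρ + a * 3 → (r * r) % 3 ≡ (ρ * ρ) % 3
  reduce ρ a refl = trans (cong (_% 3) (expand ρ a)) ([m+kn]%n≡m%n (ρ * ρ) (a * (2 * ρ + a * 3)) 3)
  cases : ∀ ρ a → ρ < 3 → r ≡ ρ + a * 3 → (r * r) % 3 ≡ 0 ⊎ (r * r) % 3 ≡ 1
  cases 0 a _ p = inj₁ (reduce 0 a p)
  cases 1 a _ p = inj₂ (reduce 1 a p)
  cases 2 a _ p = inj₂ (reduce 2 a p)
  cases (suc (suc (suc ρ))) a (s≤s (s≤s (s≤s ()))) p

square-residue₅ : ∀ r → (r * r) % 5 ≡ 0 ⊎ (r * r) % 5 ≡ 1 ⊎ (r * r) % 5 ≡ 4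
square-residue₅ r with square-mod5 r
... | inj₂ h = inj₂ h
... | inj₁ (t , refl) = inj₁ (trans (cong (_% 5) (lemma t)) ([m+kn]%n≡m%n 0 (t * 5 * t) 5))
  where
  lemma : ∀ t → t * 5 * (t * 5) ≡ 0 + t * 5 * t * 5
  lemma = solve-∀

form : ℤ → ℤ → ℤ → ℤ → ℤ → ℤ
form a b c z w = a ℤ.* (z ℤ.* z) ℤ.+ + 2 ℤ.* (b ℤ.* (z ℤ.* w)) ℤ.+ c ℤ.* (w ℤ.* w)

Represents : ℕ → ℕ → ℕ → ℕ → Set
Represents a b c N = ∃[ z ] ∃[ w ] form (+ a) (+ b) (+ c) z w ≡ + N

-- Of the four reduced forms only z² + 30 w² takes values with these residues.
Principal : ℕ → Set
Principal N = N % 3 ≡ 1 × (N % 5 ≡ 1 ⊎ N % 5 ≡ 4)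

private
  swap-form : ∀ {a b c N} → Represents a b c N → Represents c b a N
  swap-form {a} {b} {c} (z , w , p) = w , z , trans (lemma (+ a) (+ b) (+ c) z w) p
    where
    lemma : ∀ a b c z w → c ℤ.* (w ℤ.* w) ℤ.+ + 2 ℤ.* (b ℤ.* (w ℤ.* z)) ℤ.+ a ℤ.* (z ℤ.* z)
                          ≡ a ℤ.* (z ℤ.* z) ℤ.+ + 2 ℤ.* (b ℤ.* (z ℤ.* w)) ℤ.+ c ℤ.* (w ℤ.* w)
    lemma = ℤSolver.solve-∀

  translate : ∀ {a b c N} → Represents a (a + b) (a + 2 * b + c) N → Represents a b c N
  translate {a} {b} {c} (z , w , p) = z ℤ.+ w , w , trans (lemma (+ a) (+ b) (+ c) z w)
    (trans (cong (λ c′ → form (+ a) (+ a ℤ.+ + b) c′ z w) (sym (cong (λ t → + a ℤ.+ t ℤ.+ + c) (ℤₚ.pos-* 2 b)))) p)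
    where
    lemma : ∀ a b c z w → a ℤ.* ((z ℤ.+ w) ℤ.* (z ℤ.+ w)) ℤ.+ + 2 ℤ.* (b ℤ.* ((z ℤ.+ w) ℤ.* w)) ℤ.+ c ℤ.* (w ℤ.* w)
                          ≡ a ℤ.* (z ℤ.* z) ℤ.+ + 2 ℤ.* ((a ℤ.+ b) ℤ.* (z ℤ.* w)) ℤ.+ (a ℤ.+ + 2 ℤ.* b ℤ.+ c) ℤ.* (w ℤ.* w)
    lemma = ℤSolver.solve-∀

  translate⁻¹ : ∀ {a b c N} → Represents a b c N → Represents a (a + b) (a + 2 * b + c) N
  translate⁻¹ {a} {b} {c} (z , w , p) = z ℤ.- w , w , trans
    (cong (λ c′ → form (+ a) (+ a ℤ.+ + b) c′ (z ℤ.- w) w) (cong (λ t → + a ℤ.+ t ℤ.+ + c) (ℤₚ.pos-* 2 b)))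
    (trans (lemma (+ a) (+ b) (+ c) z w) p)
    where
    lemma : ∀ a b c z w → a ℤ.* ((z ℤ.- w) ℤ.* (z ℤ.- w)) ℤ.+ + 2 ℤ.* ((a ℤ.+ b) ℤ.* ((z ℤ.- w) ℤ.* w)) ℤ.+ (a ℤ.+ + 2 ℤ.* b ℤ.+ c) ℤ.* (w ℤ.* w)
                          ≡ a ℤ.* (z ℤ.* z) ℤ.+ + 2 ℤ.* (b ℤ.* (z ℤ.* w)) ℤ.+ c ℤ.* (w ℤ.* w)
    lemma = ℤSolver.solve-∀

  -- Keeps the middle coefficient a natural number: for a / 2 < b < a a translation would make it b
  -- - a, and the change of sign of w makes it a - b.
  reflect : ∀ {b b′ c c′ N} → c + b′ ≡ c′ + b → Represents (b + b′) b c N → Represents (b + b′) b′ c′ N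
  reflect {b} {b′} {c} {c′} q (z , w , p) = z ℤ.+ w , ℤ.- w , trans (lemma (+ b) (+ b′) (+ c′) z w)
    (trans (cong (λ c → form (+ b ℤ.+ + b′) (+ b) c z w) (sym c≡)) p)
    where
    c≡ : + c ≡ + c′ ℤ.+ + b ℤ.- + b′
    c≡ = trans (l (+ c) (+ b′)) (cong (λ t → t ℤ.- + b′) (cong +_ q))
      where
      l : ∀ c b → c ≡ c ℤ.+ b ℤ.- b
      l = ℤSolver.solve-∀
    lemma : ∀ b b′ c′ z w → (b ℤ.+ b′) ℤ.* ((z ℤ.+ w) ℤ.* (z ℤ.+ w)) ℤ.+ + 2 ℤ.* (b′ ℤ.* ((z ℤ.+ w) ℤ.* ℤ.- w)) ℤ.+ c′ ℤ.* (ℤ.- w ℤ.* ℤ.- w)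
                            ≡ (b ℤ.+ b′) ℤ.* (z ℤ.* z) ℤ.+ + 2 ℤ.* (b ℤ.* (z ℤ.* w)) ℤ.+ (c′ ℤ.+ b ℤ.- b′) ℤ.* (w ℤ.* w)
    lemma = ℤSolver.solve-∀

  diagonal : ∀ {a c N} → Represents a 0 c N → ∃[ z ] ∃[ w ] a * (z * z) + c * (w * w) ≡ N
  diagonal {a} {c} (z , w , p) = ∣ z ∣ , ∣ w ∣ , ℤₚ.+-injective (trans (cong₂ ℤ._+_
    (trans (ℤₚ.pos-* a (∣ z ∣ * ∣ z ∣)) (cong (λ t → + a ℤ.* t) (sym (square-abs z))))
    (trans (ℤₚ.pos-* c (∣ w ∣ * ∣ w ∣)) (cong (λ t → + c ℤ.* t) (sym (square-abs w)))))
    (trans (lemma (+ a) (+ c) z w) p))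
    where
    lemma : ∀ a c z w → a ℤ.* (z ℤ.* z) ℤ.+ c ℤ.* (w ℤ.* w) ≡ a ℤ.* (z ℤ.* z) ℤ.+ + 2 ℤ.* (+ 0 ℤ.* (z ℤ.* w)) ℤ.+ c ℤ.* (w ℤ.* w)
    lemma = ℤSolver.solve-∀

  not-principal-mod3 : ∀ {N} k l z w → k % 3 ≡ 2 → k * (z * z) + l * 3 * (w * w) ≡ N → N % 3 ≢ 1
  not-principal-mod3 {N} k l z w k≡2 refl N≡1 = cases (square-mod3 z)
    where
    reduced : (2 * ((z * z) % 3)) % 3 ≡ 1
    reduced = begin
      (2 * ((z * z) % 3)) % 3                       ≡⟨ cong (λ t → (t * ((z * z) % 3)) % 3) (sym k≡2) ⟩
      (k % 3 * ((z * z) % 3)) % 3                   ≡⟨ sym (%-distribˡ-* k (z * z) 3) ⟩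
      (k * (z * z)) % 3                             ≡⟨ sym ([m+kn]%n≡m%n (k * (z * z)) (l * (w * w)) 3) ⟩
      (k * (z * z) + l * (w * w) * 3) % 3           ≡⟨ cong (λ t → (k * (z * z) + t) % 3) (lemma l (w * w)) ⟩
      (k * (z * z) + l * 3 * (w * w)) % 3           ≡⟨ N≡1 ⟩
      1                                             ∎
      where
      open ≡-Reasoning
      lemma : ∀ l w → l * w * 3 ≡ l * 3 * w
      lemma = solve-∀
    cases : (z * z) % 3 ≡ 0 ⊎ (z * z) % 3 ≡ 1 → ⊥
    cases (inj₁ h) = contradiction (trans (sym (cong (λ t → (2 * t) % 3) h)) reduced) λ ()
    cases (inj₂ h) = contradiction (trans (sym (cong (λ t → (2 * t) % 3) h)) reduced) λ ()

  not-principal-mod5 : ∀ {N} z w → 3 * (z * z) + 10 * (w * w) ≡ N → ¬ (N % 5 ≡ 1 ⊎ N % 5 ≡ 4)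
  not-principal-mod5 z w refl h = cases (square-residue₅ z) h
    where
    residue : (3 * (z * z) + 10 * (w * w)) % 5 ≡ (3 * ((z * z) % 5)) % 5
    residue = begin
      (3 * (z * z) + 10 * (w * w)) % 5      ≡⟨ cong (λ t → (3 * (z * z) + t) % 5) (lemma (w * w)) ⟩
      (3 * (z * z) + 2 * (w * w) * 5) % 5   ≡⟨ [m+kn]%n≡m%n (3 * (z * z)) (2 * (w * w)) 5 ⟩
      (3 * (z * z)) % 5                     ≡⟨ %-distribˡ-* 3 (z * z) 5 ⟩
      (3 * ((z * z) % 5)) % 5               ∎
      where
      open ≡-Reasoning
      lemma : ∀ w → 10 * w ≡ 2 * w * 5
      lemma = solve-∀
    value : ∀ {ρ} → (z * z) % 5 ≡ ρ → (3 * (z * z) + 10 * (w * w)) % 5 ≡ (3 * ρ) % 5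
    value h = trans residue (cong (λ t → (3 * t) % 5) h)
    cases : (z * z) % 5 ≡ 0 ⊎ (z * z) % 5 ≡ 1 ⊎ (z * z) % 5 ≡ 4 → ¬ ((3 * (z * z) + 10 * (w * w)) % 5 ≡ 1 ⊎ (3 * (z * z) + 10 * (w * w)) % 5 ≡ 4)
    cases (inj₁ h)        (inj₁ r) = contradiction (trans (sym (value h)) r) λ ()
    cases (inj₁ h)        (inj₂ r) = contradiction (trans (sym (value h)) r) λ ()
    cases (inj₂ (inj₁ h)) (inj₁ r) = contradiction (trans (sym (value h)) r) λ ()
    cases (inj₂ (inj₁ h)) (inj₂ r) = contradiction (trans (sym (value h)) r) λ ()
    cases (inj₂ (inj₂ h)) (inj₁ r) = contradiction (trans (sym (value h)) r) λ ()
    cases (inj₂ (inj₂ h)) (inj₂ r) = contradiction (trans (sym (value h)) r) λ ()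

  no-quotient : ∀ {a c n} .{{_ : NonZero a}} → a * c ≡ n → n % a ≢ 0 → ⊥
  no-quotient {a} {c} p h = h (trans (cong (_% a) (trans (sym p) (ℕₚ.*-comm a c))) (m*n%n≡0 c a))

  -- 3 b² ≤ 30 and a² ≤ b² + 30 bound b by 3 and a by 6. Divisibility of b² + 30 by a leaves b = 0
  -- and a = 1, 2, 3 or 5; the values of 2 z² + 15 w² and 5 z² + 6 w² are excluded modulo 3, those
  -- of 3 z² + 10 w² modulo 5.
  reduced : ∀ {N} a b c → a * c ≡ b * b + 30 → a ≤ c → b + b ≤ a → Principal N → Represents a b c N → Represents a b c 1
  reduced {N} a b c ac a≤c 2b≤a (N₃ , N₅) rep = by-cases a b a≤6 b≤3 ac a≤c 2b≤a rep
    where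
    open ℕₚ.≤-Reasoning
    a²≤ : a * a ≤ b * b + 30
    a²≤ = ℕₚ.≤-trans (ℕₚ.*-monoʳ-≤ a a≤c) (ℕₚ.≤-reflexive ac)
    3b²≤30 : 3 * (b * b) ≤ 3 * 10
    3b²≤30 = ℕₚ.+-cancelˡ-≤ (b * b) _ _ (begin
      b * b + 3 * (b * b)       ≡⟨ lemma b ⟩
      (b + b) * (b + b)         ≤⟨ ℕₚ.*-mono-≤ 2b≤a 2b≤a ⟩
      a * a                     ≤⟨ a²≤ ⟩
      b * b + 30                ∎)
      where
      lemma : ∀ b → b * b + 3 * (b * b) ≡ (b + b) * (b + b)
      lemma = solve-∀
    b²≤10 : b * b ≤ 10
    b²≤10 = ℕₚ.*-cancelˡ-≤ 3 3b²≤30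
    bounded : ∀ {x} n → x * x < suc n * suc n → x ≤ n
    bounded {x} n h with x ≤? n
    ... | yes p = p
    ... | no ¬p = contradiction (ℕₚ.*-mono-≤ (ℕₚ.≰⇒> ¬p) (ℕₚ.≰⇒> ¬p)) (ℕₚ.<⇒≱ h)
    b≤3 : b ≤ 3
    b≤3 = bounded 3 (ℕₚ.≤-trans (s≤s b²≤10) (ℕₚ.m≤m+n 11 5))
    a≤6 : a ≤ 6
    a≤6 = bounded 6 (ℕₚ.≤-trans (s≤s (ℕₚ.≤-trans a²≤ (ℕₚ.+-monoˡ-≤ 30 b²≤10))) (ℕₚ.m≤m+n 41 8))
    by-cases : ∀ a b → a ≤ 6 → b ≤ 3 → a * c ≡ b * b + 30 → a ≤ c → b + b ≤ a → Represents a b c N → Represents a b c 1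
    by-cases 0 b _ _ p _ _ _ = contradiction (trans p (ℕₚ.+-comm (b * b) 30)) λ ()
    by-cases 1 0 _ _ p _ _ _ = + 1 , + 0 , lemma (+ c)
      where
      lemma : ∀ c → + 1 ℤ.* (+ 1 ℤ.* + 1) ℤ.+ + 2 ℤ.* (+ 0 ℤ.* (+ 1 ℤ.* + 0)) ℤ.+ c ℤ.* (+ 0 ℤ.* + 0) ≡ + 1
      lemma = ℤSolver.solve-∀
    by-cases 2 0 _ _ p _ _ r with ℕₚ.*-cancelˡ-≡ c 15 2 p
    ... | refl = let z , w , q = diagonal {2} {15} r in contradiction N₃ (not-principal-mod3 2 5 z w refl q)
    by-cases 3 0 _ _ p _ _ r with ℕₚ.*-cancelˡ-≡ c 10 3 p
    ... | refl = let z , w , q = diagonal {3} {10} r in contradiction N₅ (not-principal-mod5 z w q)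
    by-cases 4 0 _ _ p _ _ _ = ⊥-elim (no-quotient {4} {c} p λ ())
    by-cases 5 0 _ _ p _ _ r with ℕₚ.*-cancelˡ-≡ c 6 5 p
    ... | refl = let z , w , q = diagonal {5} {6} r in contradiction N₃ (not-principal-mod3 5 2 z w refl q)
    by-cases 6 0 _ _ p a≤c _ _ with ℕₚ.*-cancelˡ-≡ c 5 6 p
    ... | refl = contradiction a≤c λ { (s≤s (s≤s (s≤s (s≤s (s≤s ()))))) }
    by-cases 1 1 _ _ _ _ (s≤s ()) _
    by-cases 2 1 _ _ p _ _ _ = ⊥-elim (no-quotient {2} {c} p λ ())
    by-cases 3 1 _ _ p _ _ _ = ⊥-elim (no-quotient {3} {c} p λ ())
    by-cases 4 1 _ _ p _ _ _ = ⊥-elim (no-quotient {4} {c} p λ ())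
    by-cases 5 1 _ _ p _ _ _ = ⊥-elim (no-quotient {5} {c} p λ ())
    by-cases 6 1 _ _ p _ _ _ = ⊥-elim (no-quotient {6} {c} p λ ())
    by-cases 1 (suc (suc b)) _ _ _ _ (s≤s ()) _
    by-cases 2 (suc (suc b)) _ _ _ _ (s≤s (s≤s h)) _ = contradiction (ℕₚ.≤-trans (ℕₚ.m≤n+m (2 + b) b) h) λ ()
    by-cases 3 (suc (suc b)) _ _ _ _ (s≤s (s≤s h)) _ = contradiction (ℕₚ.≤-trans (ℕₚ.m≤n+m (2 + b) b) h) λ { (s≤s ()) }
    by-cases 4 2 _ _ p _ _ _ = ⊥-elim (no-quotient {4} {c} p λ ())
    by-cases 5 2 _ _ p _ _ _ = ⊥-elim (no-quotient {5} {c} p λ ())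
    by-cases 6 2 _ _ p _ _ _ = ⊥-elim (no-quotient {6} {c} p λ ())
    by-cases 4 3 _ _ _ _ (s≤s (s≤s (s≤s (s≤s ())))) _
    by-cases 5 3 _ _ _ _ (s≤s (s≤s (s≤s (s≤s (s≤s ()))))) _
    by-cases 6 3 _ _ p _ _ _ = ⊥-elim (no-quotient {6} {c} p λ ())
    by-cases _ (suc (suc (suc (suc b)))) _ (s≤s (s≤s (s≤s ()))) _ _ _ _
    by-cases (suc (suc (suc (suc (suc (suc (suc a))))))) _ (s≤s (s≤s (s≤s (s≤s (s≤s (s≤s ())))))) _ _ _ _ _

-- Gauss reduction, with a + b as the decreasing measure. The representation of N is carried along
-- to the reduced form, which it identifies as z² + 30 w², and the representation of 1 is carried
-- back.
represents-one : ∀ {N} → Principal N → ∀ fuel a b c → a + b < fuel → a * c ≡ b * b + 30 → Represents a b c N → Represents a b c 1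
represents-one {N} P (suc fuel) a b c (s≤s a+b≤fuel) ac rep with a ≤? c
... | no a≰c = swap-form {c} {b} {a} (represents-one {N} P fuel c b a
        (ℕₚ.<-≤-trans (ℕₚ.+-monoˡ-< b (ℕₚ.≰⇒> a≰c)) a+b≤fuel) (trans (ℕₚ.*-comm c a) ac) (swap-form {a} {b} {c} rep))
... | yes a≤c with b + b ≤? a
...   | yes 2b≤a = reduced a b c ac a≤c 2b≤a P rep
...   | no 2b≰a with a ≤? b
...     | yes a≤b = subst₂ (λ b c → Represents a b c 1) b≡ c≡ (translate⁻¹ {a} {b′} {c′}
          (represents-one {N} P fuel a b′ c′ (ℕₚ.<-≤-trans (ℕₚ.+-monoʳ-< a b′<b) a+b≤fuel) ac′
            (translate {a} {b′} {c′} (subst₂ (λ b c → Represents a b c N) (sym b≡) (sym c≡) rep))))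
  where
  b′ c′ : ℕ
  b′ = b ∸ a
  c′ = c ∸ (a + 2 * b′)
  b≡ : a + b′ ≡ b
  b≡ = ℕₚ.m+[n∸m]≡n a≤b
  0<a : 0 < a
  0<a = ℕₚ.n≢0⇒n>0 λ { refl → contradiction (trans ac (ℕₚ.+-comm (b * b) 30)) λ () }
  instance
    a≢0 : NonZero a
    a≢0 = ℕ.>-nonZero 0<a
  b′<b : b′ < b
  b′<b = subst (b′ <_) b≡ (ℕₚ.m<n+m b′ 0<a)
  expand : a * c ≡ a * (a + 2 * b′) + (b′ * b′ + 30)
  expand = trans ac (trans (cong (λ b → b * b + 30) (sym b≡)) (lemma a b′))
    where
    lemma : ∀ a b → (a + b) * (a + b) + 30 ≡ a * (a + 2 * b) + (b * b + 30)
    lemma = solve-∀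
  large : a + 2 * b′ ≤ c
  large = ℕₚ.*-cancelˡ-≤ a (subst (a * (a + 2 * b′) ≤_) (sym expand) (ℕₚ.m≤m+n _ _))
  c≡ : a + 2 * b′ + c′ ≡ c
  c≡ = ℕₚ.m+[n∸m]≡n large
  ac′ : a * c′ ≡ b′ * b′ + 30
  ac′ = ℕₚ.+-cancelˡ-≡ (a * (a + 2 * b′)) _ _ (trans (sym (ℕₚ.*-distribˡ-+ a (a + 2 * b′) c′)) (trans (cong (a *_) c≡) expand))
...     | no a≰b = subst (λ a → Represents a b c 1) (trans (ℕₚ.+-comm b′ b) a≡) (reflect {b′} {b} {c′} {c} (sym c≡)
          (subst (λ a → Represents a b′ c′ 1) (trans (sym a≡) (ℕₚ.+-comm b b′))
            (represents-one {N} P fuel a b′ c′ (ℕₚ.<-≤-trans (ℕₚ.+-monoʳ-< a b′<b) a+b≤fuel) ac′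
              (subst (λ a → Represents a b′ c′ N) a≡ (reflect {b} {b′} {c} {c′} c≡ (subst (λ a → Represents a b c N) (sym a≡) rep))))))
  where
  b′ c′ : ℕ
  b′ = a ∸ b
  c′ = c ∸ a + 2 * b′
  a≡ : b + b′ ≡ a
  a≡ = ℕₚ.m+[n∸m]≡n (ℕₚ.<⇒≤ (ℕₚ.≰⇒> a≰b))
  b′<b : b′ < b
  b′<b = ℕₚ.+-cancelˡ-< b b′ b (subst (_< b + b) (sym a≡) (ℕₚ.≰⇒> 2b≰a))
  c≡ : c + b′ ≡ c′ + b
  c≡ = begin
    c + b′                    ≡⟨ cong (_+ b′) (sym (ℕₚ.m∸n+n≡m a≤c)) ⟩
    c ∸ a + a + b′            ≡⟨ cong (λ a′ → c ∸ a + a′ + b′) (sym a≡) ⟩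
    c ∸ a + (b + b′) + b′     ≡⟨ lemma (c ∸ a) b b′ ⟩
    c′ + b                    ∎
    where
    open ≡-Reasoning
    lemma : ∀ x b b′ → x + (b + b′) + b′ ≡ x + 2 * b′ + b
    lemma = solve-∀
  ac′ : a * c′ ≡ b′ * b′ + 30
  ac′ = ℕₚ.+-cancelʳ-≡ (a * b) (a * c′) (b′ * b′ + 30) (begin
    a * c′ + a * b            ≡⟨ sym (ℕₚ.*-distribˡ-+ a c′ b) ⟩
    a * (c′ + b)              ≡⟨ cong (a *_) (sym c≡) ⟩
    a * (c + b′)              ≡⟨ ℕₚ.*-distribˡ-+ a c b′ ⟩
    a * c + a * b′            ≡⟨ cong₂ _+_ ac (cong (_* b′) (sym a≡)) ⟩
    b * b + 30 + (b + b′) * b′ ≡⟨ lemma b b′ ⟩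
    b′ * b′ + 30 + (b + b′) * b ≡⟨ cong (λ a → b′ * b′ + 30 + a * b) a≡ ⟩
    b′ * b′ + 30 + a * b      ∎)
    where
    open ≡-Reasoning
    lemma : ∀ b b′ → b * b + 30 + (b + b′) * b′ ≡ b′ * b′ + 30 + (b + b′) * b
    lemma = solve-∀

-- Nontrivial square roots of one

bézout : ∀ {m n} → Coprime m n → ∃[ α ] ∃[ β ] α ℤ.* + m ℤ.+ β ℤ.* + n ≡ + 1
bézout {m} {n} c with coprime-Bézout c
... | Bézout.+- x y eq = + x , ℤ.- + y , trans (cong (λ t → t ℤ.+ ℤ.- + y ℤ.* + n) (trans (sym (ℤₚ.pos-* x m)) (trans (cong +_ (sym eq)) (cong (λ t → + 1 ℤ.+ t) (ℤₚ.pos-* y n))))) (lemma (+ y) (+ n))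
  where
  lemma : ∀ y n → + 1 ℤ.+ y ℤ.* n ℤ.+ ℤ.- y ℤ.* n ≡ + 1
  lemma = ℤSolver.solve-∀
... | Bézout.-+ x y eq = ℤ.- + x , + y , trans (cong (λ t → ℤ.- + x ℤ.* + m ℤ.+ t) (trans (sym (ℤₚ.pos-* y n)) (trans (cong +_ (sym eq)) (cong (λ t → + 1 ℤ.+ t) (ℤₚ.pos-* x m))))) (lemma (+ x) (+ m))
  where
  lemma : ∀ x m → ℤ.- x ℤ.* m ℤ.+ (+ 1 ℤ.+ x ℤ.* m) ≡ + 1
  lemma = ℤSolver.solve-∀

∣⁺ : ∀ {d z} → d ∣ⁿ ∣ z ∣ → + d ∣ᶻ z
∣⁺ {d} {z} p = ℤ∣.∣ᵤ⇒∣ {+ d} {z} p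

∣⁻ : ∀ {d z} → + d ∣ᶻ z → d ∣ⁿ ∣ z ∣
∣⁻ p = ℤ∣.∣⇒∣ᵤ p

bézout⇒coprime : ∀ {x y} α β → α ℤ.* x ℤ.+ β ℤ.* y ≡ + 1 → Coprime ∣ x ∣ ∣ y ∣
bézout⇒coprime {x} {y} α β p {d} (d∣x , d∣y) = ∣1⇒≡1 (∣⁻ {d} {+ 1} (subst (+ d ∣ᶻ_) p
  (ℤ∣.∣m∣n⇒∣m+n (ℤ∣.∣n⇒∣m*n α {x} (∣⁺ {d} {x} d∣x)) (ℤ∣.∣n⇒∣m*n β {y} (∣⁺ {d} {y} d∣y)))))

coprime-cancel : ∀ {n x z} → Coprime n x → + n ∣ᶻ + x ℤ.* z → + n ∣ᶻ z
coprime-cancel {n} {x} {z} c p = ∣⁺ {n} {z} (coprime-divisor c (subst (n ∣ⁿ_) (ℤₚ.abs-* (+ x) z) (∣⁻ {n} {+ x ℤ.* z} p)))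

prime-power-part : ∀ {p} → Prime p → ∀ n → 0 < n → ∃[ e ] ∃[ w ] (n ≡ p ^ e * w × ¬ p ∣ⁿ w)
prime-power-part {p} pr = <-rec _ step
  where
  instance
    p≢0 : NonZero p
    p≢0 = prime⇒nonZero pr
  1<p : 1 < p
  1<p = ℕ.nonTrivial⇒n>1 p {{prime⇒nonTrivial pr}}
  step : ∀ n → (∀ {m} → m < n → 0 < m → ∃[ e ] ∃[ w ] (m ≡ p ^ e * w × ¬ p ∣ⁿ w)) → 0 < n → ∃[ e ] ∃[ w ] (n ≡ p ^ e * w × ¬ p ∣ⁿ w)
  step n rec 0<n with p ∣? n
  ... | no p∤n = 0 , n , sym (ℕₚ.*-identityˡ n) , p∤n
  ... | yes (divides zero n≡) = contradiction n≡ λ { refl → ℕₚ.<-irrefl refl 0<n }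
  ... | yes (divides (suc m) n≡) with rec {suc m} (subst (suc m <_) (sym n≡) (ℕₚ.m<m*n (suc m) p 1<p)) (s≤s z≤n)
  ...   | e , w , m≡ , p∤w = suc e , w , trans n≡ (trans (ℕₚ.*-comm (suc m) p) (trans (cong (p *_) m≡) (sym (ℕₚ.*-assoc p (p ^ e) w)))) , p∤w

prime-coprime : ∀ {p w} → Prime p → ¬ p ∣ⁿ w → Coprime p w
prime-coprime pr p∤w {d} (d∣p , d∣w) with prime⇒irreducible pr d∣p
... | inj₁ d≡1 = d≡1
... | inj₂ refl = contradiction d∣w p∤w

bézout-^ : ∀ {p w} e → Coprime p w → ∃[ α ] ∃[ β ] α ℤ.* + (p ^ e) ℤ.+ β ℤ.* + w ≡ + 1
bézout-^ {p} {w} zero    c = + 1 , + 0 , refl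
bézout-^ {p} {w} (suc e) c with bézout c | bézout-^ e c
... | α , β , eq | α′ , β′ , eq′ = α ℤ.* α′ , β′ ℤ.+ α′ ℤ.* + (p ^ e) ℤ.* β , (begin
  α ℤ.* α′ ℤ.* + (p * p ^ e) ℤ.+ (β′ ℤ.+ α′ ℤ.* + (p ^ e) ℤ.* β) ℤ.* + w      ≡⟨ cong (λ t → α ℤ.* α′ ℤ.* t ℤ.+ (β′ ℤ.+ α′ ℤ.* + (p ^ e) ℤ.* β) ℤ.* + w) (ℤₚ.pos-* p (p ^ e)) ⟩
  _                                                                           ≡⟨ lemma α β α′ β′ (+ p) (+ (p ^ e)) (+ w) ⟩
  α′ ℤ.* + (p ^ e) ℤ.* (α ℤ.* + p ℤ.+ β ℤ.* + w) ℤ.+ β′ ℤ.* + w                 ≡⟨ cong (λ t → α′ ℤ.* + (p ^ e) ℤ.* t ℤ.+ β′ ℤ.* + w) eq ⟩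
  α′ ℤ.* + (p ^ e) ℤ.* + 1 ℤ.+ β′ ℤ.* + w                                       ≡⟨ cong (λ t → t ℤ.+ β′ ℤ.* + w) (ℤₚ.*-identityʳ (α′ ℤ.* + (p ^ e))) ⟩
  α′ ℤ.* + (p ^ e) ℤ.+ β′ ℤ.* + w                                              ≡⟨ eq′ ⟩
  + 1                                                                         ∎)
  where
  open ≡-Reasoning
  lemma : ∀ α β α′ β′ p u w → α ℤ.* α′ ℤ.* (p ℤ.* u) ℤ.+ (β′ ℤ.+ α′ ℤ.* u ℤ.* β) ℤ.* w ≡ α′ ℤ.* u ℤ.* (α ℤ.* p ℤ.+ β ℤ.* w) ℤ.+ β′ ℤ.* w
  lemma = ℤSolver.solve-∀

PrimePower : ℕ → Set
PrimePower n = ∃[ p ] ∃[ e ] (Prime p × n ≡ p ^ e)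

NontrivialRoot : ℕ → ℤ → Set
NontrivialRoot n κ = (+ n ∣ᶻ κ ℤ.* κ ℤ.- + 1) × (¬ + n ∣ᶻ κ ℤ.- + 1) × (¬ + n ∣ᶻ κ ℤ.+ + 1)

odd-∣2 : ∀ {d} → odd d ≡ true → d ∣ⁿ 2 → d ≡ 1
odd-∣2 {d} o d∣2 = cases d o (ℕ∣.∣⇒≤ d∣2)
  where
  cases : ∀ d → odd d ≡ true → d ≤ 2 → d ≡ 1
  cases 1 _ _ = refl
  cases (suc (suc (suc d))) _ (s≤s (s≤s ()))

-- β w - α u is 1 modulo u and -1 modulo w.
nontrivial-root : ∀ u w α β → α ℤ.* + u ℤ.+ β ℤ.* + w ≡ + 1 → ¬ (u ∣ⁿ 2) → ¬ (w ∣ⁿ 2) → NontrivialRoot (u * w) (β ℤ.* + w ℤ.- α ℤ.* + u)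
nontrivial-root u w α β eq u∤2 w∤2 = dividesᶻ (ℤ.- + 4 ℤ.* (α ℤ.* β)) square , not-one , not-minus-one
  where
  open ≡-Reasoning
  uw : + (u * w) ≡ + u ℤ.* + w
  uw = ℤₚ.pos-* u w
  κ : ℤ
  κ = β ℤ.* + w ℤ.- α ℤ.* + u
  square : κ ℤ.* κ ℤ.- + 1 ≡ ℤ.- + 4 ℤ.* (α ℤ.* β) ℤ.* + (u * w)
  square = begin
    κ ℤ.* κ ℤ.- + 1 ℤ.* + 1                                                       ≡⟨ cong (λ t → κ ℤ.* κ ℤ.- t ℤ.* t) (sym eq) ⟩
    _                                                                             ≡⟨ lemma α β (+ u) (+ w) ⟩
    ℤ.- + 4 ℤ.* (α ℤ.* β) ℤ.* (+ u ℤ.* + w)                                       ≡⟨ cong (λ t → ℤ.- + 4 ℤ.* (α ℤ.* β) ℤ.* t) (sym uw) ⟩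
    ℤ.- + 4 ℤ.* (α ℤ.* β) ℤ.* + (u * w)                                           ∎
    where
    lemma : ∀ α β u w → (β ℤ.* w ℤ.- α ℤ.* u) ℤ.* (β ℤ.* w ℤ.- α ℤ.* u) ℤ.- (α ℤ.* u ℤ.+ β ℤ.* w) ℤ.* (α ℤ.* u ℤ.+ β ℤ.* w) ≡ ℤ.- + 4 ℤ.* (α ℤ.* β) ℤ.* (u ℤ.* w)
    lemma = ℤSolver.solve-∀
  not-one : ¬ + (u * w) ∣ᶻ κ ℤ.- + 1
  not-one (dividesᶻ m m≡) = w∤2 (∣⁻ {w} {+ 2} (dividesᶻ (+ 2 ℤ.* β ℤ.- m ℤ.* + u) (begin
    + 2 ℤ.* + 1                                                ≡⟨ cong (λ t → + 2 ℤ.* t) (sym eq) ⟩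
    + 2 ℤ.* (α ℤ.* + u ℤ.+ β ℤ.* + w)                           ≡⟨ lemma₁ α β (+ u) (+ w) ⟩
    + 2 ℤ.* β ℤ.* + w ℤ.- (κ ℤ.- (α ℤ.* + u ℤ.+ β ℤ.* + w))     ≡⟨ cong (λ t → + 2 ℤ.* β ℤ.* + w ℤ.- (κ ℤ.- t)) eq ⟩
    + 2 ℤ.* β ℤ.* + w ℤ.- (κ ℤ.- + 1)                           ≡⟨ cong (λ t → + 2 ℤ.* β ℤ.* + w ℤ.- t) (trans m≡ (cong (λ t → m ℤ.* t) uw)) ⟩
    + 2 ℤ.* β ℤ.* + w ℤ.- m ℤ.* (+ u ℤ.* + w)                   ≡⟨ lemma₂ β m (+ u) (+ w) ⟩
    (+ 2 ℤ.* β ℤ.- m ℤ.* + u) ℤ.* + w                           ∎)))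
    where
    lemma₁ : ∀ α β u w → + 2 ℤ.* (α ℤ.* u ℤ.+ β ℤ.* w) ≡ + 2 ℤ.* β ℤ.* w ℤ.- (β ℤ.* w ℤ.- α ℤ.* u ℤ.- (α ℤ.* u ℤ.+ β ℤ.* w))
    lemma₁ = ℤSolver.solve-∀
    lemma₂ : ∀ β m u w → + 2 ℤ.* β ℤ.* w ℤ.- m ℤ.* (u ℤ.* w) ≡ (+ 2 ℤ.* β ℤ.- m ℤ.* u) ℤ.* w
    lemma₂ = ℤSolver.solve-∀
  not-minus-one : ¬ + (u * w) ∣ᶻ κ ℤ.+ + 1
  not-minus-one (dividesᶻ m m≡) = u∤2 (∣⁻ {u} {+ 2} (dividesᶻ (+ 2 ℤ.* α ℤ.+ m ℤ.* + w) (begin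
    + 2 ℤ.* + 1                                                ≡⟨ cong (λ t → + 2 ℤ.* t) (sym eq) ⟩
    + 2 ℤ.* (α ℤ.* + u ℤ.+ β ℤ.* + w)                           ≡⟨ lemma₁ α β (+ u) (+ w) ⟩
    + 2 ℤ.* α ℤ.* + u ℤ.+ (κ ℤ.+ (α ℤ.* + u ℤ.+ β ℤ.* + w))     ≡⟨ cong (λ t → + 2 ℤ.* α ℤ.* + u ℤ.+ (κ ℤ.+ t)) eq ⟩
    + 2 ℤ.* α ℤ.* + u ℤ.+ (κ ℤ.+ + 1)                           ≡⟨ cong (λ t → + 2 ℤ.* α ℤ.* + u ℤ.+ t) (trans m≡ (cong (λ t → m ℤ.* t) uw)) ⟩
    + 2 ℤ.* α ℤ.* + u ℤ.+ m ℤ.* (+ u ℤ.* + w)                   ≡⟨ lemma₂ α m (+ u) (+ w) ⟩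
    (+ 2 ℤ.* α ℤ.+ m ℤ.* + w) ℤ.* + u                           ∎)))
    where
    lemma₁ : ∀ α β u w → + 2 ℤ.* (α ℤ.* u ℤ.+ β ℤ.* w) ≡ + 2 ℤ.* α ℤ.* u ℤ.+ (β ℤ.* w ℤ.- α ℤ.* u ℤ.+ (α ℤ.* u ℤ.+ β ℤ.* w))
    lemma₁ = ℤSolver.solve-∀
    lemma₂ : ∀ α m u w → + 2 ℤ.* α ℤ.* u ℤ.+ m ℤ.* (u ℤ.* w) ≡ (+ 2 ℤ.* α ℤ.+ m ℤ.* w) ℤ.* u
    lemma₂ = ℤSolver.solve-∀

Splitting : ℕ → Set
Splitting n = odd n ≡ false ⊎ PrimePower n ⊎ (∃[ κ ] NontrivialRoot n κ)

splitting : ∀ n → Splitting n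
splitting n with odd n in o
... | false = inj₁ refl
... | true  = inj₂ (split-odd n o)
  where
  odd-factorʳ : ∀ {u w} → odd (u * w) ≡ true → odd u ≡ true × odd w ≡ true
  odd-factorʳ {u} {w} p = ∧-true (trans (sym (odd-* u w)) p)
  split-odd : ∀ n → odd n ≡ true → PrimePower n ⊎ (∃[ κ ] NontrivialRoot n κ)
  split-odd n@(suc _) o = by-factors (PrimeFactorisation.factors f) (PrimeFactorisation.isFactorisation f) (PrimeFactorisation.factorsPrime f)
    where
    f = factorise n
    by-part : ∀ p → Prime p → p ∣ⁿ n → ∃[ e ] ∃[ w ] (n ≡ p ^ e * w × ¬ p ∣ⁿ w) → PrimePower n ⊎ (∃[ κ ] NontrivialRoot n κ)
    by-part p pr p∣n (e , w , n≡ , p∤w) with w ≟ 1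
    ... | yes w≡1 = inj₁ (p , e , pr , trans n≡ (trans (cong (p ^ e *_) w≡1) (ℕₚ.*-identityʳ (p ^ e))))
    ... | no w≢1 with odd-factorʳ {p ^ e} {w} (trans (cong odd (sym n≡)) o)
    ...   | u-odd , w-odd = let α , β , eq = bézout-^ e (prime-coprime pr p∤w) in
      inj₂ (β ℤ.* + w ℤ.- α ℤ.* + (p ^ e) , subst (λ n → NontrivialRoot n (β ℤ.* + w ℤ.- α ℤ.* + (p ^ e))) (sym n≡)
        (nontrivial-root (p ^ e) w α β eq (λ u∣2 → u≢1 e n≡ (odd-∣2 u-odd u∣2)) (λ w∣2 → w≢1 (odd-∣2 w-odd w∣2))))
      where
      u≢1 : ∀ e → n ≡ p ^ e * w → p ^ e ≢ 1
      u≢1 zero    n≡ _ = p∤w (subst (p ∣ⁿ_) (trans n≡ (ℕₚ.*-identityˡ w)) p∣n)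
      u≢1 (suc e) _  p^≡1 = ℕ.nonTrivial⇒≢1 {{prime⇒nonTrivial pr}} (ℕₚ.m*n≡1⇒m≡1 p (p ^ e) p^≡1)
    by-factors : ∀ ps → n ≡ product ps → All Prime ps → PrimePower n ⊎ (∃[ κ ] NontrivialRoot n κ)
    -- n = 1 counts as the prime power 2⁰; the even exponent will contradict that the number
    -- represented is not a square.
    by-factors []       n≡1 _         = inj₁ (2 , 0 , prime[2] , n≡1)
    by-factors (p ∷ ps) n≡  (pr ∷ _) = by-part p pr (divides (product ps) (trans n≡ (ℕₚ.*-comm p (product ps)))) (prime-power-part pr n (s≤s z≤n))

-- Through `κ[_]` the root depends on n alone, so that both members of a pair use the same one. The
-- value 0 is a default for those n for which no nontrivial root was produced.
root-of : ∀ {n} → Splitting n → ℤ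
root-of (inj₂ (inj₂ (κ , _))) = κ
root-of (inj₂ (inj₁ _))       = + 0
root-of (inj₁ _)              = + 0

κ[_] : ℕ → ℤ
κ[ n ] = root-of (splitting n)

κ-spec : ∀ n → odd n ≡ true → PrimePower n ⊎ NontrivialRoot n κ[ n ]
κ-spec n o = cases (splitting n)
  where
  cases : (s : Splitting n) → PrimePower n ⊎ NontrivialRoot n (root-of s)
  cases (inj₁ e)              = contradiction (trans (sym o) e) λ ()
  cases (inj₂ (inj₁ pp))      = inj₁ pp
  cases (inj₂ (inj₂ (_ , r))) = inj₂ r

record Conjugate (n x y : ℕ) (κ : ℤ) : Set where
  field
    x₁ y₁      : ℤ
    norm       : + 30 ℤ.* (x₁ ℤ.* x₁) ℤ.+ y₁ ℤ.* y₁ ≡ + n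
    coprime    : Coprime ∣ x₁ ∣ ∣ y₁ ∣
    congruent  : + n ∣ᶻ + x ℤ.* y₁ ℤ.- κ ℤ.* (x₁ ℤ.* + y)

-- The ideal argument made explicit: the representation whose quotient y₁/x₁ is κ times y/x modulo n exists
-- because the form (n, 2t, (t² + 30)/n) with t = κ y/x represents n, hence lies in the principal class.
conjugate : ∀ n x y κ → n ≡ 30 * (x * x) + y * y → Coprime x n → + n ∣ᶻ κ ℤ.* κ ℤ.- + 1 → Principal n → Conjugate n x y κ
conjugate n x y κ n≡ cop (dividesᶻ k κ²) P with bézout cop
-- The form takes the value n at (1, 0), and n lies in the principal genus; that is the input of the
-- reduction.
... | x̄ , β , inverse = from-one (represents-one P (suc (n + ∣ t ∣)) n ∣ t ∣ c ℕₚ.≤-refl nc (+ 1 , + 0 , unit (+ n) (+ ∣ t ∣) (+ c)))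
  where
  open ≡-Reasoning
  m : ℤ
  m = ℤ.- β
  xx̄ : + x ℤ.* x̄ ≡ + 1 ℤ.+ m ℤ.* + n
  xx̄ = trans (lemma (+ x) x̄ β (+ n)) (cong (λ t → t ℤ.+ m ℤ.* + n) inverse)
    where
    lemma : ∀ x x̄ β n → x ℤ.* x̄ ≡ x̄ ℤ.* x ℤ.+ β ℤ.* n ℤ.+ ℤ.- β ℤ.* n
    lemma = ℤSolver.solve-∀
  κκ : κ ℤ.* κ ≡ + 1 ℤ.+ k ℤ.* + n
  κκ = trans (lemma (κ ℤ.* κ)) (cong (λ t → + 1 ℤ.+ t) κ²)
    where
    lemma : ∀ x → x ≡ + 1 ℤ.+ (x ℤ.- + 1)
    lemma = ℤSolver.solve-∀
  yy : + y ℤ.* + y ≡ + n ℤ.- + 30 ℤ.* (+ x ℤ.* + x)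
  yy = begin
    + y ℤ.* + y                                                            ≡⟨ lemma (+ 30 ℤ.* (+ x ℤ.* + x)) (+ y ℤ.* + y) ⟩
    + 30 ℤ.* (+ x ℤ.* + x) ℤ.+ + y ℤ.* + y ℤ.- + 30 ℤ.* (+ x ℤ.* + x)      ≡⟨ cong (λ t → t ℤ.- + 30 ℤ.* (+ x ℤ.* + x)) (cong₂ ℤ._+_ (cong (λ t → + 30 ℤ.* t) (sym (ℤₚ.pos-* x x))) (sym (ℤₚ.pos-* y y))) ⟩
    + 30 ℤ.* + (x * x) ℤ.+ + (y * y) ℤ.- + 30 ℤ.* (+ x ℤ.* + x)            ≡⟨ cong (λ t → t ℤ.+ + (y * y) ℤ.- + 30 ℤ.* (+ x ℤ.* + x)) (sym (ℤₚ.pos-* 30 (x * x))) ⟩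
    + (30 * (x * x) + y * y) ℤ.- + 30 ℤ.* (+ x ℤ.* + x)                    ≡⟨ cong (λ t → + t ℤ.- + 30 ℤ.* (+ x ℤ.* + x)) (sym n≡) ⟩
    + n ℤ.- + 30 ℤ.* (+ x ℤ.* + x)                                         ∎
    where
    lemma : ∀ a b → b ≡ a ℤ.+ b ℤ.- a
    lemma = ℤSolver.solve-∀
  t : ℤ
  t = κ ℤ.* + y ℤ.* x̄
  -- Modulo n one has κ² = 1, y² = -30 x² and x x̄ = 1, hence t² = -30. `Q` is the quotient left by
  -- these three substitutions.
  Q : ℤ
  Q = x̄ ℤ.* x̄ ℤ.- + 60 ℤ.* m ℤ.- + 30 ℤ.* (m ℤ.* m ℤ.* + n) ℤ.+ k ℤ.* (+ n ℤ.* (x̄ ℤ.* x̄) ℤ.- + 30 ℤ.* ((+ 1 ℤ.+ m ℤ.* + n) ℤ.* (+ 1 ℤ.+ m ℤ.* + n)))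
  t²+30 : t ℤ.* t ℤ.+ + 30 ≡ Q ℤ.* + n
  t²+30 = begin
    t ℤ.* t ℤ.+ + 30
      ≡⟨ lemma₁ κ (+ y) x̄ ⟩
    κ ℤ.* κ ℤ.* (+ y ℤ.* + y ℤ.* (x̄ ℤ.* x̄)) ℤ.+ + 30
      ≡⟨ cong₂ (λ a b → a ℤ.* (b ℤ.* (x̄ ℤ.* x̄)) ℤ.+ + 30) κκ yy ⟩
    (+ 1 ℤ.+ k ℤ.* + n) ℤ.* ((+ n ℤ.- + 30 ℤ.* (+ x ℤ.* + x)) ℤ.* (x̄ ℤ.* x̄)) ℤ.+ + 30
      ≡⟨ lemma₂ k (+ n) (+ x) x̄ ⟩
    (+ 1 ℤ.+ k ℤ.* + n) ℤ.* (+ n ℤ.* (x̄ ℤ.* x̄) ℤ.- + 30 ℤ.* ((+ x ℤ.* x̄) ℤ.* (+ x ℤ.* x̄))) ℤ.+ + 30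
      ≡⟨ cong (λ a → (+ 1 ℤ.+ k ℤ.* + n) ℤ.* (+ n ℤ.* (x̄ ℤ.* x̄) ℤ.- + 30 ℤ.* (a ℤ.* a)) ℤ.+ + 30) xx̄ ⟩
    (+ 1 ℤ.+ k ℤ.* + n) ℤ.* (+ n ℤ.* (x̄ ℤ.* x̄) ℤ.- + 30 ℤ.* ((+ 1 ℤ.+ m ℤ.* + n) ℤ.* (+ 1 ℤ.+ m ℤ.* + n))) ℤ.+ + 30
      ≡⟨ lemma₃ k (+ n) x̄ m ⟩
    Q ℤ.* + n ∎
    where
    lemma₁ : ∀ κ y x̄ → (κ ℤ.* y ℤ.* x̄) ℤ.* (κ ℤ.* y ℤ.* x̄) ℤ.+ + 30 ≡ κ ℤ.* κ ℤ.* (y ℤ.* y ℤ.* (x̄ ℤ.* x̄)) ℤ.+ + 30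
    lemma₁ = ℤSolver.solve-∀
    lemma₂ : ∀ k n x x̄ → (+ 1 ℤ.+ k ℤ.* n) ℤ.* ((n ℤ.- + 30 ℤ.* (x ℤ.* x)) ℤ.* (x̄ ℤ.* x̄)) ℤ.+ + 30
                         ≡ (+ 1 ℤ.+ k ℤ.* n) ℤ.* (n ℤ.* (x̄ ℤ.* x̄) ℤ.- + 30 ℤ.* ((x ℤ.* x̄) ℤ.* (x ℤ.* x̄))) ℤ.+ + 30
    lemma₂ = ℤSolver.solve-∀
    lemma₃ : ∀ k n x̄ m → (+ 1 ℤ.+ k ℤ.* n) ℤ.* (n ℤ.* (x̄ ℤ.* x̄) ℤ.- + 30 ℤ.* ((+ 1 ℤ.+ m ℤ.* n) ℤ.* (+ 1 ℤ.+ m ℤ.* n))) ℤ.+ + 30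
                         ≡ (x̄ ℤ.* x̄ ℤ.- + 60 ℤ.* m ℤ.- + 30 ℤ.* (m ℤ.* m ℤ.* n) ℤ.+ k ℤ.* (n ℤ.* (x̄ ℤ.* x̄) ℤ.- + 30 ℤ.* ((+ 1 ℤ.+ m ℤ.* n) ℤ.* (+ 1 ℤ.+ m ℤ.* n)))) ℤ.* n
    lemma₃ = ℤSolver.solve-∀
  t²+30-abs : t ℤ.* t ℤ.+ + 30 ≡ + (∣ t ∣ * ∣ t ∣ + 30)
  t²+30-abs = cong (λ s → s ℤ.+ + 30) (square-abs t)
  n∣t²+30 : n ∣ⁿ ∣ t ∣ * ∣ t ∣ + 30
  n∣t²+30 = ∣⁻ {n} {+ (∣ t ∣ * ∣ t ∣ + 30)} (subst (+ n ∣ᶻ_) t²+30-abs (dividesᶻ Q t²+30))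
  c : ℕ
  c = ℕ∣.quotient n∣t²+30
  nc : n * c ≡ ∣ t ∣ * ∣ t ∣ + 30
  nc = trans (ℕₚ.*-comm n c) (sym (ℕ∣._∣_.equality n∣t²+30))
  ncᶻ : + n ℤ.* + c ≡ t ℤ.* t ℤ.+ + 30
  ncᶻ = trans (sym (ℤₚ.pos-* n c)) (trans (cong +_ nc) (sym t²+30-abs))
  unit : ∀ a b c → a ℤ.* (+ 1 ℤ.* + 1) ℤ.+ + 2 ℤ.* (b ℤ.* (+ 1 ℤ.* + 0)) ℤ.+ c ℤ.* (+ 0 ℤ.* + 0) ≡ a
  unit = ℤSolver.solve-∀
  -- Multiplying n z² + 2 t z w + c w² = 1 by n completes the square to (n z + t w)² + 30 w² = n.
  -- Modulo n the quotient of n z + t w by w is t, and coprimality can be read off from the same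
  -- equation.
  finish : ∀ z w → form (+ n) t (+ c) z w ≡ + 1 → Conjugate n x y κ
  finish z w one = record
    { x₁ = w ; y₁ = y₁ ; norm = norm
    ; coprime = bézout⇒coprime {w} {y₁} (t ℤ.* z ℤ.+ + c ℤ.* w) z (trans (lemma₁ (+ n) t (+ c) z w) one)
    ; congruent = dividesᶻ (+ x ℤ.* z ℤ.+ κ ℤ.* + y ℤ.* w ℤ.* m) quotient }
    where
    y₁ : ℤ
    y₁ = + n ℤ.* z ℤ.+ t ℤ.* w
    lemma₁ : ∀ n t c z w → (t ℤ.* z ℤ.+ c ℤ.* w) ℤ.* w ℤ.+ z ℤ.* (n ℤ.* z ℤ.+ t ℤ.* w) ≡ n ℤ.* (z ℤ.* z) ℤ.+ + 2 ℤ.* (t ℤ.* (z ℤ.* w)) ℤ.+ c ℤ.* (w ℤ.* w)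
    lemma₁ = ℤSolver.solve-∀
    norm : + 30 ℤ.* (w ℤ.* w) ℤ.+ y₁ ℤ.* y₁ ≡ + n
    norm = begin
      + 30 ℤ.* (w ℤ.* w) ℤ.+ y₁ ℤ.* y₁
        ≡⟨ lemma₂ (+ n) t z w ⟩
      + n ℤ.* (+ n ℤ.* (z ℤ.* z) ℤ.+ + 2 ℤ.* (t ℤ.* (z ℤ.* w))) ℤ.+ (t ℤ.* t ℤ.+ + 30) ℤ.* (w ℤ.* w)
        ≡⟨ cong (λ s → + n ℤ.* (+ n ℤ.* (z ℤ.* z) ℤ.+ + 2 ℤ.* (t ℤ.* (z ℤ.* w))) ℤ.+ s ℤ.* (w ℤ.* w)) (sym ncᶻ) ⟩
      + n ℤ.* (+ n ℤ.* (z ℤ.* z) ℤ.+ + 2 ℤ.* (t ℤ.* (z ℤ.* w))) ℤ.+ + n ℤ.* + c ℤ.* (w ℤ.* w)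
        ≡⟨ lemma₃ (+ n) t (+ c) z w ⟩
      + n ℤ.* form (+ n) t (+ c) z w
        ≡⟨ cong (λ s → + n ℤ.* s) one ⟩
      + n ℤ.* + 1
        ≡⟨ ℤₚ.*-identityʳ (+ n) ⟩
      + n ∎
      where
      lemma₂ : ∀ n t z w → + 30 ℤ.* (w ℤ.* w) ℤ.+ (n ℤ.* z ℤ.+ t ℤ.* w) ℤ.* (n ℤ.* z ℤ.+ t ℤ.* w)
                           ≡ n ℤ.* (n ℤ.* (z ℤ.* z) ℤ.+ + 2 ℤ.* (t ℤ.* (z ℤ.* w))) ℤ.+ (t ℤ.* t ℤ.+ + 30) ℤ.* (w ℤ.* w)
      lemma₂ = ℤSolver.solve-∀
      lemma₃ : ∀ n t c z w → n ℤ.* (n ℤ.* (z ℤ.* z) ℤ.+ + 2 ℤ.* (t ℤ.* (z ℤ.* w))) ℤ.+ n ℤ.* c ℤ.* (w ℤ.* w)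
                             ≡ n ℤ.* (n ℤ.* (z ℤ.* z) ℤ.+ + 2 ℤ.* (t ℤ.* (z ℤ.* w)) ℤ.+ c ℤ.* (w ℤ.* w))
      lemma₃ = ℤSolver.solve-∀
    quotient : + x ℤ.* y₁ ℤ.- κ ℤ.* (w ℤ.* + y) ≡ (+ x ℤ.* z ℤ.+ κ ℤ.* + y ℤ.* w ℤ.* m) ℤ.* + n
    quotient = begin
      + x ℤ.* y₁ ℤ.- κ ℤ.* (w ℤ.* + y)
        ≡⟨ lemma₄ (+ n) (+ x) (+ y) κ x̄ z w ⟩
      + x ℤ.* z ℤ.* + n ℤ.+ κ ℤ.* + y ℤ.* w ℤ.* (+ x ℤ.* x̄ ℤ.- + 1)
        ≡⟨ cong (λ s → + x ℤ.* z ℤ.* + n ℤ.+ κ ℤ.* + y ℤ.* w ℤ.* (s ℤ.- + 1)) xx̄ ⟩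
      + x ℤ.* z ℤ.* + n ℤ.+ κ ℤ.* + y ℤ.* w ℤ.* (+ 1 ℤ.+ m ℤ.* + n ℤ.- + 1)
        ≡⟨ lemma₅ (+ n) (+ x) (+ y) κ m z w ⟩
      (+ x ℤ.* z ℤ.+ κ ℤ.* + y ℤ.* w ℤ.* m) ℤ.* + n ∎
      where
      lemma₄ : ∀ n x y κ x̄ z w → x ℤ.* (n ℤ.* z ℤ.+ κ ℤ.* y ℤ.* x̄ ℤ.* w) ℤ.- κ ℤ.* (w ℤ.* y) ≡ x ℤ.* z ℤ.* n ℤ.+ κ ℤ.* y ℤ.* w ℤ.* (x ℤ.* x̄ ℤ.- + 1)
      lemma₄ = ℤSolver.solve-∀
      lemma₅ : ∀ n x y κ m z w → x ℤ.* z ℤ.* n ℤ.+ κ ℤ.* y ℤ.* w ℤ.* (+ 1 ℤ.+ m ℤ.* n ℤ.- + 1) ≡ (x ℤ.* z ℤ.+ κ ℤ.* y ℤ.* w ℤ.* m) ℤ.* n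
      lemma₅ = ℤSolver.solve-∀
  from-one : Represents n ∣ t ∣ c 1 → Conjugate n x y κ
  from-one (z , w , one) = sign (ℤₚ.+∣i∣≡i⊎+∣i∣≡-i t)
    where
    -- The reduction was run with the natural number ∣ t ∣; a negative t is absorbed by the sign of
    -- w.
    sign : + ∣ t ∣ ≡ t ⊎ + ∣ t ∣ ≡ ℤ.- t → Conjugate n x y κ
    sign (inj₁ q) = finish z w (trans (cong (λ b → form (+ n) b (+ c) z w) (sym q)) one)
    sign (inj₂ q) = finish z (ℤ.- w) (trans (lemma (+ n) t (+ c) z w) (trans (cong (λ b → form (+ n) b (+ c) z w) (sym q)) one))
      where
      lemma : ∀ n t c z w → n ℤ.* (z ℤ.* z) ℤ.+ + 2 ℤ.* (t ℤ.* (z ℤ.* ℤ.- w)) ℤ.+ c ℤ.* (ℤ.- w ℤ.* ℤ.- w)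
                            ≡ n ℤ.* (z ℤ.* z) ℤ.+ + 2 ℤ.* (ℤ.- t ℤ.* (z ℤ.* w)) ℤ.+ c ℤ.* (w ℤ.* w)
      lemma = ℤSolver.solve-∀

-- Representations of N by 30 x² + y²

-- The relation y′/x′ = ±κ y/x modulo n without denominators; both signs occur because the
-- coordinates are taken non-negative.
Congruent : ℕ → ℤ → ℕ → ℕ → ℕ → ℕ → Set
Congruent n κ x y x′ y′ = (+ n ∣ᶻ + x ℤ.* + y′ ℤ.- κ ℤ.* (+ x′ ℤ.* + y)) ⊎ (+ n ∣ᶻ + x ℤ.* + y′ ℤ.+ κ ℤ.* (+ x′ ℤ.* + y))

∣-neg : ∀ {n z} → + n ∣ᶻ z → + n ∣ᶻ ℤ.- z
∣-neg {n} {z} = ℤ∣.∣m⇒∣-m {+ n} {z}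

-- κ is its own inverse modulo n.
Congruent-sym : ∀ {n κ x y x′ y′} → + n ∣ᶻ κ ℤ.* κ ℤ.- + 1 → Congruent n κ x y x′ y′ → Congruent n κ x′ y′ x y
Congruent-sym {n} {κ} {x} {y} {x′} {y′} κ² (inj₁ p) = inj₁ (subst (+ n ∣ᶻ_) (lemma κ (+ x) (+ y) (+ x′) (+ y′))
  (ℤ∣.∣m∣n⇒∣m+n (ℤ∣.∣n⇒∣m*n (ℤ.- κ) p) (ℤ∣.∣n⇒∣m*n (ℤ.- (+ x′ ℤ.* + y)) κ²)))
  where
  lemma : ∀ κ x y x′ y′ → ℤ.- κ ℤ.* (x ℤ.* y′ ℤ.- κ ℤ.* (x′ ℤ.* y)) ℤ.+ ℤ.- (x′ ℤ.* y) ℤ.* (κ ℤ.* κ ℤ.- + 1) ≡ x′ ℤ.* y ℤ.- κ ℤ.* (x ℤ.* y′)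
  lemma = ℤSolver.solve-∀
Congruent-sym {n} {κ} {x} {y} {x′} {y′} κ² (inj₂ p) = inj₂ (subst (+ n ∣ᶻ_) (lemma κ (+ x) (+ y) (+ x′) (+ y′))
  (ℤ∣.∣m∣n⇒∣m+n (ℤ∣.∣n⇒∣m*n κ p) (ℤ∣.∣n⇒∣m*n (ℤ.- (+ x′ ℤ.* + y)) κ²)))
  where
  lemma : ∀ κ x y x′ y′ → κ ℤ.* (x ℤ.* y′ ℤ.+ κ ℤ.* (x′ ℤ.* y)) ℤ.+ ℤ.- (x′ ℤ.* y) ℤ.* (κ ℤ.* κ ℤ.- + 1) ≡ x′ ℤ.* y ℤ.+ κ ℤ.* (x ℤ.* y′)
  lemma = ℤSolver.solve-∀

-- n² = (30 x u + y v)² + 30 (x v - u y)² leaves no room for a nonzero multiple of n.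
congruent⇒equal : ∀ n x y u v → 0 < n → + 30 ℤ.* (x ℤ.* x) ℤ.+ y ℤ.* y ≡ + n → + 30 ℤ.* (u ℤ.* u) ℤ.+ v ℤ.* v ≡ + n →
                  + n ∣ᶻ x ℤ.* v ℤ.- u ℤ.* y → x ℤ.* x ≡ u ℤ.* u
congruent⇒equal n@(suc _) x y u v 0<n p p′ (dividesᶻ m z≡) = by-quotient ∣ m ∣ refl
  where
  open ≡-Reasoning
  A z : ℤ
  A = + 30 ℤ.* (x ℤ.* u) ℤ.+ y ℤ.* v
  z = x ℤ.* v ℤ.- u ℤ.* y
  n²ᶻ : + n ℤ.* + n ≡ A ℤ.* A ℤ.+ + 30 ℤ.* (z ℤ.* z)
  n²ᶻ = trans (sym (cong₂ ℤ._*_ p p′)) (lemma x y u v)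
    where
    lemma : ∀ x y u v → (+ 30 ℤ.* (x ℤ.* x) ℤ.+ y ℤ.* y) ℤ.* (+ 30 ℤ.* (u ℤ.* u) ℤ.+ v ℤ.* v)
                        ≡ (+ 30 ℤ.* (x ℤ.* u) ℤ.+ y ℤ.* v) ℤ.* (+ 30 ℤ.* (x ℤ.* u) ℤ.+ y ℤ.* v) ℤ.+ + 30 ℤ.* ((x ℤ.* v ℤ.- u ℤ.* y) ℤ.* (x ℤ.* v ℤ.- u ℤ.* y))
    lemma = ℤSolver.solve-∀
  n² : n * n ≡ ∣ A ∣ * ∣ A ∣ + 30 * (∣ z ∣ * ∣ z ∣)
  n² = ℤₚ.+-injective (trans (ℤₚ.pos-* n n) (trans n²ᶻ (cong₂ ℤ._+_ (square-abs A)
    (trans (cong (λ t → + 30 ℤ.* t) (square-abs z)) (sym (ℤₚ.pos-* 30 (∣ z ∣ * ∣ z ∣)))))))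
  ∣z∣ : ∣ z ∣ ≡ ∣ m ∣ * n
  ∣z∣ = trans (cong ∣_∣ z≡) (ℤₚ.abs-* m (+ n))
  by-quotient : ∀ k → ∣ m ∣ ≡ k → x ℤ.* x ≡ u ℤ.* u
  by-quotient (suc k) m≡ = contradiction n² (ℕₚ.<⇒≢ (ℕₚ.<-≤-trans
    (ℕₚ.m<m+n (n * n) {29 * (n * n)} (s≤s z≤n))
    (ℕₚ.≤-trans (ℕₚ.*-monoʳ-≤ 30 (ℕₚ.*-mono-≤ n≤∣z∣ n≤∣z∣)) (ℕₚ.m≤n+m (30 * (∣ z ∣ * ∣ z ∣)) (∣ A ∣ * ∣ A ∣)))))
    where
    n≤∣z∣ : n ≤ ∣ z ∣
    n≤∣z∣ = subst (n ≤_) (sym (trans ∣z∣ (cong (_* n) m≡))) (ℕₚ.m≤m+n n (k * n))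
  by-quotient zero m≡ = ℤₚ.*-cancelʳ-≡ (x ℤ.* x) (u ℤ.* u) (+ n) (begin
    x ℤ.* x ℤ.* + n                                                      ≡⟨ cong (λ t → x ℤ.* x ℤ.* t) (sym p′) ⟩
    x ℤ.* x ℤ.* (+ 30 ℤ.* (u ℤ.* u) ℤ.+ v ℤ.* v)                         ≡⟨ lemma₁ x u v ⟩
    + 30 ℤ.* (x ℤ.* x ℤ.* (u ℤ.* u)) ℤ.+ (x ℤ.* v) ℤ.* (x ℤ.* v)         ≡⟨ cong (λ t → + 30 ℤ.* (x ℤ.* x ℤ.* (u ℤ.* u)) ℤ.+ t ℤ.* t) (ℤₚ.i-j≡0⇒i≡j (x ℤ.* v) (u ℤ.* y) z≡0) ⟩
    + 30 ℤ.* (x ℤ.* x ℤ.* (u ℤ.* u)) ℤ.+ (u ℤ.* y) ℤ.* (u ℤ.* y)         ≡⟨ lemma₂ x y u ⟩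
    u ℤ.* u ℤ.* (+ 30 ℤ.* (x ℤ.* x) ℤ.+ y ℤ.* y)                         ≡⟨ cong (λ t → u ℤ.* u ℤ.* t) p ⟩
    u ℤ.* u ℤ.* + n                                                      ∎)
    where
    z≡0 : z ≡ + 0
    z≡0 = ℤₚ.∣i∣≡0⇒i≡0 (trans ∣z∣ (cong (_* n) m≡))
    lemma₁ : ∀ x u v → x ℤ.* x ℤ.* (+ 30 ℤ.* (u ℤ.* u) ℤ.+ v ℤ.* v) ≡ + 30 ℤ.* (x ℤ.* x ℤ.* (u ℤ.* u)) ℤ.+ (x ℤ.* v) ℤ.* (x ℤ.* v)
    lemma₁ = ℤSolver.solve-∀
    lemma₂ : ∀ x y u → + 30 ℤ.* (x ℤ.* x ℤ.* (u ℤ.* u)) ℤ.+ (u ℤ.* y) ℤ.* (u ℤ.* y) ≡ u ℤ.* u ℤ.* (+ 30 ℤ.* (x ℤ.* x) ℤ.+ y ℤ.* y)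
    lemma₂ = ℤSolver.solve-∀

pos-norm : ∀ {n} x y → n ≡ 30 * (x * x) + y * y → + 30 ℤ.* (+ x ℤ.* + x) ℤ.+ + y ℤ.* + y ≡ + n
pos-norm x y refl = sym (cong₂ ℤ._+_ (trans (ℤₚ.pos-* 30 (x * x)) (cong (λ t → + 30 ℤ.* t) (ℤₚ.pos-* x x))) (ℤₚ.pos-* y y))

neg-norm : ∀ {n} x y → n ≡ 30 * (x * x) + y * y → + 30 ℤ.* (+ x ℤ.* + x) ℤ.+ ℤ.- + y ℤ.* ℤ.- + y ≡ + n
neg-norm x y p = trans (lemma (+ x) (+ y)) (pos-norm x y p)
  where
  lemma : ∀ x y → + 30 ℤ.* (x ℤ.* x) ℤ.+ ℤ.- y ℤ.* ℤ.- y ≡ + 30 ℤ.* (x ℤ.* x) ℤ.+ y ℤ.* y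
  lemma = ℤSolver.solve-∀

-- Eliminating y from the two congruences leaves n dividing x (u′ v - u v′), or x (u′ v + u v′) if
-- their signs differ. After cancelling x this is the situation of `congruent⇒equal`, in the second
-- case with v′ negated.
Congruent-functional : ∀ {n x y u v u′ v′} κ → Coprime n x → 0 < n → n ≡ 30 * (u * u) + v * v → n ≡ 30 * (u′ * u′) + v′ * v′ →
                       Congruent n κ x y u v → Congruent n κ x y u′ v′ → u * u ≡ u′ * u′
Congruent-functional {n} {x} {y} {u} {v} {u′} {v′} κ cop 0<n p p′ c c′ = ℤₚ.+-injective (trans (ℤₚ.pos-* u u) (trans (sym (by-cases c c′)) (sym (ℤₚ.pos-* u′ u′))))
  where
  same : + n ∣ᶻ + x ℤ.* (+ u′ ℤ.* + v ℤ.- + u ℤ.* + v′) → + u′ ℤ.* + u′ ≡ + u ℤ.* + u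
  same d = congruent⇒equal n (+ u′) (+ v′) (+ u) (+ v) 0<n (pos-norm u′ v′ p′) (pos-norm u v p) (coprime-cancel {n} {x} cop d)
  opposite : + n ∣ᶻ + x ℤ.* (+ u′ ℤ.* + v ℤ.+ + u ℤ.* + v′) → + u′ ℤ.* + u′ ≡ + u ℤ.* + u
  opposite d = congruent⇒equal n (+ u′) (ℤ.- + v′) (+ u) (+ v) 0<n (neg-norm u′ v′ p′) (pos-norm u v p)
    (subst (+ n ∣ᶻ_) (lemma (+ u) (+ v) (+ u′) (+ v′)) (coprime-cancel {n} {x} cop d))
    where
    lemma : ∀ u v u′ v′ → u′ ℤ.* v ℤ.+ u ℤ.* v′ ≡ u′ ℤ.* v ℤ.- u ℤ.* ℤ.- v′
    lemma = ℤSolver.solve-∀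
  by-cases : Congruent n κ x y u v → Congruent n κ x y u′ v′ → + u′ ℤ.* + u′ ≡ + u ℤ.* + u
  by-cases (inj₁ a) (inj₁ b) = same (subst (+ n ∣ᶻ_) (lemma κ (+ x) (+ y) (+ u) (+ v) (+ u′) (+ v′)) (ℤ∣.∣m∣n⇒∣m-n (ℤ∣.∣n⇒∣m*n (+ u′) a) (ℤ∣.∣n⇒∣m*n (+ u) b)))
    where
    lemma : ∀ κ x y u v u′ v′ → u′ ℤ.* (x ℤ.* v ℤ.- κ ℤ.* (u ℤ.* y)) ℤ.- u ℤ.* (x ℤ.* v′ ℤ.- κ ℤ.* (u′ ℤ.* y)) ≡ x ℤ.* (u′ ℤ.* v ℤ.- u ℤ.* v′)
    lemma = ℤSolver.solve-∀
  by-cases (inj₂ a) (inj₂ b) = same (subst (+ n ∣ᶻ_) (lemma κ (+ x) (+ y) (+ u) (+ v) (+ u′) (+ v′)) (ℤ∣.∣m∣n⇒∣m-n (ℤ∣.∣n⇒∣m*n (+ u′) a) (ℤ∣.∣n⇒∣m*n (+ u) b)))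
    where
    lemma : ∀ κ x y u v u′ v′ → u′ ℤ.* (x ℤ.* v ℤ.+ κ ℤ.* (u ℤ.* y)) ℤ.- u ℤ.* (x ℤ.* v′ ℤ.+ κ ℤ.* (u′ ℤ.* y)) ≡ x ℤ.* (u′ ℤ.* v ℤ.- u ℤ.* v′)
    lemma = ℤSolver.solve-∀
  by-cases (inj₁ a) (inj₂ b) = opposite (subst (+ n ∣ᶻ_) (lemma κ (+ x) (+ y) (+ u) (+ v) (+ u′) (+ v′)) (ℤ∣.∣m∣n⇒∣m+n (ℤ∣.∣n⇒∣m*n (+ u′) a) (ℤ∣.∣n⇒∣m*n (+ u) b)))
    where
    lemma : ∀ κ x y u v u′ v′ → u′ ℤ.* (x ℤ.* v ℤ.- κ ℤ.* (u ℤ.* y)) ℤ.+ u ℤ.* (x ℤ.* v′ ℤ.+ κ ℤ.* (u′ ℤ.* y)) ≡ x ℤ.* (u′ ℤ.* v ℤ.+ u ℤ.* v′)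
    lemma = ℤSolver.solve-∀
  by-cases (inj₂ a) (inj₁ b) = opposite (subst (+ n ∣ᶻ_) (lemma κ (+ x) (+ y) (+ u) (+ v) (+ u′) (+ v′)) (ℤ∣.∣m∣n⇒∣m+n (ℤ∣.∣n⇒∣m*n (+ u′) a) (ℤ∣.∣n⇒∣m*n (+ u) b)))
    where
    lemma : ∀ κ x y u v u′ v′ → u′ ℤ.* (x ℤ.* v ℤ.+ κ ℤ.* (u ℤ.* y)) ℤ.+ u ℤ.* (x ℤ.* v′ ℤ.- κ ℤ.* (u′ ℤ.* y)) ≡ x ℤ.* (u′ ℤ.* v ℤ.+ u ℤ.* v′)
    lemma = ℤSolver.solve-∀

-- x and y are units modulo n, so a fixed point would give κ = 1 or κ = -1.
Congruent-irreflexive : ∀ {n x y κ} → Coprime n x → Coprime n y → NontrivialRoot n κ → ¬ Congruent n κ x y x y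
Congruent-irreflexive {n} {x} {y} {κ} cx cy (_ , κ≢1 , κ≢-1) (inj₁ p) =
  κ≢1 (subst (+ n ∣ᶻ_) (lemma₂ κ) (∣-neg {n} {+ 1 ℤ.- κ} (coprime-cancel {n} {y} cy (coprime-cancel {n} {x} cx (subst (+ n ∣ᶻ_) (lemma₁ κ (+ x) (+ y)) p)))))
  where
  lemma₁ : ∀ κ x y → x ℤ.* y ℤ.- κ ℤ.* (x ℤ.* y) ≡ x ℤ.* (y ℤ.* (+ 1 ℤ.- κ))
  lemma₁ = ℤSolver.solve-∀
  lemma₂ : ∀ κ → ℤ.- (+ 1 ℤ.- κ) ≡ κ ℤ.- + 1
  lemma₂ = ℤSolver.solve-∀
Congruent-irreflexive {n} {x} {y} {κ} cx cy (_ , κ≢1 , κ≢-1) (inj₂ p) =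
  κ≢-1 (coprime-cancel {n} {y} cy (coprime-cancel {n} {x} cx (subst (+ n ∣ᶻ_) (lemma κ (+ x) (+ y)) p)))
  where
  lemma : ∀ κ x y → x ℤ.* y ℤ.+ κ ℤ.* (x ℤ.* y) ≡ x ℤ.* (y ℤ.* (κ ℤ.+ + 1))
  lemma = ℤSolver.solve-∀

Congruent-abs : ∀ {n κ x y} u v → + n ∣ᶻ + x ℤ.* v ℤ.- κ ℤ.* (u ℤ.* + y) → Congruent n κ x y ∣ u ∣ ∣ v ∣
Congruent-abs {n} {κ} {x} {y} u v p = by-signs (ℤₚ.+∣i∣≡i⊎+∣i∣≡-i u) (ℤₚ.+∣i∣≡i⊎+∣i∣≡-i v)
  where
  E⁻ E⁺ : ℤ → ℤ → ℤ
  E⁻ u v = + x ℤ.* v ℤ.- κ ℤ.* (u ℤ.* + y)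
  E⁺ u v = + x ℤ.* v ℤ.+ κ ℤ.* (u ℤ.* + y)
  by-signs : + ∣ u ∣ ≡ u ⊎ + ∣ u ∣ ≡ ℤ.- u → + ∣ v ∣ ≡ v ⊎ + ∣ v ∣ ≡ ℤ.- v → Congruent n κ x y ∣ u ∣ ∣ v ∣
  by-signs (inj₁ a) (inj₁ b) = inj₁ (subst (+ n ∣ᶻ_) (sym (cong₂ E⁻ a b)) p)
  by-signs (inj₂ a) (inj₂ b) = inj₁ (subst (+ n ∣ᶻ_) (sym (trans (cong₂ E⁻ a b) (lemma κ (+ x) (+ y) u v))) (∣-neg {n} p))
    where
    lemma : ∀ κ x y u v → x ℤ.* ℤ.- v ℤ.- κ ℤ.* (ℤ.- u ℤ.* y) ≡ ℤ.- (x ℤ.* v ℤ.- κ ℤ.* (u ℤ.* y))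
    lemma = ℤSolver.solve-∀
  by-signs (inj₂ a) (inj₁ b) = inj₂ (subst (+ n ∣ᶻ_) (sym (trans (cong₂ E⁺ a b) (lemma κ (+ x) (+ y) u v))) p)
    where
    lemma : ∀ κ x y u v → x ℤ.* v ℤ.+ κ ℤ.* (ℤ.- u ℤ.* y) ≡ x ℤ.* v ℤ.- κ ℤ.* (u ℤ.* y)
    lemma = ℤSolver.solve-∀
  by-signs (inj₁ a) (inj₂ b) = inj₂ (subst (+ n ∣ᶻ_) (sym (trans (cong₂ E⁺ a b) (lemma κ (+ x) (+ y) u v))) (∣-neg {n} p))
    where
    lemma : ∀ κ x y u v → x ℤ.* ℤ.- v ℤ.+ κ ℤ.* (u ℤ.* y) ≡ ℤ.- (x ℤ.* v ℤ.- κ ℤ.* (u ℤ.* y))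
    lemma = ℤSolver.solve-∀

-- Pairing the representations of one number

ν∈±1 : ℕ → Set
ν∈±1 ν = ν ≡ 1 ⊎ ν ≡ 4

-- 1 and 4 are the nonzero squares modulo 5, so N = g² n₀ passes this part of the principal genus on
-- to n₀.
quotient-by-square-mod5 : ∀ {a ρ} → a ≡ 0 ⊎ a ≡ 1 ⊎ a ≡ 4 → ρ < 5 → ν∈±1 ((a * ρ) % 5) → ν∈±1 ρ
quotient-by-square-mod5 {ρ = 1} _ _ _ = inj₁ refl
quotient-by-square-mod5 {ρ = 4} _ _ _ = inj₂ refl
quotient-by-square-mod5 {ρ = 0} (inj₁ refl)        _ (inj₁ ())
quotient-by-square-mod5 {ρ = 0} (inj₁ refl)        _ (inj₂ ())
quotient-by-square-mod5 {ρ = 0} (inj₂ (inj₁ refl)) _ (inj₁ ())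
quotient-by-square-mod5 {ρ = 0} (inj₂ (inj₁ refl)) _ (inj₂ ())
quotient-by-square-mod5 {ρ = 0} (inj₂ (inj₂ refl)) _ (inj₁ ())
quotient-by-square-mod5 {ρ = 0} (inj₂ (inj₂ refl)) _ (inj₂ ())
quotient-by-square-mod5 {ρ = 2} (inj₁ refl)        _ (inj₁ ())
quotient-by-square-mod5 {ρ = 2} (inj₁ refl)        _ (inj₂ ())
quotient-by-square-mod5 {ρ = 2} (inj₂ (inj₁ refl)) _ (inj₁ ())
quotient-by-square-mod5 {ρ = 2} (inj₂ (inj₁ refl)) _ (inj₂ ())
quotient-by-square-mod5 {ρ = 2} (inj₂ (inj₂ refl)) _ (inj₁ ())
quotient-by-square-mod5 {ρ = 2} (inj₂ (inj₂ refl)) _ (inj₂ ())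
quotient-by-square-mod5 {ρ = 3} (inj₁ refl)        _ (inj₁ ())
quotient-by-square-mod5 {ρ = 3} (inj₁ refl)        _ (inj₂ ())
quotient-by-square-mod5 {ρ = 3} (inj₂ (inj₁ refl)) _ (inj₁ ())
quotient-by-square-mod5 {ρ = 3} (inj₂ (inj₁ refl)) _ (inj₂ ())
quotient-by-square-mod5 {ρ = 3} (inj₂ (inj₂ refl)) _ (inj₁ ())
quotient-by-square-mod5 {ρ = 3} (inj₂ (inj₂ refl)) _ (inj₂ ())
quotient-by-square-mod5 {ρ = suc (suc (suc (suc (suc ρ))))} _ (s≤s (s≤s (s≤s (s≤s (s≤s ()))))) _

coprime-square : ∀ {d x} → Coprime d x → d ∣ⁿ x * x → d ∣ⁿ x
coprime-square c p = coprime-divisor c p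

PrimeTimesSquare : ℕ → Set
PrimeTimesSquare N = ∃[ p ] ∃[ s ] (Prime p × N ≡ p * (s * s))

module Representations (c n : ℕ) (c≤2 : c ≤ 2) (coprime-30 : Coprime (31 + c * 24) 30) (residue-5 : ν∈±1 ((31 + c * 24) % 5)) where

  N : ℕ
  N = 31 + c * 24 + 120 * n

  private
    N-mod8 : N ≡ 7 + (3 + c * 3 + 15 * n) * 8
    N-mod8 = lemma c n
      where
      lemma : ∀ c n → 31 + c * 24 + 120 * n ≡ 7 + (3 + c * 3 + 15 * n) * 8
      lemma = solve-∀

    N-odd : odd N ≡ true
    N-odd = trans (cong odd N-mod8) (cong (λ b → not (not (not (not (not (not (not b))))))) (trans (odd-* (3 + c * 3 + 15 * n) 8) (Boolₚ.∧-zeroʳ _)))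

    N-mod3 : N % 3 ≡ 1
    N-mod3 = trans (cong (_% 3) (lemma c n)) ([m+kn]%n≡m%n 1 (10 + c * 8 + 40 * n) 3)
      where
      lemma : ∀ c n → 31 + c * 24 + 120 * n ≡ 1 + (10 + c * 8 + 40 * n) * 3
      lemma = solve-∀

    N-mod5 : N % 5 ≡ (31 + c * 24) % 5
    N-mod5 = trans (cong (_% 5) (lemma (31 + c * 24) n)) ([m+kn]%n≡m%n (31 + c * 24) (24 * n) 5)
      where
      lemma : ∀ a n → a + 120 * n ≡ a + 24 * n * 5
      lemma = solve-∀

    N-not-square : ∀ r → N ≢ r * r
    N-not-square r p = absurd (odd-square-mod8 r (trans (sym (odd-square r)) (trans (cong odd (sym p)) N-odd)))
      where
      absurd : ∃[ t ] r * r ≡ 1 + t * 8 → ⊥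
      absurd (t , r²) = contradiction (trans (sym ([m+kn]%n≡m%n 7 (3 + c * 3 + 15 * n) 8))
        (trans (cong (_% 8) (trans (sym N-mod8) (trans p r²))) ([m+kn]%n≡m%n 1 t 8))) λ ()

    coprime-N-30 : Coprime N 30
    coprime-N-30 {d} (d∣N , d∣30) = coprime-30 (∣m+n∣m⇒∣n (subst (d ∣ⁿ_) (ℕₚ.+-comm (31 + c * 24) (120 * n)) d∣N) (∣-trans d∣30 (divides (4 * n) (lemma n))) , d∣30)
      where
      lemma : ∀ n → 120 * n ≡ 4 * n * 30
      lemma = solve-∀

    -- The pair (g x, g y) counted at j with its greatest common divisor g taken out; the coprime
    -- pair represents n₀ = N / g².
    record Rep (j : ℕ) : Set where
      constructor rep
      field
        g x y   : ℕ
        n₀      : ℕ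
        n₀≡     : n₀ ≡ 30 * (x * x) + y * y
        j≤n     : j ≤ n
        coprime : Coprime x y
        x-eq    : g * x * (g * x) ≡ 1 + 4 * (n ∸ j)
        y-eq    : g * y * (g * y) ≡ 1 + c * 24 + 120 * j

      norm : g * g * n₀ ≡ N
      norm = begin
        g * g * n₀                                              ≡⟨ cong (g * g *_) n₀≡ ⟩
        g * g * (30 * (x * x) + y * y)                          ≡⟨ lemma₁ g x y ⟩
        30 * (g * x * (g * x)) + g * y * (g * y)                ≡⟨ cong₂ (λ a b → 30 * a + b) x-eq y-eq ⟩
        30 * (1 + 4 * (n ∸ j)) + (1 + c * 24 + 120 * j)         ≡⟨ lemma₂ (n ∸ j) c j ⟩
        31 + c * 24 + 120 * ((n ∸ j) + j)                       ≡⟨ cong (λ m → 31 + c * 24 + 120 * m) (ℕₚ.m∸n+n≡m j≤n) ⟩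
        N                                                       ∎
        where
        open ≡-Reasoning
        lemma₁ : ∀ g x y → g * g * (30 * (x * x) + y * y) ≡ 30 * (g * x * (g * x)) + g * y * (g * y)
        lemma₁ = solve-∀
        lemma₂ : ∀ m c j → 30 * (1 + 4 * m) + (1 + c * 24 + 120 * j) ≡ 31 + c * 24 + 120 * (m + j)
        lemma₂ = solve-∀

      n₀-odd : odd n₀ ≡ true
      n₀-odd = proj₂ (∧-true {odd (g * g)} (trans (sym (odd-* (g * g) n₀)) (trans (cong odd norm) N-odd)))

      0<n₀ : 0 < n₀
      0<n₀ = ℕₚ.n≢0⇒n>0 λ n₀≡0 → contradiction (trans (sym (cong odd n₀≡0)) n₀-odd) λ ()

      g≢0 : NonZero g
      g≢0 = ℕ.≢-nonZero λ g≡0 → contradiction (trans (sym (cong (λ g → g * x * (g * x)) g≡0)) x-eq) λ ()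

      n₀∣N : n₀ ∣ⁿ N
      n₀∣N = divides (g * g) (sym norm)

      coprime-n₀-x : Coprime n₀ x
      coprime-n₀-x {d} (d∣n₀ , d∣x) = coprime (d∣x , coprime-square d⊥y (∣m+n∣m⇒∣n (subst (d ∣ⁿ_) n₀≡ d∣n₀) (∣n⇒∣m*n 30 (∣n⇒∣m*n x d∣x))))
        where
        d⊥y : Coprime d y
        d⊥y (e∣d , e∣y) = coprime (∣-trans e∣d d∣x , e∣y)

      coprime-n₀-y : Coprime n₀ y
      coprime-n₀-y {d} (d∣n₀ , d∣y) = coprime (coprime-square d⊥x (coprime-divisor d⊥30 (∣m+n∣m⇒∣n (subst (d ∣ⁿ_) (trans n₀≡ (ℕₚ.+-comm (30 * (x * x)) (y * y))) d∣n₀) (∣n⇒∣m*n y d∣y))) , d∣y)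
        where
        d⊥x : Coprime d x
        d⊥x (e∣d , e∣x) = coprime (e∣x , ∣-trans e∣d d∣y)
        d⊥30 : Coprime d 30
        d⊥30 (e∣d , e∣30) = coprime-N-30 (∣-trans e∣d (∣-trans d∣n₀ n₀∣N) , e∣30)

      n₀-principal : Principal n₀
      n₀-principal = mod3 (square-mod3 g) , quotient-by-square-mod5 {(g * g) % 5} {n₀ % 5} (square-residue₅ g) (m%n<n n₀ 5)
        (subst ν∈±1 product-mod5 residue-5)
        where
        product-mod5 : (31 + c * 24) % 5 ≡ ((g * g) % 5 * (n₀ % 5)) % 5
        product-mod5 = trans (sym N-mod5) (trans (cong (_% 5) (sym norm)) (%-distribˡ-* (g * g) n₀ 5))
        product-mod3 : ((g * g) % 3 * (n₀ % 3)) % 3 ≡ 1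
        product-mod3 = trans (sym (%-distribˡ-* (g * g) n₀ 3)) (trans (cong (_% 3) norm) N-mod3)
        mod3 : (g * g) % 3 ≡ 0 ⊎ (g * g) % 3 ≡ 1 → n₀ % 3 ≡ 1
        mod3 (inj₁ h) = contradiction (trans (sym (cong (λ a → (a * (n₀ % 3)) % 3) h)) product-mod3) λ ()
        mod3 (inj₂ h) = trans (sym (m%n%n≡m%n n₀ 3)) (trans (cong (_% 3) (sym (ℕₚ.*-identityˡ (n₀ % 3)))) (trans (cong (λ a → (a * (n₀ % 3)) % 3) (sym h)) product-mod3))
    open Rep

    -- j fixes g x and g y, and coprimality fixes g. Two pairs that mention the same j can thus be
    -- compared although each carries its own `Rep j`.
    rep-unique : ∀ {j} (r s : Rep j) → g r ≡ g s × x r ≡ x s × y r ≡ y s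
    rep-unique r s = g≡ , ℕₚ.*-cancelˡ-≡ (x r) (x s) (g r) {{g≢0 r}} (trans gx≡ (cong (_* x s) (sym g≡)))
                        , ℕₚ.*-cancelˡ-≡ (y r) (y s) (g r) {{g≢0 r}} (trans gy≡ (cong (_* y s) (sym g≡)))
      where
      gx≡ : g r * x r ≡ g s * x s
      gx≡ = square-injective (trans (x-eq r) (sym (x-eq s)))
      gy≡ : g r * y r ≡ g s * y s
      gy≡ = square-injective (trans (y-eq r) (sym (y-eq s)))
      g∣g : ∀ {g x y h u v} → Coprime u v → g * x ≡ h * u → g * y ≡ h * v → g ∣ⁿ h
      g∣g {g} {x} {y} {h} {u} {v} cop p q = coprime-factors cop
        ( divides x (trans (ℕₚ.*-comm u h) (trans (sym p) (ℕₚ.*-comm g x)))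
        , divides y (trans (ℕₚ.*-comm v h) (trans (sym q) (ℕₚ.*-comm g y))) )
      g≡ : g r ≡ g s
      g≡ = ∣-antisym (g∣g (coprime s) gx≡ gy≡) (g∣g (coprime r) (sym gx≡) (sym gy≡))

    n₀-determined : ∀ {j j′} (r : Rep j) (r′ : Rep j′) → g r ≡ g r′ → n₀ r ≡ n₀ r′
    n₀-determined r r′ g≡ = ℕₚ.*-cancelˡ-≡ (n₀ r) (n₀ r′) (g r * g r) {{ℕₚ.m*n≢0 (g r) (g r) {{g≢0 r}} {{g≢0 r}}}}
      (trans (norm r) (trans (sym (norm r′)) (cong (λ g → g * g * n₀ r′) (sym g≡))))

    Summand : ℕ → Bool
    Summand j = isSquare (1 + c * 24 + 120 * j) ∧ isSquare (1 + 4 * (n ∸ j))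

    representation : ∀ j → j ≤ n → Summand j ≡ true → Rep j
    representation j j≤n p with ∧-true {isSquare (1 + c * 24 + 120 * j)} p
    ... | sy , sx with isSquare-sound (1 + 4 * (n ∸ j)) sx | isSquare-sound (1 + c * 24 + 120 * j) sy
    ... | X , X² | Y , Y² with gcd X Y in gcd≡ | gcd[m,n]∣m X Y | gcd[m,n]∣n X Y
    ... | h | divides x X≡ | divides y Y≡ = rep h x y (30 * (x * x) + y * y) refl j≤n cop
      (trans (cong (λ t → t * t) (trans (ℕₚ.*-comm h x) (sym X≡))) (sym X²)) (trans (cong (λ t → t * t) (trans (ℕₚ.*-comm h y) (sym Y≡))) (sym Y²))
      where
      h≢0 : NonZero h
      h≢0 = ℕ.≢-nonZero λ h≡0 → contradiction (trans X² (cong (λ t → t * t) (trans X≡ (trans (cong (x *_) h≡0) (ℕₚ.*-zeroʳ x))))) λ ()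
      cop : Coprime x y
      cop {d} (d∣x , d∣y) = ∣1⇒≡1 (ℕ∣.*-cancelʳ-∣ h {{h≢0}} (subst₂ _∣ⁿ_ refl (trans gcd≡ (sym (ℕₚ.*-identityˡ h)))
        (gcd-greatest {X} {Y} (subst (d * h ∣ⁿ_) (sym X≡) (ℕ∣.*-monoˡ-∣ h d∣x)) (subst (d * h ∣ⁿ_) (sym Y≡) (ℕ∣.*-monoˡ-∣ h d∣y)))))

    -- Only representations with the same greatest common divisor are paired; they share n₀ and
    -- therefore κ.
    data _~_ (j j′ : ℕ) : Set where
      conjugates : (r : Rep j) (r′ : Rep j′) → g r ≡ g r′ → NontrivialRoot (n₀ r) κ[ n₀ r ] →
                   Congruent (n₀ r) κ[ n₀ r ] (x r) (y r) (x r′) (y r′) → j ~ j′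

    open Pairing _≟_

    matching : Matching _~_ Summand
    matching = record { symmetric = λ _ _ → symm ; functional = λ _ _ _ → func ; irreflexive = λ _ _ → irrefl }
      where
      symm : ∀ {j j′} → j ~ j′ → j′ ~ j
      symm (conjugates r r′ g≡ root cong-r) = conjugates r′ r (sym g≡)
        (subst (λ m → NontrivialRoot m κ[ m ]) same root)
        (subst (λ m → Congruent m κ[ m ] (x r′) (y r′) (x r) (y r)) same (Congruent-sym {n₀ r} {κ[ n₀ r ]} {x r} {y r} {x r′} {y r′} (proj₁ root) cong-r))
        where
        same : n₀ r ≡ n₀ r′
        same = n₀-determined r r′ g≡
      transport : ∀ {m x y m₂ x₂ y₂ u v} → m ≡ m₂ → x ≡ x₂ → y ≡ y₂ → Congruent m₂ κ[ m₂ ] x₂ y₂ u v → Congruent m κ[ m ] x y u v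
      transport refl refl refl p = p
      func : ∀ {j j₁ j₂} → j ~ j₁ → j ~ j₂ → j₁ ≡ j₂
      func {j} {j₁} {j₂} (conjugates r r₁ g≡₁ _ cong₁) (conjugates s r₂ g≡₂ _ cong₂′) = ℕₚ.∸-cancelˡ-≡ (j≤n r₁) (j≤n r₂) (ℕₚ.*-cancelˡ-≡ (n ∸ j₁) (n ∸ j₂) 4 (ℕₚ.suc-injective (begin
        1 + 4 * (n ∸ j₁)                 ≡⟨ sym (x-eq r₁) ⟩
        g r₁ * x r₁ * (g r₁ * x r₁)      ≡⟨ rearrange (g r₁) (x r₁) ⟩
        g r₁ * g r₁ * (x r₁ * x r₁)      ≡⟨ cong₂ (λ a b → a * a * b) (trans (sym g≡₁) (trans g≡ g≡₂)) x²≡ ⟩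
        g r₂ * g r₂ * (x r₂ * x r₂)      ≡⟨ sym (rearrange (g r₂) (x r₂)) ⟩
        g r₂ * x r₂ * (g r₂ * x r₂)      ≡⟨ x-eq r₂ ⟩
        1 + 4 * (n ∸ j₂)                 ∎)))
        where
        open ≡-Reasoning
        g≡ : g r ≡ g s
        g≡ = proj₁ (rep-unique r s)
        x≡ : x r ≡ x s
        x≡ = proj₁ (proj₂ (rep-unique r s))
        y≡ : y r ≡ y s
        y≡ = proj₂ (proj₂ (rep-unique r s))
        rearrange : ∀ g x → g * x * (g * x) ≡ g * g * (x * x)
        rearrange = solve-∀
        x²≡ : x r₁ * x r₁ ≡ x r₂ * x r₂
        x²≡ = Congruent-functional {n₀ r} {x r} {y r} {x r₁} {y r₁} {x r₂} {y r₂} κ[ n₀ r ] (coprime-n₀-x r) (0<n₀ r)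
          (trans (n₀-determined r r₁ g≡₁) (n₀≡ r₁)) (trans (n₀-determined r r₂ (trans g≡ g≡₂)) (n₀≡ r₂)) cong₁
          (transport {n₀ r} {x r} {y r} {n₀ s} {x s} {y s} {x r₂} {y r₂} (n₀-determined r s g≡) x≡ y≡ cong₂′)
      irrefl : ∀ {j j′} → j ~ j′ → j ≢ j′
      irrefl (conjugates r r′ _ root cong-r) refl = let _ , x≡ , y≡ = rep-unique r r′ in Congruent-irreflexive {n₀ r} {x r} {y r} {κ[ n₀ r ]} (coprime-n₀-x r) (coprime-n₀-y r) root
        (subst₂ (λ u v → Congruent (n₀ r) κ[ n₀ r ] (x r) (y r) u v) (sym x≡) (sym y≡) cong-r)

    -- An even exponent would make N a square, but N is 7 modulo 8; an odd one leaves a single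
    -- factor p outside a square.
    prime-power⇒exception : ∀ h p e → Prime p → N ≡ h * h * p ^ e → PrimeTimesSquare N
    prime-power⇒exception h p e pr N≡ with halve e
    ... | f , inj₁ refl = contradiction (trans N≡ (trans (cong (h * h *_) (sym (ℕₚ.^-*-assoc p f 2))) (lemma h (p ^ f)))) (N-not-square (h * p ^ f))
      where
      lemma : ∀ h u → h * h * (u * (u * 1)) ≡ h * u * (h * u)
      lemma = solve-∀
    ... | f , inj₂ refl = p , h * p ^ f , pr , trans N≡ (trans (cong (λ t → h * h * (p * t)) (sym (ℕₚ.^-*-assoc p f 2))) (lemma h p (p ^ f)))
      where
      lemma : ∀ h p u → h * h * (p * (u * (u * 1))) ≡ p * (h * u * (h * u))
      lemma = solve-∀

    -- Every solution is one of those counted: V is odd, and an even U would make N = 1 modulo 8. So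
    -- U² = 1 + 8 t, and j = n - 2 t.
    index : ∀ U V → 30 * (U * U) + V * V ≡ N → ∃[ j ] (j ≤ n × U * U ≡ 1 + 4 * (n ∸ j) × V * V ≡ 1 + c * 24 + 120 * j)
    index U V p = from-t (odd-square-mod8 U U-odd)
      where
      V-odd : odd V ≡ true
      V-odd = trans (sym (odd-square V)) (trans (sym (trans (odd-+ (30 * (U * U)) (V * V)) (cong (_xor odd (V * V)) (odd-* 30 (U * U))))) (trans (cong odd p) N-odd))
      U-odd : odd U ≡ true
      U-odd = by-parity (halve U)
        where
        by-parity : ∃[ i ] (U ≡ i * 2 ⊎ U ≡ 1 + i * 2) → odd U ≡ true
        by-parity (i , inj₂ U≡) = trans (cong odd U≡) (cong not (trans (odd-* i 2) (Boolₚ.∧-zeroʳ (odd i))))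
        by-parity (i , inj₁ U≡) = let s , V² = odd-square-mod8 V V-odd in contradiction (begin
          7                                            ≡⟨ sym ([m+kn]%n≡m%n 7 (3 + c * 3 + 15 * n) 8) ⟩
          (7 + (3 + c * 3 + 15 * n) * 8) % 8           ≡⟨ cong (_% 8) (trans (sym N-mod8) (sym p)) ⟩
          (30 * (U * U) + V * V) % 8                   ≡⟨ cong (_% 8) (cong₂ (λ u v → 30 * (u * u) + v) U≡ V²) ⟩
          (30 * (i * 2 * (i * 2)) + (1 + s * 8)) % 8   ≡⟨ cong (_% 8) (lemma i s) ⟩
          (1 + (15 * (i * i) + s) * 8) % 8             ≡⟨ [m+kn]%n≡m%n 1 (15 * (i * i) + s) 8 ⟩
          1                                            ∎) λ ()
          where
          open ≡-Reasoning
          lemma : ∀ i s → 30 * (i * 2 * (i * 2)) + (1 + s * 8) ≡ 1 + (15 * (i * i) + s) * 8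
          lemma = solve-∀
      from-t : ∃[ t ] U * U ≡ 1 + t * 8 → ∃[ j ] (j ≤ n × U * U ≡ 1 + 4 * (n ∸ j) × V * V ≡ 1 + c * 24 + 120 * j)
      from-t (t , U²) = n ∸ 2 * t , ℕₚ.m∸n≤m n (2 * t)
        , trans U² (trans (lemma₁ t) (cong (λ m → 1 + 4 * m) (sym (ℕₚ.m∸[m∸n]≡n 2t≤n)))) , V²
        where
        lemma₁ : ∀ t → 1 + t * 8 ≡ 1 + 4 * (2 * t)
        lemma₁ = solve-∀
        total : 240 * t + V * V ≡ 1 + c * 24 + 120 * n
        total = ℕₚ.+-cancelˡ-≡ 30 _ _ (trans (trans (lemma₂ t (V * V)) (cong (λ u → 30 * u + V * V) (sym U²))) p)
          where
          lemma₂ : ∀ t v → 30 + (240 * t + v) ≡ 30 * (1 + t * 8) + v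
          lemma₂ = solve-∀
        -- Here c ≤ 2 enters: 240 t ≤ 1 + 24 c + 120 n < 120 (n + 1).
        2t≤n : 2 * t ≤ n
        2t≤n with 2 * t ≤? n
        ... | yes h = h
        ... | no ¬h = contradiction (begin
          120 + 120 * n            ≡⟨ sym (ℕₚ.*-suc 120 n) ⟩
          120 * suc n              ≤⟨ ℕₚ.*-monoʳ-≤ 120 (ℕₚ.≰⇒> ¬h) ⟩
          120 * (2 * t)            ≡⟨ sym (ℕₚ.*-assoc 120 2 t) ⟩
          240 * t                  ≤⟨ ℕₚ.m≤m+n (240 * t) (V * V) ⟩
          240 * t + V * V          ≡⟨ total ⟩
          1 + c * 24 + 120 * n     ≤⟨ ℕₚ.+-monoˡ-≤ (120 * n) (s≤s (ℕₚ.*-monoˡ-≤ 24 c≤2)) ⟩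
          49 + 120 * n             ∎) (ℕₚ.<⇒≱ (ℕₚ.+-monoˡ-< (120 * n) (ℕₚ.m≤m+n 50 70)))
          where open ℕₚ.≤-Reasoning
        V² : V * V ≡ 1 + c * 24 + 120 * (n ∸ 2 * t)
        V² = ℕₚ.+-cancelˡ-≡ (240 * t) _ _ (trans total (trans (cong (λ m → 1 + c * 24 + 120 * m) (sym (ℕₚ.m+[n∸m]≡n 2t≤n))) (lemma₃ t (c * 24) (n ∸ 2 * t))))
          where
          lemma₃ : ∀ t a j → 1 + a + 120 * (2 * t + j) ≡ 240 * t + (1 + a + 120 * j)
          lemma₃ = solve-∀

    partner : ∀ j → j ∈ upTo (suc n) → Summand j ≡ true → PrimeTimesSquare N ⊎ ∃[ j′ ] (j′ ∈ upTo (suc n) × Summand j′ ≡ true × j ~ j′)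
    partner j j∈ p = from-spec (κ-spec (n₀ r) (n₀-odd r))
      where
      r : Rep j
      r = representation j (ℕₚ.≤-pred (∈-upTo⁻ j∈)) p
      Partner : Set
      Partner = ∃[ j′ ] (j′ ∈ upTo (suc n) × Summand j′ ≡ true × j ~ j′)
      from-conjugate : NontrivialRoot (n₀ r) κ[ n₀ r ] → Conjugate (n₀ r) (x r) (y r) κ[ n₀ r ] → Partner
      from-conjugate root k = from-index (index (g r * u) (g r * v) norm′)
        where
        open Conjugate k renaming (norm to norm₁; coprime to coprime₁)
        u v : ℕ
        u = ∣ x₁ ∣
        v = ∣ y₁ ∣
        norm-uv : 30 * (u * u) + v * v ≡ n₀ r
        norm-uv = ℤₚ.+-injective (trans (cong₂ ℤ._+_ (trans (ℤₚ.pos-* 30 (u * u)) (cong (λ t → + 30 ℤ.* t) (sym (square-abs x₁)))) (sym (square-abs y₁))) norm₁)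
        norm′ : 30 * (g r * u * (g r * u)) + g r * v * (g r * v) ≡ N
        norm′ = trans (lemma (g r) u v) (trans (cong (g r * g r *_) norm-uv) (norm r))
          where
          lemma : ∀ g x y → 30 * (g * x * (g * x)) + g * y * (g * y) ≡ g * g * (30 * (x * x) + y * y)
          lemma = solve-∀
        from-index : ∃[ j′ ] (j′ ≤ n × g r * u * (g r * u) ≡ 1 + 4 * (n ∸ j′) × g r * v * (g r * v) ≡ 1 + c * 24 + 120 * j′) → Partner
        from-index (j′ , j′≤n , U² , V²) = j′ , ∈-upTo⁺ (s≤s j′≤n)
          , cong₂ _∧_ (subst (λ w → isSquare w ≡ true) V² (isSquare-complete (g r * v))) (subst (λ w → isSquare w ≡ true) U² (isSquare-complete (g r * u)))
          , conjugates r (rep (g r) u v (n₀ r) (sym norm-uv) j′≤n coprime₁ U² V²) refl root (Congruent-abs {n₀ r} {κ[ n₀ r ]} {x r} {y r} x₁ y₁ congruent)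
      from-spec : PrimePower (n₀ r) ⊎ NontrivialRoot (n₀ r) κ[ n₀ r ] → PrimeTimesSquare N ⊎ Partner
      from-spec (inj₁ (p , e , pr , n₀≡pᵉ)) = inj₁ (prime-power⇒exception (g r) p e pr (trans (sym (norm r)) (cong (g r * g r *_) n₀≡pᵉ)))
      from-spec (inj₂ root) = inj₂ (from-conjugate root
        (conjugate (n₀ r) (x r) (y r) κ[ n₀ r ] (n₀≡ r) (Coprimality.sym (coprime-n₀-x r)) (proj₁ root) (n₀-principal r)))

  odd-representations⇒prime-times-square : representations c n ≡ true → PrimeTimesSquare N
  odd-representations⇒prime-times-square h = outcome (perfect-matching⇒even matching (upTo (suc n)) (Unique.upTo⁺ (suc n)) partner)
    where
    outcome : PrimeTimesSquare N ⊎ ⨁ Summand (upTo (suc n)) ≡ false → PrimeTimesSquare N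
    outcome (inj₁ e)    = e
    outcome (inj₂ even) = contradiction (trans (sym even) h) λ ()

-- Comparing counting functions

[_] : Bool → ℕ
[ b ] = if b then 1 else 0

count-mono : ∀ {f g} x → (∀ n → n < x → f n ≡ true → g n ≡ true) → count f x ≤ count g x
count-mono zero h = z≤n
count-mono {f} {g} (suc x) h = ℕₚ.+-mono-≤ (step (h x ℕₚ.≤-refl)) (count-mono x (λ n n<x → h n (ℕₚ.m≤n⇒m≤1+n n<x)))
  where
  step : ∀ {a b} → (a ≡ true → b ≡ true) → [ a ] ≤ [ b ]
  step {false} p = z≤n
  step {true} {b} p rewrite p refl = ℕₚ.≤-refl

count-∨ : ∀ f g x → count (λ n → f n ∨ g n) x ≤ count f x + count g x
count-∨ f g zero    = z≤n
count-∨ f g (suc x) = ℕₚ.≤-trans (ℕₚ.+-mono-≤ (step (f x) (g x)) (count-∨ f g x)) (ℕₚ.≤-reflexive (lemma [ f x ] [ g x ] (count f x) (count g x)))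
  where
  step : ∀ a b → [ a ∨ b ] ≤ [ a ] + [ b ]
  step true  b = ℕₚ.m≤m+n 1 [ b ]
  step false b = ℕₚ.≤-refl
  lemma : ∀ a b c d → a + b + (c + d) ≡ a + c + (b + d)
  lemma = solve-∀

count≤ : ∀ f x → count f x ≤ x
count≤ f zero    = z≤n
count≤ f (suc x) = ℕₚ.+-mono-≤ (step (f x)) (count≤ f x)
  where
  step : ∀ b → [ b ] ≤ 1
  step true  = ℕₚ.≤-refl
  step false = z≤n

module ℕ-Pairing = Pairing _≟_

count-without : ∀ {g y} x → y < x → g y ≡ true → count g x ≡ suc (count (g ℕ-Pairing.without y) x)
count-without {g} {y} (suc x) y<sx gy with y ≟ x
... | yes refl = cong₂ _+_ (cong [_] gy) (sym (trans (cong (_+ count (g ℕ-Pairing.without y) x) (cong [_] off)) (unchanged x ℕₚ.≤-refl)))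
  where
  off : (g ℕ-Pairing.without y) y ≡ false
  off = trans (cong (λ b → g y ∧ not b) (dec-true (y ≟ y) refl)) (Boolₚ.∧-zeroʳ (g y))
  unchanged : ∀ z → z ≤ y → count (g ℕ-Pairing.without y) z ≡ count g z
  unchanged zero    _   = refl
  unchanged (suc z) z<y = cong₂ _+_ (cong [_] (ℕ-Pairing.without-≢ {g} (ℕₚ.<⇒≢ z<y))) (unchanged z (ℕₚ.<⇒≤ z<y))
... | no y≢x = trans (cong₂ _+_ (cong [_] (sym (ℕ-Pairing.without-≢ {g} {x} {y} (λ p → y≢x (sym p))))) (count-without {g} x (ℕₚ.≤∧≢⇒< (ℕₚ.≤-pred y<sx) y≢x) gy)) (ℕₚ.+-suc _ _)

count-injection : ∀ {f} g x y (φ : ℕ → ℕ) → (∀ n → n < x → f n ≡ true → φ n < y × g (φ n) ≡ true) →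
                  (∀ m n → m < x → n < x → f m ≡ true → f n ≡ true → φ m ≡ φ n → m ≡ n) → count f x ≤ count g y
count-injection g zero y φ into inj = z≤n
count-injection {f} g (suc x) y φ into inj with f x in fx
... | false = count-injection {f} g x y φ (λ n n<x → into n (ℕₚ.m≤n⇒m≤1+n n<x)) (λ m n m<x n<x → inj m n (ℕₚ.m≤n⇒m≤1+n m<x) (ℕₚ.m≤n⇒m≤1+n n<x))
... | true with into x ℕₚ.≤-refl fx
...   | φx<y , gφx = subst (suc (count f x) ≤_) (sym (count-without {g} y φx<y gφx)) (s≤s
  (count-injection {f} (g ℕ-Pairing.without φ x) x y φ into′ (λ m n m<x n<x → inj m n (ℕₚ.m≤n⇒m≤1+n m<x) (ℕₚ.m≤n⇒m≤1+n n<x))))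
  where
  into′ : ∀ n → n < x → f n ≡ true → φ n < y × (g ℕ-Pairing.without φ x) (φ n) ≡ true
  into′ n n<x fn = let φn<y , gφn = into n (ℕₚ.m≤n⇒m≤1+n n<x) fn in
    φn<y , trans (ℕ-Pairing.without-≢ {g} λ φn≡φx → ℕₚ.<⇒≢ n<x (inj n x (ℕₚ.m≤n⇒m≤1+n n<x) ℕₚ.≤-refl fn fx φn≡φx)) gφn

-- Chebyshev's upper bound for the number of primes

isPrime : ℕ → Bool
isPrime n = does (prime? n)

-- Counts the primes strictly below its argument; the primes up to n are therefore counted by π (suc
-- n).
π : ℕ → ℕ
π = count isPrime

binomial≤2^ : ∀ n k → n choose k ≤ 2 ^ n
binomial≤2^ zero    (suc k) = subst (_≤ 1) (sym (k>n⇒nCk≡0 {0} {suc k} (s≤s z≤n))) z≤n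
binomial≤2^ n       zero    = subst (_≤ 2 ^ n) (sym (trans (nCk≡nC[n∸k] {0} {n} z≤n) (nCn≡1 n))) (ℕₚ.m^n>0 2 n)
binomial≤2^ (suc n) (suc k) = subst (_≤ 2 ^ suc n) (nCk+nC[k+1]≡[n+1]C[k+1] n k)
  (ℕₚ.≤-trans (ℕₚ.+-mono-≤ (binomial≤2^ n k) (binomial≤2^ n (suc k))) (ℕₚ.≤-reflexive (cong (λ t → 2 ^ n + t) (sym (ℕₚ.+-identityʳ (2 ^ n))))))

central-binomial : ∀ n → ((n + n) choose n) * (n ! * n !) ≡ (n + n) !
central-binomial n = trans
  (cong (λ c → c * (n ! * n !)) (trans (nCk≡n!/k![n-k]! {n + n} {n} (ℕₚ.m≤m+n n n))
    (/-congʳ {{n ℕₚ.!* (n + n ∸ n) !≢0}} {{n ℕₚ.!* n !≢0}} (cong (λ m → n ! * m !) (ℕₚ.m+n∸n≡m n n)))))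
  (m/n*n≡m {{n ℕₚ.!* n !≢0}} (subst (λ m → n ! * m ! ∣ⁿ (n + n) !) (ℕₚ.m+n∸n≡m n n) (k![n∸k]!∣n! {n + n} {n} (ℕₚ.m≤m+n n n))))

prime∤! : ∀ {p} → Prime p → ∀ n → n < p → ¬ p ∣ⁿ n !
prime∤! pr zero    n<p p∣ = ℕ.nonTrivial⇒≢1 {{prime⇒nonTrivial pr}} (∣1⇒≡1 p∣)
prime∤! pr (suc n) n<p p∣ with euclidsLemma (suc n) (n !) pr p∣
... | inj₁ h = ℕₚ.<⇒≱ n<p (ℕ∣.∣⇒≤ h)
... | inj₂ h = prime∤! pr n (ℕₚ.<⇒≤ n<p) h

prime∣! : ∀ {p} → Prime p → ∀ n → p ≤ n → p ∣ⁿ n !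
prime∣! {p} pr n p≤n = ∣-trans (p∣p! p {{prime⇒nonZero pr}}) (m≤n⇒m!∣n! p≤n)
  where
  p∣p! : ∀ p .{{_ : NonZero p}} → p ∣ⁿ p !
  p∣p! (suc p) = divides (p !) (ℕₚ.*-comm (suc p) (p !))

prime∣central : ∀ {p} n → Prime p → n < p → p ≤ n + n → p ∣ⁿ (n + n) choose n
prime∣central {p} n pr n<p p≤2n with euclidsLemma ((n + n) choose n) (n ! * n !) pr (subst (p ∣ⁿ_) (sym (central-binomial n)) (prime∣! pr (n + n) p≤2n))
... | inj₁ h = h
... | inj₂ h with euclidsLemma (n !) (n !) pr h
...   | inj₁ h′ = ⊥-elim (prime∤! pr n n<p h′)
...   | inj₂ h′ = ⊥-elim (prime∤! pr n n<p h′)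

-- The product of the primes p with n < p ≤ n + k.
primes-above : ℕ → ℕ → ℕ
primes-above n zero    = 1
primes-above n (suc k) = (if isPrime (suc n + k) then suc n + k else 1) * primes-above n k

prime∤primes-above : ∀ {p} n k → Prime p → n + k < p → ¬ p ∣ⁿ primes-above n k
prime∤primes-above n zero    pr h p∣ = ℕ.nonTrivial⇒≢1 {{prime⇒nonTrivial pr}} (∣1⇒≡1 p∣)
prime∤primes-above {p} n (suc k) pr h p∣ with isPrime (suc n + k)
... | false = prime∤primes-above n k pr (ℕₚ.<-trans (ℕₚ.+-monoʳ-< n ℕₚ.≤-refl) h) (subst (p ∣ⁿ_) (ℕₚ.*-identityˡ (primes-above n k)) p∣)
... | true with euclidsLemma (suc n + k) (primes-above n k) pr p∣
...   | inj₁ p∣n = ℕₚ.<⇒≱ (subst (_< p) (ℕₚ.+-suc n k) h) (ℕ∣.∣⇒≤ p∣n)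
...   | inj₂ p∣r = prime∤primes-above n k pr (ℕₚ.<-trans (ℕₚ.+-monoʳ-< n ℕₚ.≤-refl) h) p∣r

coprime-product-∣ : ∀ {a b c} → Coprime b a → a ∣ⁿ c → b ∣ⁿ c → b * a ∣ⁿ c
coprime-product-∣ {a} {b} {c} cop (divides t c≡) b∣c with coprime-divisor cop (subst (b ∣ⁿ_) (trans c≡ (ℕₚ.*-comm t a)) b∣c)
... | divides u t≡ = divides u (trans c≡ (trans (cong (_* a) t≡) (ℕₚ.*-assoc u b a)))

primes-above∣central : ∀ n k → k ≤ n → primes-above n k ∣ⁿ (n + n) choose n
primes-above∣central n zero    _   = ℕ∣.1∣ ((n + n) choose n)
primes-above∣central n (suc k) k<n with prime? (suc n + k)
... | no _ = subst (_∣ⁿ (n + n) choose n) (sym (ℕₚ.*-identityˡ (primes-above n k))) (primes-above∣central n k (ℕₚ.<⇒≤ k<n))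
... | yes pr = coprime-product-∣ (prime-coprime pr (prime∤primes-above n k pr ℕₚ.≤-refl))
  (primes-above∣central n k (ℕₚ.<⇒≤ k<n)) (prime∣central n pr (ℕₚ.m≤m+n (suc n) k) (subst (_≤ n + n) (ℕₚ.+-suc n k) (ℕₚ.+-monoʳ-≤ n k<n)))

-- Each prime above n contributes a factor greater than n. The factor n ^ π (suc n) on the right
-- avoids the difference of two values of π.
power≤primes-above : ∀ n k → n ^ π (suc n + k) ≤ primes-above n k * n ^ π (suc n)
power≤primes-above n zero    = ℕₚ.≤-reflexive (trans (cong (λ m → n ^ π m) (ℕₚ.+-identityʳ (suc n))) (sym (ℕₚ.*-identityˡ (n ^ π (suc n)))))
power≤primes-above n (suc k) = subst (λ m → n ^ π m ≤ primes-above n (suc k) * n ^ π (suc n)) (sym (ℕₚ.+-suc (suc n) k)) (step (isPrime (suc n + k)) refl)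
  where
  step : ∀ b → isPrime (suc n + k) ≡ b → n ^ ([ isPrime (suc n + k) ] + π (suc n + k)) ≤ (if isPrime (suc n + k) then suc n + k else 1) * primes-above n k * n ^ π (suc n)
  step b eq rewrite eq = pick b
    where
    pick : ∀ b → n ^ ([ b ] + π (suc n + k)) ≤ (if b then suc n + k else 1) * primes-above n k * n ^ π (suc n)
    pick true  = ℕₚ.≤-trans (ℕₚ.*-mono-≤ (ℕₚ.≤-trans (ℕₚ.n≤1+n n) (ℕₚ.m≤m+n (suc n) k)) (power≤primes-above n k)) (ℕₚ.≤-reflexive (sym (ℕₚ.*-assoc (suc n + k) (primes-above n k) (n ^ π (suc n)))))
    pick false = ℕₚ.≤-trans (power≤primes-above n k) (ℕₚ.≤-reflexive (cong (_* n ^ π (suc n)) (sym (ℕₚ.*-identityˡ (primes-above n k)))))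

central-nonzero : ∀ n → NonZero ((n + n) choose n)
central-nonzero n = ℕ.≢-nonZero λ c≡0 → ℕ.≢-nonZero⁻¹ ((n + n) !) {{(n + n) ℕₚ.!≢0}} (trans (sym (central-binomial n)) (cong (_* (n ! * n !)) c≡0))

π-doubling-power : ∀ n → n ^ π (suc n + n) ≤ 2 ^ (n + n) * n ^ π (suc n)
π-doubling-power n = ℕₚ.≤-trans (power≤primes-above n n) (ℕₚ.*-monoˡ-≤ (n ^ π (suc n))
  (ℕₚ.≤-trans (ℕ∣.∣⇒≤ {{central-nonzero n}} (primes-above∣central n n ℕₚ.≤-refl)) (binomial≤2^ (n + n) n)))

count-monotone : ∀ f {x y} → x ≤′ y → count f x ≤ count f y
count-monotone f ≤′-refl       = ℕₚ.≤-refl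
count-monotone f (≤′-step x≤y) = ℕₚ.≤-trans (count-monotone f x≤y) (ℕₚ.m≤n+m _ _)

2^-cancel-≤ : ∀ m n → 2 ^ m ≤ 2 ^ n → m ≤ n
2^-cancel-≤ m n h with m ≤? n
... | yes p = p
... | no ¬p = contradiction h (ℕₚ.<⇒≱ (ℕₚ.^-monoʳ-< 2 (s≤s (s≤s z≤n)) (ℕₚ.≰⇒> ¬p)))

-- The logarithm to base 2 of `π-doubling-power`, with κ as a lower bound for the logarithm of n.
π-doubling : ∀ κ n → 2 ^ κ ≤ n → κ * π (suc n + n) ≤ (n + n) + κ * π (suc n)
π-doubling κ n 2^κ≤n = subst (λ a → κ * a ≤ (n + n) + κ * π (suc n)) split-π (begin
  κ * (π (suc n) + δ)           ≡⟨ ℕₚ.*-distribˡ-+ κ (π (suc n)) δ ⟩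
  κ * π (suc n) + κ * δ         ≡⟨ ℕₚ.+-comm (κ * π (suc n)) (κ * δ) ⟩
  κ * δ + κ * π (suc n)         ≤⟨ ℕₚ.+-monoˡ-≤ (κ * π (suc n)) κδ≤2n ⟩
  (n + n) + κ * π (suc n)       ∎)
  where
  open ℕₚ.≤-Reasoning
  δ : ℕ
  δ = π (suc n + n) ∸ π (suc n)
  split-π : π (suc n) + δ ≡ π (suc n + n)
  split-π = ℕₚ.m+[n∸m]≡n (count-monotone isPrime (ℕₚ.≤⇒≤′ (ℕₚ.m≤m+n (suc n) n)))
  instance
    n≢0 : NonZero n
    n≢0 = ℕ.>-nonZero (ℕₚ.≤-trans (ℕₚ.m^n>0 2 κ) 2^κ≤n)
  nᵟ≤ : n ^ δ ≤ 2 ^ (n + n)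
  nᵟ≤ = ℕₚ.*-cancelʳ-≤ (n ^ δ) (2 ^ (n + n)) (n ^ π (suc n)) {{ℕₚ.m^n≢0 n (π (suc n))}} (begin
    n ^ δ * n ^ π (suc n)            ≡⟨ sym (ℕₚ.^-distribˡ-+-* n δ (π (suc n))) ⟩
    n ^ (δ + π (suc n))              ≡⟨ cong (n ^_) (trans (ℕₚ.+-comm δ (π (suc n))) split-π) ⟩
    n ^ π (suc n + n)                ≤⟨ π-doubling-power n ⟩
    2 ^ (n + n) * n ^ π (suc n)      ∎)
  κδ≤2n : κ * δ ≤ n + n
  κδ≤2n = 2^-cancel-≤ (κ * δ) (n + n) (begin
    2 ^ (κ * δ)      ≡⟨ sym (ℕₚ.^-*-assoc 2 κ δ) ⟩
    (2 ^ κ) ^ δ      ≤⟨ ℕₚ.^-monoˡ-≤ δ 2^κ≤n ⟩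
    n ^ δ            ≤⟨ nᵟ≤ ⟩
    2 ^ (n + n)      ∎)

n≤2^n : ∀ n → n ≤ 2 ^ n
n≤2^n zero    = z≤n
n≤2^n (suc n) = ℕₚ.≤-trans (ℕₚ.+-mono-≤ (ℕₚ.m^n>0 2 n) (n≤2^n n)) (ℕₚ.≤-reflexive (cong (λ t → 2 ^ n + t) (sym (ℕₚ.+-identityʳ (2 ^ n)))))

-- Doubling n costs 2 n on top of the bound 4 (n + 1), and 6 n + 4 is less than four times the
-- doubled argument. The constant covers the range in which 2 ^ κ ≤ n fails. As κ is arbitrary, π x
-- is o(x).
prime-density : ∀ κ x → κ * π x ≤ κ * (2 + (2 ^ κ + 2 ^ κ)) + 4 * x
prime-density κ = <-rec _ step
  where
  open ℕₚ.≤-Reasoning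
  c : ℕ
  c = κ * (2 + (2 ^ κ + 2 ^ κ))
  small : ∀ x → x ≤ 2 + (2 ^ κ + 2 ^ κ) → κ * π x ≤ c + 4 * x
  small x h = ℕₚ.≤-trans (ℕₚ.*-monoʳ-≤ κ (ℕₚ.≤-trans (count≤ isPrime x) h)) (ℕₚ.m≤m+n c (4 * x))
  step : ∀ x → (∀ {y} → y < x → κ * π y ≤ c + 4 * y) → κ * π x ≤ c + 4 * x
  step zero rec = small 0 z≤n
  step (suc x) rec with suc x ≤? 2 + (2 ^ κ + 2 ^ κ)
  ... | yes h = small (suc x) h
  ... | no ¬h = by-parity (halve x)
    where
    large : ∀ {n} → x ≤ 1 + n * 2 → 2 ^ κ ≤ n
    large {n} x≤ with 2 ^ κ ≤? n
    ... | yes h = h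
    ... | no h = contradiction (begin
      suc x                        ≤⟨ s≤s x≤ ⟩
      2 + n * 2                    ≤⟨ ℕₚ.+-monoʳ-≤ 2 (ℕₚ.*-monoˡ-≤ 2 (ℕₚ.<⇒≤ (ℕₚ.≰⇒> h))) ⟩
      2 + 2 ^ κ * 2                ≡⟨ cong (λ t → 2 + t) (double (2 ^ κ)) ⟩
      2 + (2 ^ κ + 2 ^ κ)          ∎) ¬h
      where
      double : ∀ a → a * 2 ≡ a + a
      double = solve-∀
    odd-case : ∀ n → n < x → 2 ^ κ ≤ n → κ * π (suc n + n) ≤ c + (6 * n + 4)
    odd-case n n<x h = begin
      κ * π (suc n + n)                  ≤⟨ π-doubling κ n h ⟩
      (n + n) + κ * π (suc n)            ≤⟨ ℕₚ.+-monoʳ-≤ (n + n) (rec (s≤s n<x)) ⟩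
      (n + n) + (c + 4 * suc n)          ≡⟨ lemma n c ⟩
      c + (6 * n + 4)                    ∎
      where
      lemma : ∀ n c → (n + n) + (c + 4 * suc n) ≡ c + (6 * n + 4)
      lemma = solve-∀
    0<n : ∀ {n} → 2 ^ κ ≤ n → 0 < n
    0<n h = ℕₚ.≤-trans (ℕₚ.m^n>0 2 κ) h
    n<2n : ∀ {n} → 2 ^ κ ≤ n → n < n + n
    n<2n {n} h = ℕₚ.m<m+n n (0<n h)
    double′ : ∀ n → n * 2 ≡ n + n
    double′ = solve-∀
    by-parity : ∃[ n ] (x ≡ n * 2 ⊎ x ≡ 1 + n * 2) → κ * π (suc x) ≤ c + 4 * suc x
    by-parity (n , inj₁ x≡) = begin
      κ * π (suc x)                ≡⟨ cong (λ m → κ * π (suc m)) x≡2n ⟩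
      κ * π (suc n + n)            ≤⟨ odd-case n (subst (n <_) (sym x≡2n) (n<2n h)) h ⟩
      c + (6 * n + 4)              ≤⟨ ℕₚ.+-monoʳ-≤ c (subst (6 * n + 4 ≤_) (sym (lemma n)) (ℕₚ.m≤m+n (6 * n + 4) (2 * n))) ⟩
      c + 4 * suc (n + n)          ≡⟨ cong (λ m → c + 4 * suc m) (sym x≡2n) ⟩
      c + 4 * suc x                ∎
      where
      h : 2 ^ κ ≤ n
      h = large (ℕₚ.≤-trans (ℕₚ.≤-reflexive x≡) (ℕₚ.n≤1+n (n * 2)))
      x≡2n : x ≡ n + n
      x≡2n = trans x≡ (double′ n)
      lemma : ∀ n → 4 * suc (n + n) ≡ 6 * n + 4 + 2 * n
      lemma = solve-∀
    by-parity (n , inj₂ x≡) = begin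
      κ * π (suc x)                          ≡⟨ cong (λ m → κ * π (suc m)) x≡2n+1 ⟩
      κ * ([ isPrime (suc n + n) ] + π (suc n + n)) ≤⟨ ℕₚ.*-monoʳ-≤ κ (ℕₚ.+-monoˡ-≤ (π (suc n + n)) (b≤1 (isPrime (suc n + n)))) ⟩
      κ * (1 + π (suc n + n))                ≡⟨ ℕₚ.*-suc κ (π (suc n + n)) ⟩
      -- The one additional candidate for a prime costs κ ≤ 2 ^ κ ≤ n.
      κ + κ * π (suc n + n)                  ≤⟨ ℕₚ.+-mono-≤ (ℕₚ.≤-trans (n≤2^n κ) h) (odd-case n (subst (n <_) (sym x≡2n+1) (ℕₚ.m≤n⇒m≤1+n (n<2n h))) h) ⟩
      n + (c + (6 * n + 4))                  ≤⟨ subst (n + (c + (6 * n + 4)) ≤_) (sym (lemma n c)) (ℕₚ.m≤m+n (n + (c + (6 * n + 4))) (n + 4)) ⟩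
      c + 4 * suc (suc (n + n))              ≡⟨ cong (λ m → c + 4 * suc m) (sym x≡2n+1) ⟩
      c + 4 * suc x                          ∎
      where
      h : 2 ^ κ ≤ n
      h = large (ℕₚ.≤-reflexive x≡)
      x≡2n+1 : x ≡ suc (n + n)
      x≡2n+1 = trans x≡ (cong suc (double′ n))
      b≤1 : ∀ b → [ b ] ≤ 1
      b≤1 true  = ℕₚ.≤-refl
      b≤1 false = z≤n
      lemma : ∀ n c → c + 4 * suc (suc (n + n)) ≡ n + (c + (6 * n + 4)) + (n + 4)
      lemma = solve-∀

-- Values of the form p s² have density zero

-- The clause for 0 is a default: the values considered are positive, so `divisible 0` never holds.
quotient-by-square : ℕ → ℕ → ℕ
quotient-by-square zero    N = 0
quotient-by-square (suc s) N = N / (suc s * suc s)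

anyBelow : ℕ → (ℕ → ℕ → Bool) → ℕ → Bool
anyBelow zero    F n = false
anyBelow (suc S) F n = anyBelow S F n ∨ F S n

anyFrom : ℕ → ℕ → (ℕ → ℕ → Bool) → ℕ → Bool
anyFrom S zero    F n = false
anyFrom S (suc L) F n = F S n ∨ anyFrom (suc S) L F n

∨-trueˡ : ∀ {a b} → a ≡ true → a ∨ b ≡ true
∨-trueˡ refl = refl

∨-trueʳ : ∀ {a b} → b ≡ true → a ∨ b ≡ true
∨-trueʳ {true}  _ = refl
∨-trueʳ {false} p = p

anyBelow-intro : ∀ {S F n} s → s < S → F s n ≡ true → anyBelow S F n ≡ true
anyBelow-intro {suc S} {F} {n} s s<S p with s ≟ S
... | yes refl = ∨-trueʳ {anyBelow S F n} p
... | no s≢S   = ∨-trueˡ (anyBelow-intro {S} {F} {n} s (ℕₚ.≤∧≢⇒< (ℕₚ.≤-pred s<S) s≢S) p)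

anyFrom-intro : ∀ {S} L {F n} s → S ≤ s → s < S + L → F s n ≡ true → anyFrom S L F n ≡ true
anyFrom-intro {S} zero s S≤s s< p = contradiction (subst (s <_) (ℕₚ.+-identityʳ S) s<) (ℕₚ.≤⇒≯ S≤s)
anyFrom-intro {S} (suc L) {F} {n} s S≤s s< p with S ≟ s
... | yes refl = ∨-trueˡ p
... | no S≢s   = ∨-trueʳ {F S n} (anyFrom-intro {suc S} L {F} {n} s (ℕₚ.≤∧≢⇒< S≤s S≢s) (subst (s <_) (ℕₚ.+-suc S L) s<) p)

count-none : ∀ x → count (λ _ → false) x ≡ 0
count-none zero    = refl
count-none (suc x) = count-none x

count-anyBelow : ∀ {F x b} S → (∀ s → count (F s) x ≤ b) → count (anyBelow S F) x ≤ S * b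
count-anyBelow {x = x} zero h = ℕₚ.≤-reflexive (count-none x)
count-anyBelow {F} {x} {b} (suc S) h = ℕₚ.≤-trans (count-∨ (anyBelow S F) (F S) x)
  (ℕₚ.≤-trans (ℕₚ.+-mono-≤ (count-anyBelow {F} {x} {b} S h) (h S)) (ℕₚ.≤-reflexive (ℕₚ.+-comm (S * b) b)))

-- The tail Σ_{s>S} Z/s² telescopes against Z/S.
count-anyFrom : ∀ {F x Z} S L → (∀ s → count (F (suc s)) x * (suc s * suc s) ≤ Z) → S * count (anyFrom (suc S) L F) x ≤ Z
count-anyFrom {F} {x} {Z} S zero h = ℕₚ.≤-trans (ℕₚ.≤-reflexive (trans (cong (S *_) (count-none x)) (ℕₚ.*-zeroʳ S))) z≤n
count-anyFrom {F} {x} {Z} S (suc L) h = ℕₚ.*-cancelˡ-≤ (suc S) (begin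
  suc S * (S * count (λ n → F (suc S) n ∨ anyFrom (suc (suc S)) L F n) x)
    ≤⟨ ℕₚ.*-monoʳ-≤ (suc S) (ℕₚ.*-monoʳ-≤ S (count-∨ (F (suc S)) (anyFrom (suc (suc S)) L F) x)) ⟩
  suc S * (S * (a + u))
    ≡⟨ lemma S a u ⟩
  a * (suc S * S) + S * (suc S * u)
    ≤⟨ ℕₚ.+-mono-≤ (ℕₚ.*-monoʳ-≤ a (ℕₚ.*-monoʳ-≤ (suc S) (ℕₚ.n≤1+n S))) (ℕₚ.*-monoʳ-≤ S (count-anyFrom {F} {x} {Z} (suc S) L h)) ⟩
  a * (suc S * suc S) + S * Z
    ≤⟨ ℕₚ.+-monoˡ-≤ (S * Z) (h S) ⟩
  suc S * Z ∎)
  where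
  open ℕₚ.≤-Reasoning
  a u : ℕ
  a = count (F (suc S)) x
  u = count (anyFrom (suc (suc S)) L F) x
  lemma : ∀ S a u → suc S * (S * (a + u)) ≡ a * (suc S * S) + S * (suc S * u)
  lemma = solve-∀

module SparseValues (a : ℕ) (1≤a : 1 ≤ a) (a≤79 : a ≤ 79) where

  value : ℕ → ℕ
  value n = a + 120 * n

  private
    value-injective : ∀ {m n} → value m ≡ value n → m ≡ n
    value-injective {m} {n} p = ℕₚ.*-cancelˡ-≡ m n 120 (ℕₚ.+-cancelˡ-≡ a (120 * m) (120 * n) p)

    bound : ℕ → ℕ
    bound x = a + 120 * x

    value≤bound : ∀ {n x} → n < x → value n ≤ bound x
    value≤bound n<x = ℕₚ.+-monoʳ-≤ a (ℕₚ.*-monoʳ-≤ 120 (ℕₚ.<⇒≤ n<x))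

    divisible : ℕ → ℕ → Bool
    divisible s n = does (quotient-by-square s (value n) * (s * s) ≟ value n)

    prime-quotient : ℕ → ℕ → Bool
    prime-quotient s n = divisible s n ∧ isPrime (quotient-by-square s (value n))

    quotient-injective : ∀ s m n → divisible s m ≡ true → divisible s n ≡ true →
                         quotient-by-square s (value m) ≡ quotient-by-square s (value n) → m ≡ n
    quotient-injective s m n dm dn p = value-injective (trans (sym (does-true (_ ≟ value m) dm))
      (trans (cong (λ t → t * (s * s)) p) (does-true (_ ≟ value n) dn)))

    quotient≤ : ∀ s N → quotient-by-square s N ≤ N
    quotient≤ zero    N = z≤n
    quotient≤ (suc s) N = ℕₚ.≤-trans (ℕₚ.m≤m*n (N / (suc s * suc s)) (suc s * suc s)) (m/n*n≤m N (suc s * suc s))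

    -- For fixed s the quotient by s² determines n, and it is a prime not exceeding the bound.
    count-prime-quotient : ∀ x s → count (prime-quotient s) x ≤ π (suc (bound x))
    count-prime-quotient x s = count-injection {prime-quotient s} isPrime x (suc (bound x)) (λ n → quotient-by-square s (value n))
      (λ n n<x p → s≤s (ℕₚ.≤-trans (quotient≤ s (value n)) (value≤bound n<x)) , proj₂ (∧-true {divisible s n} p))
      (λ m n _ _ pm pn → quotient-injective s m n (proj₁ (∧-true {divisible s m} pm)) (proj₁ (∧-true {divisible s n} pn)))

    count-divisible : ∀ x s → count (divisible (suc s)) x * (suc s * suc s) ≤ bound x
    count-divisible x s = ℕₚ.≤-trans (ℕₚ.*-monoˡ-≤ (suc s * suc s) (ℕₚ.≤-trans injection (count≤ (λ _ → true) (bound x / (suc s * suc s))))) (m/n*n≤m (bound x) (suc s * suc s))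
      where
      m/s² : ℕ → ℕ
      m/s² n = quotient-by-square (suc s) (value n)
      q≢0 : ∀ n → divisible (suc s) n ≡ true → m/s² n ≢ 0
      q≢0 n d q≡0 = ℕₚ.<⇒≢ (ℕₚ.≤-trans 1≤a (ℕₚ.m≤m+n a (120 * n))) (trans (sym (cong (λ t → t * (suc s * suc s)) q≡0)) (does-true (_ ≟ value n) d))
      pred-injective : ∀ {u v} → u ≢ 0 → v ≢ 0 → u ∸ 1 ≡ v ∸ 1 → u ≡ v
      pred-injective {zero}          u≢0 _   _ = contradiction refl u≢0
      pred-injective {suc u} {zero}  _   v≢0 _ = contradiction refl v≢0
      pred-injective {suc u} {suc v} _   _   p = cong suc p
      pred< : ∀ {u v} → u ≢ 0 → u ≤ v → u ∸ 1 < v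
      pred< {zero}  u≢0 _ = contradiction refl u≢0
      pred< {suc u} _   h = h
      injection : count (divisible (suc s)) x ≤ count (λ _ → true) (bound x / (suc s * suc s))
      -- The quotients lie between 1 and bound x / s². Subtracting 1 maps them strictly below the
      -- upper end and avoids an error of 1 for each s, which the sum over all s could not afford.
      injection = count-injection {divisible (suc s)} (λ _ → true) x (bound x / (suc s * suc s)) (λ n → m/s² n ∸ 1)
        (λ n n<x d → pred< (q≢0 n d) (/-monoˡ-≤ (suc s * suc s) (value≤bound n<x)) , refl)
        (λ m n _ _ dm dn p → quotient-injective (suc s) m n dm dn (pred-injective (q≢0 m dm) (q≢0 n dn) p))

    -- If s ≤ S, the quotient by s² is recognised as a prime; if s > S, divisibility by s² alone is
    -- recorded. The second range is finite because s ≤ p s².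
    covered : ∀ S x n → n < x → PrimeTimesSquare (value n) →
              anyBelow (suc S) prime-quotient n ∨ anyFrom (suc S) (bound x) divisible n ≡ true
    covered S x n n<x (p , s , pr , v≡) = by-size s v≡
      where
      by-size : ∀ s → value n ≡ p * (s * s) → anyBelow (suc S) prime-quotient n ∨ anyFrom (suc S) (bound x) divisible n ≡ true
      by-size zero v≡ = contradiction (sym (trans v≡ (ℕₚ.*-zeroʳ p))) (ℕₚ.<⇒≢ (ℕₚ.≤-trans 1≤a (ℕₚ.m≤m+n a (120 * n))))
      by-size (suc s) v≡ = split-at (suc s ≤? S)
        where
        q≡p : quotient-by-square (suc s) (value n) ≡ p
        q≡p = trans (cong (λ v → v / (suc s * suc s)) v≡) (m*n/n≡m p (suc s * suc s))
        d : divisible (suc s) n ≡ true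
        d = dec-true (quotient-by-square (suc s) (value n) * (suc s * suc s) ≟ value n) (trans (cong (λ t → t * (suc s * suc s)) q≡p) (sym v≡))
        s≤bound : suc s ≤ bound x
        s≤bound = ℕₚ.≤-trans (n≤n² (suc s)) (ℕₚ.≤-trans (ℕₚ.m≤n*m (suc s * suc s) p {{prime⇒nonZero pr}}) (ℕₚ.≤-trans (ℕₚ.≤-reflexive (sym v≡)) (value≤bound n<x)))
        split-at : Dec (suc s ≤ S) → anyBelow (suc S) prime-quotient n ∨ anyFrom (suc S) (bound x) divisible n ≡ true
        split-at (yes h) = ∨-trueˡ (anyBelow-intro {suc S} {prime-quotient} {n} (suc s) (s≤s h)
          (cong₂ _∧_ d (trans (cong isPrime q≡p) (dec-true (prime? p) pr))))
        split-at (no h) = ∨-trueʳ {anyBelow (suc S) prime-quotient n} (anyFrom-intro {suc S} (bound x) {divisible} {n} (suc s) (ℕₚ.≰⇒> h)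
          (s≤s (ℕₚ.≤-trans s≤bound (ℕₚ.m≤n+m (bound x) S))) d)

  sparse : ∀ f → (∀ n → f n ≡ true → PrimeTimesSquare (value n)) → DensityZero f
  sparse f h k = suc c , λ x c<x → ℕₚ.*-cancelˡ-≤ 2 (estimate x c<x)
    where
    -- Each of the two ranges of s may use x / (2 K). With bound x < 200 x the tail beyond S is at
    -- most 200 x / S, whence S = 400 K. For the S + 1 smaller s the prime bound gives κ P ≤ c + 800
    -- x ≤ 801 x once x > c, and 1600 is ample for 801.
    K S κ c : ℕ
    K = suc k
    S = 400 * K
    κ = 1600 * (2 * K * suc S)
    c = κ * (2 + (2 ^ κ + 2 ^ κ))
    open ℕₚ.≤-Reasoning
    estimate : ∀ x → c < x → 2 * (K * count f x) ≤ 2 * x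
    estimate x c<x = begin
      2 * (K * count f x)          ≤⟨ ℕₚ.*-monoʳ-≤ 2 (ℕₚ.*-monoʳ-≤ K count-f) ⟩
      2 * (K * (suc S * P + T))    ≡⟨ lemma₁ K (suc S) P T ⟩
      2 * K * suc S * P + 2 * K * T ≤⟨ ℕₚ.+-mono-≤ small large ⟩
      x + x                        ≡⟨ cong (λ t → x + t) (sym (ℕₚ.+-identityʳ x)) ⟩
      2 * x                        ∎
      where
      P T : ℕ
      P = π (suc (bound x))
      T = count (anyFrom (suc S) (bound x) divisible) x
      lemma₁ : ∀ K S P T → 2 * (K * (S * P + T)) ≡ 2 * K * S * P + 2 * K * T
      lemma₁ = solve-∀
      count-f : count f x ≤ suc S * P + T
      count-f = begin
        count f x
          ≤⟨ count-mono {f} {λ n → anyBelow (suc S) prime-quotient n ∨ anyFrom (suc S) (bound x) divisible n} x (λ n n<x fn → covered S x n n<x (h n fn)) ⟩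
        count (λ n → anyBelow (suc S) prime-quotient n ∨ anyFrom (suc S) (bound x) divisible n) x
          ≤⟨ count-∨ (anyBelow (suc S) prime-quotient) (anyFrom (suc S) (bound x) divisible) x ⟩
        count (anyBelow (suc S) prime-quotient) x + T
          ≤⟨ ℕₚ.+-monoˡ-≤ T (count-anyBelow {prime-quotient} {x} {P} (suc S) (count-prime-quotient x)) ⟩
        suc S * P + T ∎
      1≤x : 1 ≤ x
      1≤x = ℕₚ.≤-trans (s≤s z≤n) c<x
      bound< : suc (bound x) ≤ 200 * x
      bound< = begin
        suc (a + 120 * x)        ≤⟨ ℕₚ.+-monoˡ-≤ (120 * x) {suc a} {80} (s≤s a≤79) ⟩
        80 + 120 * x             ≤⟨ ℕₚ.+-monoˡ-≤ (120 * x) {80} {80 * x} (ℕₚ.*-monoʳ-≤ 80 {1} {x} 1≤x) ⟩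
        80 * x + 120 * x         ≡⟨ sym (ℕₚ.*-distribʳ-+ x 80 120) ⟩
        200 * x                  ∎
      large : 2 * K * T ≤ x
      large = ℕₚ.*-cancelˡ-≤ 200 (begin
        200 * (2 * K * T)        ≡⟨ lemma₂ K T ⟩
        S * T                    ≤⟨ count-anyFrom {divisible} {x} {bound x} S (bound x) (count-divisible x) ⟩
        bound x                  ≤⟨ ℕₚ.n≤1+n (bound x) ⟩
        suc (bound x)            ≤⟨ bound< ⟩
        200 * x                  ∎)
        where
        lemma₂ : ∀ K T → 200 * (2 * K * T) ≡ 400 * K * T
        lemma₂ = solve-∀
      small : 2 * K * suc S * P ≤ x
      small = ℕₚ.*-cancelˡ-≤ 1600 (begin
        1600 * (2 * K * suc S * P)      ≡⟨ sym (ℕₚ.*-assoc 1600 (2 * K * suc S) P) ⟩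
        κ * P                           ≤⟨ prime-density κ (suc (bound x)) ⟩
        c + 4 * suc (bound x)           ≤⟨ ℕₚ.+-mono-≤ (ℕₚ.<⇒≤ c<x) (ℕₚ.*-monoʳ-≤ 4 bound<) ⟩
        x + 4 * (200 * x)               ≡⟨ lemma₃ x ⟩
        801 * x                         ≤⟨ ℕₚ.*-monoˡ-≤ x (ℕₚ.m≤m+n 801 799) ⟩
        1600 * x                        ∎)
        where
        lemma₃ : ∀ x → x + 4 * (200 * x) ≡ 801 * x
        lemma₃ = solve-∀

theorem9 : DensityZero (parityDiffers (λ n → b200 (25 * (5 * n + 2) ∸ 26)) (λ n → p17 (5 * n + 2)))
    × DensityZero (parityDiffers (λ n → b200 (25 * (5 * n + 4) ∸ 26)) (λ n → p17 (5 * n + 4)))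
theorem9 =
    SparseValues.sparse 31 (s≤s z≤n) (ℕₚ.m≤m+n 31 48) (parityDiffers (λ n → b200 (25 * (5 * n + 2) ∸ 26)) (λ n → p17 (5 * n + 2)))
      (λ n p → Representations.odd-representations⇒prime-times-square 0 n z≤n (Coprimality.gcd≡1⇒coprime refl) (inj₁ refl) (differ₂⇒representations n p))
  , SparseValues.sparse 79 (s≤s z≤n) ℕₚ.≤-refl (parityDiffers (λ n → b200 (25 * (5 * n + 4) ∸ 26)) (λ n → p17 (5 * n + 4)))
      (λ n p → Representations.odd-representations⇒prime-times-square 2 n (s≤s (s≤s z≤n)) (Coprimality.gcd≡1⇒coprime refl) (inj₂ refl) (differ₄⇒representations n p))
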